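{- There exist absolute constants $\delta_0 > 0$ and $C > 0$ such that the following holds. Let $N \geq 1$ be an integer, let $x_1, \dots, x_N \in \mathbb{T}$ and let $0 < \delta \leq \delta_0$. Suppose that $$ \frac{1}{N} \# \left\{ (m,n) : 1 \leq m, n \leq N,\ m \neq n,\ |x_m - x_n| \leq \frac{s}{N} \right\} \leq (1+\delta)\,2s \qquad \text{for all real } s \text{ with } 1 \leq s \leq \frac{8}{\delta}\sqrt{\log N}. $$ Then $$ \sum_{\substack{k \in \mathbb{Z},\ k \neq 0 \\ |k| \leq \delta^{3/2} N}} \left| \sum_{n=1}^{N} e^{2 \pi i k x_n} \right|^2 \leq C\, \delta N^2 . $$
   Context: $\mathbb{T} = \mathbb{R}/\mathbb{Z}$ is the one-dimensional torus, identified with $[0,1]$ with endpoints glued. For $x,y \in \mathbb{T}$, $|x-y|$ denotes the distance on the torus, i.e. the distance from $x-y$ to the nearest integer. Pairs $(m,n)$ are ordered, and points are counted by index. $\log$ is the natural logarithm. -}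

module Defs where

open import Data.Nat as ℕ using (ℕ; zero; suc; NonZero)
import Data.Nat.Properties as ℕₚ
open import Data.Integer as ℤ using (ℤ; +_)
import Data.Integer.Properties as ℤₚ
import Data.Integer.DivMod as ℤᵈ
open import Data.Rational as ℚ using (ℚ; 0ℚ; 1ℚ; ½)
import Data.Rational.Properties as ℚₚ
open import Data.Rational.Solver using (module +-*-Solver)
open import Data.Fin using (Fin)
open import Data.List using (List; length; map; foldr)
open import Data.List.Membership.Propositional using (_∈_)
open import Data.List.Relation.Unary.Unique.Propositional using (Unique)
import Data.Vec.Functional as Vector
open import Data.Product using (_×_; _,_; proj₁; proj₂; ∃-syntax)
open import Data.Sum using (_⊎_; inj₁; inj₂)
open import Function using (_⇔_)
open import Relation.Nullary using (¬_)
open import Relation.Binary.PropositionalEquality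
  using (_≡_; refl; sym; trans; cong; cong₂; subst; subst₂)

module RationalFacts where

  open import Data.Rational
  open import Data.Rational.Literals using (fromℤ)
  open ℚₚ
  open +-*-Solver
  open import Relation.Binary.Definitions using (tri<; tri≈; tri>)
  open import Algebra.Definitions.RawSemiring +-*-rawSemiring public using (_^_)

  infix 4 _≤ₙ_
  _≤ₙ_ : ℕ → ℕ → Set
  _≤ₙ_ = ℕ._≤_

  ≤-by : ∀ {p q r} → 0ℚ ≤ r → p + r ≡ q → p ≤ q
  ≤-by {p} {q} {r} 0≤r eq =
    subst₂ _≤_ (+-identityʳ p) eq (+-monoʳ-≤ p 0≤r)

  <-by : ∀ {p q r} → 0ℚ < r → p + r ≡ q → p < q
  <-by {p} {q} {r} 0<r eq =
    subst₂ _<_ (+-identityʳ p) eq (+-monoʳ-< p 0<r)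

  diff≥0 : ∀ {p q} → p ≤ q → 0ℚ ≤ q - p
  diff≥0 {p} {q} p≤q = subst₂ _≤_ (+-inverseʳ p) refl (+-monoˡ-≤ (- p) p≤q)

  diff>0 : ∀ {p q} → p < q → 0ℚ < q - p
  diff>0 {p} {q} p<q = subst₂ _<_ (+-inverseʳ p) refl (+-monoˡ-< (- p) p<q)

  +≥0 : ∀ {p q} → 0ℚ ≤ p → 0ℚ ≤ q → 0ℚ ≤ p + q
  +≥0 = +-mono-≤

  *-monoˡ : ∀ {p q r} → 0ℚ ≤ r → p ≤ q → r * p ≤ r * q
  *-monoˡ {r = r} 0≤r = *-monoˡ-≤-nonNeg r {{nonNegative 0≤r}}

  *-monoʳ : ∀ {p q r} → 0ℚ ≤ r → p ≤ q → p * r ≤ q * r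
  *-monoʳ {r = r} 0≤r = *-monoʳ-≤-nonNeg r {{nonNegative 0≤r}}

  *≥0 : ∀ {p q} → 0ℚ ≤ p → 0ℚ ≤ q → 0ℚ ≤ p * q
  *≥0 {p} 0≤p 0≤q = subst₂ _≤_ (*-zeroʳ p) refl (*-monoˡ 0≤p 0≤q)

  *>0 : ∀ {p q} → 0ℚ < p → 0ℚ < q → 0ℚ < p * q
  *>0 {p} {q} 0<p 0<q =
    subst₂ _<_ (*-zeroʳ p) refl (*-monoʳ-<-pos p {{positive 0<p}} 0<q)

  *-mono : ∀ {p q r s} → 0ℚ ≤ q → 0ℚ ≤ r → p ≤ q → r ≤ s → p * r ≤ q * s
  *-mono 0≤q 0≤r p≤q r≤s = ≤-trans (*-monoʳ 0≤r p≤q) (*-monoˡ 0≤q r≤s)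

  neg-mono : ∀ {p q} → p ≤ q → - q ≤ - p
  neg-mono = neg-antimono-≤

  neg²  : ∀ p → - (- p) ≡ p
  neg² p = solve 1 (λ a → :- (:- a) := a) refl p

  0≤1 : 0ℚ ≤ 1ℚ
  0≤1 = nonNegative⁻¹ 1ℚ

  0<1 : 0ℚ < 1ℚ
  0<1 = positive⁻¹ 1ℚ

  0<½ : 0ℚ < ½
  0<½ = positive⁻¹ ½

  ⅓ : ℚ
  ⅓ = + 1 / 3

  0<⅓ : 0ℚ < ⅓
  0<⅓ = positive⁻¹ ⅓

  ≤∣∣ : ∀ p → p ≤ ∣ p ∣
  ≤∣∣ p with ≤-total 0ℚ p
  ... | inj₁ 0≤p = ≤-reflexive (sym (0≤p⇒∣p∣≡p 0≤p))
  ... | inj₂ p≤0 = ≤-trans p≤0 (0≤∣p∣ p)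

  -≤∣∣ : ∀ p → - p ≤ ∣ p ∣
  -≤∣∣ p = subst (- p ≤_) (∣-p∣≡∣p∣ p) (≤∣∣ (- p))

  ∣∣≤ : ∀ {p q} → p ≤ q → - p ≤ q → ∣ p ∣ ≤ q
  ∣∣≤ {p} p≤q -p≤q with ∣p∣≡p∨∣p∣≡-p p
  ... | inj₁ e = subst (_≤ _) (sym e) p≤q
  ... | inj₂ e = subst (_≤ _) (sym e) -p≤q

  ∣∣-sym : ∀ p q → ∣ p - q ∣ ≡ ∣ q - p ∣
  ∣∣-sym p q = trans (sym (∣-p∣≡∣p∣ (p - q)))
    (cong ∣_∣ (solve 2 (λ a b → :- (a :- b) := b :- a) refl p q))

  ∣∣-triangle : ∀ p q r → ∣ p - r ∣ ≤ ∣ p - q ∣ + ∣ q - r ∣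
  ∣∣-triangle p q r = subst (λ t → ∣ t ∣ ≤ ∣ p - q ∣ + ∣ q - r ∣)
    (solve 3 (λ a b c → (a :- b) :+ (b :- c) := a :- c) refl p q r)
    (∣p+q∣≤∣p∣+∣q∣ (p - q) (q - r))

  fromℤ≡/1 : ∀ i → fromℤ i ≡ i / 1
  fromℤ≡/1 i = sym (↥p/↧p≡p (fromℤ i))

  fromℤ-+ : ∀ i j → fromℤ (i ℤ.+ j) ≡ fromℤ i + fromℤ j
  fromℤ-+ i j = trans (fromℤ≡/1 (i ℤ.+ j))
    (cong (_/ 1) (sym (cong₂ ℤ._+_ (ℤₚ.*-identityʳ i) (ℤₚ.*-identityʳ j))))

  fromℤ-mono : ∀ {i j} → i ℤ.≤ j → fromℤ i ≤ fromℤ j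
  fromℤ-mono {i} {j} i≤j =
    *≤* (subst₂ ℤ._≤_ (sym (ℤₚ.*-identityʳ i)) (sym (ℤₚ.*-identityʳ j)) i≤j)

  fromℕ : ℕ → ℚ
  fromℕ n = fromℤ (+ n)

  fromℕ-suc : ∀ n → fromℕ (suc n) ≡ 1ℚ + fromℕ n
  fromℕ-suc n = fromℤ-+ (+ 1) (+ n)

  fromℕ-mono : ∀ {m n} → m ≤ₙ n → fromℕ m ≤ fromℕ n
  fromℕ-mono m≤n = fromℤ-mono (ℤ.+≤+ m≤n)

  fromℕ≥0 : ∀ n → 0ℚ ≤ fromℕ n
  fromℕ≥0 n = fromℕ-mono (ℕ.z≤n {n})

  ⌊⌋≤ : ∀ p → fromℤ (floor p) ≤ p
  ⌊⌋≤ p@record{} = *≤* (subst (floor p ℤ.* ↧ p ℤ.≤_) (sym (ℤₚ.*-identityʳ (↥ p)))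
    (ℤᵈ.[n/d]*d≤n (↥ p) (↧ p)))

  <⌊⌋+1 : ∀ p → p < fromℤ (ℤ.suc (floor p))
  <⌊⌋+1 p@record{} = *<* (subst (ℤ._< ℤ.suc (floor p) ℤ.* ↧ p)
    (sym (ℤₚ.*-identityʳ (↥ p)))
    (subst (λ f → ↥ p ℤ.< ℤ.suc f ℤ.* ↧ p) (sym (ℤᵈ.div-pos-is-/ℕ (↥ p) (↧ₙ p)))
      (ℤᵈ.n<s[n/ℕd]*d (↥ p) (↧ₙ p))))

  archimedean : ∀ p → ∃[ n ] p ≤ fromℕ n
  archimedean p = n , ≤-trans (<⇒≤ (<⌊⌋+1 p)) (fromℤ-mono (i≤∣i∣ _))
    where
    i≤∣i∣ : ∀ i → i ℤ.≤ + ℤ.∣ i ∣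
    i≤∣i∣ (+ k)        = ℤₚ.≤-refl
    i≤∣i∣ (ℤ.-[1+ k ]) = ℤ.-≤+
    n = ℤ.∣ ℤ.suc (floor p) ∣

  inv : ∀ {p} → 0ℚ < p → ℚ
  inv {p} 0<p = (1/ p) {{>-nonZero 0<p}}

  inv-inverse : ∀ {p} (0<p : 0ℚ < p) → p * inv 0<p ≡ 1ℚ
  inv-inverse {p} 0<p = *-inverseʳ p {{>-nonZero 0<p}}

  inv>0 : ∀ {p} (0<p : 0ℚ < p) → 0ℚ < inv 0<p
  inv>0 {p} 0<p = positive⁻¹ _ {{1/pos⇒pos p {{positive 0<p}}}}

  ^≥0 : ∀ {p} → 0ℚ ≤ p → ∀ n → 0ℚ ≤ p ^ n
  ^≥0 0≤p zero    = 0≤1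
  ^≥0 0≤p (suc n) = *≥0 0≤p (^≥0 0≤p n)

  ^-mono : ∀ {p q} → 0ℚ ≤ p → p ≤ q → ∀ n → p ^ n ≤ q ^ n
  ^-mono 0≤p p≤q zero    = ≤-refl
  ^-mono 0≤p p≤q (suc n) =
    *-mono (≤-trans 0≤p p≤q) (^≥0 0≤p n) p≤q (^-mono 0≤p p≤q n)

  ∣^∣≤ : ∀ {p q} → ∣ p ∣ ≤ q → ∀ n → ∣ p ^ n ∣ ≤ q ^ n
  ∣^∣≤ ∣p∣≤q zero = ≤-refl
  ∣^∣≤ {p} {q} ∣p∣≤q (suc n) = subst (_≤ q * q ^ n) (sym (∣p*q∣≡∣p∣*∣q∣ p (p ^ n)))
    (*-mono (≤-trans (0≤∣p∣ p) ∣p∣≤q) (0≤∣p∣ (p ^ n)) ∣p∣≤q (∣^∣≤ ∣p∣≤q n))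

  1/suc : ℕ → ℚ
  1/suc n = + 1 / suc n

  1/suc>0 : ∀ n → 0ℚ < 1/suc n
  1/suc>0 n = positive⁻¹ _ {{normalize-pos 1 (suc n)}}

  suc*1/suc : ∀ n → fromℕ (suc n) * 1/suc n ≡ 1ℚ
  suc*1/suc n = toℚᵘ-injective (ℚᵘₚ.≃-trans (toℚᵘ-homo-* (fromℕ (suc n)) (1/suc n))
    (ℚᵘₚ.≃-trans (ℚᵘₚ.*-congˡ {toℚᵘ (fromℕ (suc n))} (toℚᵘ-fromℚᵘ (ℚᵘ.mkℚᵘ (+ 1) n)))
      (ℚᵘ.*≡* (solveℤ 1 (λ a → (a :*ℤ conℤ (+ 1)) :*ℤ conℤ (+ 1) :=ℤ conℤ (+ 1) :*ℤ (conℤ (+ 1) :*ℤ a)) refl (+ suc n)))))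
    where
    open import Data.Integer.Solver using () renaming (module +-*-Solver to ℤ-Solver)
    open ℤ-Solver using () renaming (solve to solveℤ; _:*_ to _:*ℤ_; con to conℤ; _:=_ to _:=ℤ_)
    import Data.Rational.Unnormalised as ℚᵘ
    import Data.Rational.Unnormalised.Properties as ℚᵘₚ

  1/!_ : ℕ → ℚ
  1/! zero  = 1ℚ
  1/! suc n = 1/suc n * 1/! n

  1/!>0 : ∀ n → 0ℚ < 1/! n
  1/!>0 zero    = positive⁻¹ 1ℚ
  1/!>0 (suc n) = *>0 (1/suc>0 n) (1/!>0 n)

  Σ[j<_] : ℕ → (ℕ → ℚ) → ℚ
  Σ[j< zero  ] f = 0ℚ
  Σ[j< suc n ] f = Σ[j< n ] f + f n

  IsCauchy : (ℕ → ℚ) → Set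
  IsCauchy x = ∀ ε → 0ℚ < ε →
    ∃[ N ] (∀ m n → N ≤ₙ m → N ≤ₙ n → ∣ x m - x n ∣ < ε)

  0<half : ∀ {ε} → 0ℚ < ε → 0ℚ < ε * ½
  0<half 0<ε = *>0 0<ε 0<½

  halves : ∀ p → p * ½ + p * ½ ≡ p
  halves p = solve 1 (λ a → a :* con ½ :+ a :* con ½ := a) refl p

  cauchy-by : ∀ (z : ℕ → ℚ) →
    (∀ ε → 0ℚ < ε → ∃[ N ] (∀ m n → N ≤ₙ m → m ≤ₙ n → ∣ z m - z n ∣ < ε)) →
    IsCauchy z
  cauchy-by z h ε 0<ε = proj₁ (h ε 0<ε) , λ m n N≤m N≤n → case m n N≤m N≤n
    where
    case : ∀ m n → proj₁ (h ε 0<ε) ≤ₙ m → proj₁ (h ε 0<ε) ≤ₙ n → ∣ z m - z n ∣ < ε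
    case m n N≤m N≤n with ℕₚ.≤-total m n
    ... | inj₁ m≤n = proj₂ (h ε 0<ε) m n N≤m m≤n
    ... | inj₂ n≤m = subst (_< ε) (∣∣-sym (z n) (z m)) (proj₂ (h ε 0<ε) n m N≤n n≤m)

  controlled : ∀ (x y z : ℕ → ℚ) {K} → IsCauchy x → IsCauchy y → 0ℚ < K → ∀ M →
    (∀ m n → M ≤ₙ m → m ≤ₙ n → ∣ z m - z n ∣ ≤ K * (∣ x m - x n ∣ + ∣ y m - y n ∣)) →
    IsCauchy z
  controlled x y z {K} cx cy 0<K M h = cauchy-by z λ ε 0<ε →
    let η     = ε * ½ * inv 0<K
        0<η   = *>0 (0<half 0<ε) (inv>0 0<K)
        A , a = cx η 0<η
        B , b = cy η 0<η
    in A ℕ.+ B ℕ.+ M , λ m n N≤m m≤n →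
      let A≤m = ℕₚ.≤-trans (ℕₚ.≤-trans (ℕₚ.m≤m+n A B) (ℕₚ.m≤m+n (A ℕ.+ B) M)) N≤m
          B≤m = ℕₚ.≤-trans (ℕₚ.≤-trans (ℕₚ.m≤n+m B A) (ℕₚ.m≤m+n (A ℕ.+ B) M)) N≤m
          M≤m = ℕₚ.≤-trans (ℕₚ.m≤n+m M (A ℕ.+ B)) N≤m
      in ≤-<-trans (h m n M≤m m≤n)
           (subst (K * (∣ x m - x n ∣ + ∣ y m - y n ∣) <_) (eq ε)
             (*-monoʳ-<-pos K {{positive 0<K}}
               (+-mono-< (a m n A≤m (ℕₚ.≤-trans A≤m m≤n)) (b m n B≤m (ℕₚ.≤-trans B≤m m≤n)))))
    where
    eq : ∀ ε → K * (ε * ½ * inv 0<K + ε * ½ * inv 0<K) ≡ ε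
    eq ε = trans
      (solve 3 (λ k e i → k :* (e :* con ½ :* i :+ e :* con ½ :* i) := (k :* i) :* e)
        refl K ε (inv 0<K))
      (trans (cong (_* ε) (inv-inverse 0<K)) (*-identityˡ ε))

  const-cauchy : ∀ q → IsCauchy (λ _ → q)
  const-cauchy q ε 0<ε =
    0 , λ _ _ _ _ → subst (_< ε) (cong ∣_∣ (sym (+-inverseʳ q))) 0<ε

  nonexpansive : ∀ {x : ℕ → ℚ} {f : ℚ → ℚ} →
    (∀ p q → ∣ f p - f q ∣ ≤ ∣ p - q ∣) → IsCauchy x → IsCauchy (λ n → f (x n))
  nonexpansive {x} {f} h cx ε 0<ε =
    let N , a = cx ε 0<ε in
    N , λ m n N≤m N≤n → ≤-<-trans (h (x m) (x n)) (a m n N≤m N≤n)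

  +-cauchy : ∀ {x y : ℕ → ℚ} → IsCauchy x → IsCauchy y → IsCauchy (λ n → x n + y n)
  +-cauchy {x} {y} cx cy = controlled x y (λ n → x n + y n) cx cy (positive⁻¹ 1ℚ) 0 λ m n _ _ →
    subst₂ _≤_
      (cong ∣_∣ (solve 4 (λ a b c d → (a :- b) :+ (c :- d) := (a :+ c) :- (b :+ d))
        refl (x m) (x n) (y m) (y n)))
      (sym (*-identityˡ _))
      (∣p+q∣≤∣p∣+∣q∣ (x m - x n) (y m - y n))

  neg-nonexpansive : ∀ p q → ∣ - p - - q ∣ ≤ ∣ p - q ∣
  neg-nonexpansive p q = ≤-reflexive (trans
    (cong ∣_∣ (solve 2 (λ a b → :- a :- :- b := b :- a) refl p q)) (∣∣-sym q p))

  eventual-bound : ∀ {x : ℕ → ℚ} → IsCauchy x →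
    ∃[ B ] (1ℚ ≤ B) × (∃[ N ] (∀ n → N ≤ₙ n → ∣ x n ∣ ≤ B))
  eventual-bound {x} cx =
    let N , a = cx 1ℚ (positive⁻¹ 1ℚ) in
    ∣ x N ∣ + 1ℚ
    , ≤-by (0≤∣p∣ (x N)) (+-comm 1ℚ ∣ x N ∣)
    , N
    , λ n N≤n → subst₂ _≤_
        (cong ∣_∣ (solve 2 (λ a b → b :+ (a :- b) := a) refl (x n) (x N)))
        refl
        (≤-trans (∣p+q∣≤∣p∣+∣q∣ (x N) (x n - x N))
          (+-monoʳ-≤ ∣ x N ∣ (<⇒≤ (a n N N≤n ℕₚ.≤-refl))))

  ∣*-*∣≤ : ∀ {B C} a b c d → 0ℚ ≤ B → 0ℚ ≤ C → ∣ a ∣ ≤ B → ∣ d ∣ ≤ C →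
    ∣ a * c - b * d ∣ ≤ (B + C) * (∣ a - b ∣ + ∣ c - d ∣)
  ∣*-*∣≤ {B} {C} a b c d 0≤B 0≤C ∣a∣≤B ∣d∣≤C = begin
    ∣ a * c - b * d ∣
      ≡⟨ cong ∣_∣ (solve 4 (λ a b c d → a :* c :- b :* d := a :* (c :- d) :+ (a :- b) :* d)
           refl a b c d) ⟩
    ∣ a * (c - d) + (a - b) * d ∣
      ≤⟨ ∣p+q∣≤∣p∣+∣q∣ (a * (c - d)) ((a - b) * d) ⟩
    ∣ a * (c - d) ∣ + ∣ (a - b) * d ∣
      ≡⟨ cong₂ _+_ (∣p*q∣≡∣p∣*∣q∣ a (c - d)) (∣p*q∣≡∣p∣*∣q∣ (a - b) d) ⟩
    ∣ a ∣ * ∣ c - d ∣ + ∣ a - b ∣ * ∣ d ∣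
      ≤⟨ +-mono-≤ (*-monoʳ (0≤∣p∣ (c - d)) ∣a∣≤B) (*-monoˡ (0≤∣p∣ (a - b)) ∣d∣≤C) ⟩
    B * ∣ c - d ∣ + ∣ a - b ∣ * C
      ≤⟨ bilinear ∣ a - b ∣ ∣ c - d ∣ (0≤∣p∣ (a - b)) (0≤∣p∣ (c - d)) ⟩
    (B + C) * (∣ a - b ∣ + ∣ c - d ∣) ∎
    where
    open ≤-Reasoning
    bilinear : ∀ u v → 0ℚ ≤ u → 0ℚ ≤ v → B * v + u * C ≤ (B + C) * (u + v)
    bilinear u v 0≤u 0≤v = ≤-by (+≥0 (*≥0 0≤B 0≤u) (*≥0 0≤C 0≤v))
      (solve 4 (λ b c u v → (b :* v :+ u :* c) :+ (b :* u :+ c :* v) := (b :+ c) :* (u :+ v))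
        refl B C u v)

  *-cauchy : ∀ {x y : ℕ → ℚ} → IsCauchy x → IsCauchy y → IsCauchy (λ n → x n * y n)
  *-cauchy {x} {y} cx cy =
    let B , 1≤B , M , bx = eventual-bound cx
        C , 1≤C , N , by = eventual-bound cy
        0≤B = ≤-trans 0≤1 1≤B
        0≤C = ≤-trans 0≤1 1≤C
    in controlled x y (λ n → x n * y n) cx cy (<-≤-trans (<-≤-trans 0<1 1≤B) (≤-by {B} {B + C} {C} 0≤C refl)) (M ℕ.+ N)
      λ m n le m≤n → ∣*-*∣≤ (x m) (x n) (y m) (y n) 0≤B 0≤C
        (bx m (ℕₚ.≤-trans (ℕₚ.m≤m+n M N) le))
        (by n (ℕₚ.≤-trans (ℕₚ.≤-trans (ℕₚ.m≤n+m N M) le) m≤n))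

  inv⊔ : ∀ {ε} → 0ℚ < ε → ℚ → ℚ
  inv⊔ {ε} 0<ε q = inv (<-≤-trans 0<ε (p≤p⊔q ε q))

  inv⊔-cauchy : ∀ {ε} (0<ε : 0ℚ < ε) {x : ℕ → ℚ} → IsCauchy x → IsCauchy (λ n → inv⊔ 0<ε (x n))
  inv⊔-cauchy {ε} 0<ε {x} cx =
    controlled x (λ _ → 0ℚ) (λ n → inv⊔ 0<ε (x n)) cx (const-cauchy 0ℚ) (*>0 0<e 0<e) 0 λ m n _ _ →
      subst (∣ inv⊔ 0<ε (x m) - inv⊔ 0<ε (x n) ∣ ≤_)
        (cong ((e * e) *_) (sym (+-identityʳ ∣ x m - x n ∣))) (lipschitz (x m) (x n))
    where
    open ≤-Reasoning
    e   = inv 0<ε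
    0<e = inv>0 0<ε
    inv≤ : ∀ {u} (0<u : 0ℚ < u) → ε ≤ u → inv 0<u ≤ e
    inv≤ {u} 0<u ε≤u = subst₂ _≤_
      (trans (solve 3 (λ i a e → (i :* e) :* a := i :* (a :* e)) refl (inv 0<u) ε e)
        (trans (cong (inv 0<u *_) (inv-inverse 0<ε)) (*-identityʳ _)))
      (trans (solve 3 (λ i u e → (i :* e) :* u := (u :* i) :* e) refl (inv 0<u) u e)
        (trans (cong (_* e) (inv-inverse 0<u)) (*-identityˡ e)))
      (*-monoˡ (*≥0 (<⇒≤ (inv>0 0<u)) (<⇒≤ 0<e)) ε≤u)
    ⊔-sub : ∀ p q → (ε ⊔ p) - (ε ⊔ q) ≤ ∣ p - q ∣
    ⊔-sub p q = ≤-by {r = ∣ p - q ∣ - ((ε ⊔ p) - (ε ⊔ q))}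
      (subst (0ℚ ≤_) (solve 3 (λ d a b → (b :+ d) :- a := d :- (a :- b)) refl ∣ p - q ∣ (ε ⊔ p) (ε ⊔ q))
        (diff≥0 (⊔-lub
          (≤-trans (p≤p⊔q ε q) (≤-by {ε ⊔ q} {(ε ⊔ q) + ∣ p - q ∣} (0≤∣p∣ (p - q)) refl))
          (subst (_≤ (ε ⊔ q) + ∣ p - q ∣) (solve 2 (λ a b → b :+ (a :- b) := a) refl p q)
            (+-mono-≤ (p≤q⊔p ε q) (≤∣∣ (p - q)))))))
      (solve 2 (λ a d → a :+ (d :- a) := d) refl ((ε ⊔ p) - (ε ⊔ q)) ∣ p - q ∣)
    ⊔-nonexpansive : ∀ p q → ∣ (ε ⊔ p) - (ε ⊔ q) ∣ ≤ ∣ p - q ∣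
    ⊔-nonexpansive p q = ∣∣≤ (⊔-sub p q)
      (subst₂ _≤_ (solve 2 (λ a b → b :- a := :- (a :- b)) refl (ε ⊔ p) (ε ⊔ q)) (∣∣-sym q p) (⊔-sub q p))
    lipschitz : ∀ p q → ∣ inv⊔ 0<ε p - inv⊔ 0<ε q ∣ ≤ (e * e) * ∣ p - q ∣
    lipschitz p q = begin
      ∣ i - j ∣
        ≡⟨ cong ∣_∣ (cong₂ _-_
             (sym (trans (cong (i *_) (inv-inverse 0<v)) (*-identityʳ i)))
             (sym (trans (cong (j *_) (inv-inverse 0<u)) (*-identityʳ j)))) ⟩
      ∣ i * (v * j) - j * (u * i) ∣
        ≡⟨ cong ∣_∣ (solve 4 (λ i j u v → i :* (v :* j) :- j :* (u :* i) := (i :* j) :* (v :- u))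
             refl i j u v) ⟩
      ∣ (i * j) * (v - u) ∣
        ≡⟨ ∣p*q∣≡∣p∣*∣q∣ (i * j) (v - u) ⟩
      ∣ i * j ∣ * ∣ v - u ∣
        ≡⟨ cong₂ _*_ (0≤p⇒∣p∣≡p (*≥0 (<⇒≤ 0<i) (<⇒≤ 0<j))) (∣∣-sym v u) ⟩
      (i * j) * ∣ u - v ∣
        ≤⟨ *-mono (*≥0 (<⇒≤ 0<e) (<⇒≤ 0<e)) (0≤∣p∣ (u - v))
             (*-mono (<⇒≤ 0<e) (<⇒≤ 0<j) (inv≤ 0<u (p≤p⊔q ε p)) (inv≤ 0<v (p≤p⊔q ε q)))
             (⊔-nonexpansive p q) ⟩
      (e * e) * ∣ p - q ∣ ∎
      where
      u   = ε ⊔ p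
      v   = ε ⊔ q
      0<u = <-≤-trans 0<ε (p≤p⊔q ε p)
      0<v = <-≤-trans 0<ε (p≤p⊔q ε q)
      i   = inv 0<u
      j   = inv 0<v
      0<i = inv>0 0<u
      0<j = inv>0 0<v

  toNearestℤ : ℚ → ℚ
  toNearestℤ q = (q - fromℤ (floor q)) ⊓ (fromℤ (ℤ.suc (floor q)) - q)

  toNearestℤ-least : ∀ q k → toNearestℤ q ≤ ∣ q - fromℤ k ∣
  toNearestℤ-least q k with ℤₚ.≤-total k (floor q)
  ... | inj₁ k≤f = ≤-trans (p⊓q≤p (q - fromℤ (floor q)) (fromℤ (ℤ.suc (floor q)) - q))
    (≤-trans (+-monoʳ-≤ q (neg-mono (fromℤ-mono k≤f))) (≤∣∣ _))
  ... | inj₂ f≤k with ℤₚ.<-cmp (floor q) k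
  ...   | tri< f<k _ _ = ≤-trans (p⊓q≤q (q - fromℤ (floor q)) (fromℤ (ℤ.suc (floor q)) - q))
    (≤-trans (+-monoˡ-≤ (- q) (fromℤ-mono (ℤₚ.i<j⇒suc[i]≤j f<k)))
      (subst (fromℤ k - q ≤_) (∣∣-sym (fromℤ k) q) (≤∣∣ _)))
  ...   | tri≈ _ refl _ = ≤-trans (p⊓q≤p (q - fromℤ (floor q)) (fromℤ (ℤ.suc (floor q)) - q)) (≤∣∣ _)
  ...   | tri> _ _ k<f  = ≤-trans (p⊓q≤p (q - fromℤ (floor q)) (fromℤ (ℤ.suc (floor q)) - q))
    (≤-trans (+-monoʳ-≤ q (neg-mono (fromℤ-mono (ℤₚ.<⇒≤ k<f)))) (≤∣∣ _))

  toNearestℤ-attained : ∀ q → ∃[ k ] ∣ q - fromℤ k ∣ ≡ toNearestℤ q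
  toNearestℤ-attained q with ⊓-sel (q - fromℤ (floor q)) (fromℤ (ℤ.suc (floor q)) - q)
  ... | inj₁ e = floor q , trans (0≤p⇒∣p∣≡p (diff≥0 (⌊⌋≤ q))) (sym e)
  ... | inj₂ e = ℤ.suc (floor q) ,
    trans (∣∣-sym q _) (trans (0≤p⇒∣p∣≡p (diff≥0 (<⇒≤ (<⌊⌋+1 q)))) (sym e))

  toNearestℤ-nonexpansive : ∀ p q → ∣ toNearestℤ p - toNearestℤ q ∣ ≤ ∣ p - q ∣
  toNearestℤ-nonexpansive p q = ∣∣≤ (sub p q)
    (subst₂ _≤_ (solve 2 (λ a b → b :- a := :- (a :- b)) refl (toNearestℤ p) (toNearestℤ q))
      (∣∣-sym q p) (sub q p))
    where
    sub : ∀ p q → toNearestℤ p - toNearestℤ q ≤ ∣ p - q ∣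
    sub p q with toNearestℤ-attained q
    ... | k , e = subst (toNearestℤ p - toNearestℤ q ≤_)
      (solve 2 (λ d t → (d :+ t) :- t := d) refl ∣ p - q ∣ (toNearestℤ q))
      (+-monoˡ-≤ (- toNearestℤ q)
        (≤-trans (toNearestℤ-least p k)
          (subst (λ t → ∣ p - fromℤ k ∣ ≤ ∣ p - q ∣ + t) e (∣∣-triangle p q (fromℤ k)))))

  shift-cauchy : ∀ (z : ℕ → ℚ) J → IsCauchy (λ n → z (n ℕ.+ J)) → IsCauchy z
  shift-cauchy z J c ε 0<ε =
    let N , a = c ε 0<ε in
    N ℕ.+ J , λ m n le le′ → subst₂ (λ i j → ∣ z i - z j ∣ < ε)
      (ℕₚ.m∸n+n≡m (ℕₚ.≤-trans (ℕₚ.m≤n+m J N) le))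
      (ℕₚ.m∸n+n≡m (ℕₚ.≤-trans (ℕₚ.m≤n+m J N) le′))
      (a (m ℕ.∸ J) (n ℕ.∸ J) (ℕₚ.m+n≤o⇒m≤o∸n N le) (ℕₚ.m+n≤o⇒m≤o∸n N le′))

  ⅔ : ℚ
  ⅔ = + 2 / 3

  0≤⅔ : 0ℚ ≤ ⅔
  0≤⅔ = nonNegative⁻¹ ⅔

  2ℚ : ℚ
  2ℚ = 1ℚ + 1ℚ

  0≤2 : 0ℚ ≤ 2ℚ
  0≤2 = nonNegative⁻¹ 2ℚ

  geometric-decay : ∀ (w : ℕ → ℚ) → (∀ n → 0ℚ ≤ w n) → (∀ n → w (suc n) ≤ ⅔ * w n) →
    ∀ ε → 0ℚ < ε → ∃[ N ] (∀ n → N ≤ₙ n → w n < ε)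
  geometric-decay w w≥0 step ε 0<ε =
    let N , a = archimedean ((2ℚ * w 0) * inv 0<ε) in
    N , λ n N≤n → *-cancelˡ-<-nonNeg (2ℚ + fromℕ n) {{nonNegative (+≥0 0≤2 (fromℕ≥0 n))}}
      (≤-<-trans (harmonic n) (≤-<-trans
        (subst (_≤ fromℕ N * ε) (unscale (2ℚ * w 0)) (*-monoʳ (<⇒≤ 0<ε) a))
        (≤-<-trans (*-monoʳ (<⇒≤ 0<ε) (fromℕ-mono N≤n))
          (<-by (*>0 (positive⁻¹ 2ℚ) 0<ε)
            (solve 2 (λ t e → t :* e :+ con 2ℚ :* e := (con 2ℚ :+ t) :* e) refl (fromℕ n) ε)))))
    where
    unscale : ∀ p → (p * inv 0<ε) * ε ≡ p
    unscale p = trans (solve 3 (λ p i e → (p :* i) :* e := (e :* i) :* p) refl p (inv 0<ε) ε)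
      (trans (cong (_* p) (inv-inverse 0<ε)) (*-identityˡ p))
    shrink : ∀ t u → 0ℚ ≤ t → 0ℚ ≤ u → (2ℚ + (1ℚ + t)) * (⅔ * u) ≤ (2ℚ + t) * u
    shrink t u 0≤t 0≤u = ≤-by (*≥0 (*≥0 0≤t (<⇒≤ 0<⅓)) 0≤u)
      (solve 2 (λ t u → (con 2ℚ :+ (con 1ℚ :+ t)) :* (con ⅔ :* u) :+ (t :* con ⅓) :* u
        := (con 2ℚ :+ t) :* u) refl t u)
    harmonic : ∀ n → (2ℚ + fromℕ n) * w n ≤ 2ℚ * w 0
    harmonic zero    = ≤-reflexive (cong (_* w 0) (+-identityʳ 2ℚ))
    harmonic (suc n) = ≤-trans
      (subst (λ t → (2ℚ + t) * w (suc n) ≤ (2ℚ + (1ℚ + fromℕ n)) * (⅔ * w n)) (sym (fromℕ-suc n))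
        (*-monoˡ (+≥0 0≤2 (+≥0 0≤1 (fromℕ≥0 n))) (step n)))
      (≤-trans (shrink (fromℕ n) (w n) (fromℕ≥0 n) (w≥0 n)) (harmonic n))

  -- The left endpoints of nested intervals [l n , l n + w n] of vanishing
  -- width.
  nested-cauchy : ∀ (l w : ℕ → ℚ) → (∀ n → 0ℚ ≤ w n) → (∀ n → w (suc n) ≤ ⅔ * w n) →
    (∀ n → l n ≤ l (suc n)) → (∀ n → l (suc n) + w (suc n) ≤ l n + w n) → IsCauchy l
  nested-cauchy l w w≥0 step l↑ r↓ = cauchy-by l λ ε 0<ε →
    let N , a = geometric-decay w w≥0 step ε 0<ε in
    N , λ m n N≤m m≤n → ≤-<-trans (close m n m≤n) (a m N≤m)
    where
    inside : ∀ m k → (l m ≤ l (k ℕ.+ m)) × (l (k ℕ.+ m) + w (k ℕ.+ m) ≤ l m + w m)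
    inside m zero    = ≤-refl , ≤-refl
    inside m (suc k) =
      ≤-trans (proj₁ (inside m k)) (l↑ _) , ≤-trans (r↓ _) (proj₂ (inside m k))
    within : ∀ p u q v → p ≤ q → 0ℚ ≤ v → q + v ≤ p + u → ∣ p - q ∣ ≤ u
    within p u q v p≤q 0≤v h = subst (_≤ u) (∣∣-sym q p) (subst (_≤ u) (sym (0≤p⇒∣p∣≡p (diff≥0 p≤q)))
      (≤-by (+≥0 0≤v (diff≥0 h))
        (solve 4 (λ p u q v → (q :- p) :+ (v :+ ((p :+ u) :- (q :+ v))) := u) refl p u q v)))
    close : ∀ m n → m ≤ₙ n → ∣ l m - l n ∣ ≤ w m
    close m n m≤n = subst (λ i → ∣ l m - l i ∣ ≤ w m) (ℕₚ.m∸n+n≡m m≤n)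
      (within (l m) (w m) _ (w (n ℕ.∸ m ℕ.+ m)) (proj₁ (inside m (n ℕ.∸ m))) (w≥0 _)
        (proj₂ (inside m (n ℕ.∸ m))))

  -- Partial sums of the power series Σ s j * p ^ j / j !
  partial : (s : ℕ → ℚ) → ℚ → ℕ → ℚ
  partial s p n = Σ[j< n ] λ j → s j * p ^ j * 1/! j

  E : ℚ → ℕ → ℚ
  E C n = Σ[j< n ] λ j → C ^ j * 1/! j

  E-mono : ∀ {C} → 0ℚ ≤ C → ∀ m k → E C m ≤ E C (k ℕ.+ m)
  E-mono 0≤C m zero    = ≤-refl
  E-mono 0≤C m (suc k) = ≤-trans (E-mono 0≤C m k)
    (≤-by (*≥0 (^≥0 0≤C (k ℕ.+ m)) (<⇒≤ (1/!>0 (k ℕ.+ m)))) refl)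

  E-cauchy : ∀ C → 0ℚ ≤ C → IsCauchy (E C)
  E-cauchy C 0≤C = shift-cauchy (E C) J (nested-cauchy
    (λ n → E C (n ℕ.+ J)) (λ n → e (n ℕ.+ J) + e (n ℕ.+ J))
    (λ n → +≥0 (e≥0 (n ℕ.+ J)) (e≥0 (n ℕ.+ J)))
    (λ n → twice (e (suc n ℕ.+ J)) (e (n ℕ.+ J)) (e≥0 (n ℕ.+ J)) (ratio (n ℕ.+ J) (ℕₚ.m≤n+m J n)))
    (λ n → E-mono 0≤C (n ℕ.+ J) 1)
    (λ n → absorb (E C (n ℕ.+ J)) (e (n ℕ.+ J)) (e (suc n ℕ.+ J)) (ratio (n ℕ.+ J) (ℕₚ.m≤n+m J n))))
    where
    J = proj₁ (archimedean (C + C))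
    C+C≤J : C + C ≤ fromℕ J
    C+C≤J = proj₂ (archimedean (C + C))
    e : ℕ → ℚ
    e j = C ^ j * 1/! j
    e≥0 : ∀ j → 0ℚ ≤ e j
    e≥0 j = *≥0 (^≥0 0≤C j) (<⇒≤ (1/!>0 j))
    C≤ : ∀ j → J ≤ₙ j → C * 1/suc j ≤ ½
    C≤ j J≤j = subst₂ _≤_
      (solve 2 (λ c i → con ½ :* ((c :+ c) :* i) := c :* i) refl C (1/suc j))
      (trans (cong (½ *_) (suc*1/suc j)) (*-identityʳ ½))
      (*-monoˡ (<⇒≤ 0<½) (*-monoʳ (<⇒≤ (1/suc>0 j))
        (≤-trans C+C≤J (fromℕ-mono (ℕₚ.≤-trans J≤j (ℕₚ.n≤1+n j))))))
    ratio : ∀ j → J ≤ₙ j → e (suc j) ≤ ½ * e j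
    ratio j J≤j = subst (_≤ ½ * e j)
      (solve 4 (λ c i x f → (c :* i) :* (x :* f) := (c :* x) :* (i :* f)) refl C (1/suc j) (C ^ j) (1/! j))
      (*-monoʳ (e≥0 j) (C≤ j J≤j))
    twice : ∀ a b → 0ℚ ≤ b → a ≤ ½ * b → a + a ≤ ⅔ * (b + b)
    twice a b 0≤b a≤ = ≤-trans (+-mono-≤ a≤ a≤)
      (≤-by (*≥0 (<⇒≤ 0<⅓) 0≤b)
        (solve 1 (λ b → (con ½ :* b :+ con ½ :* b) :+ con ⅓ :* b := con ⅔ :* (b :+ b)) refl b))
    absorb : ∀ t b a → a ≤ ½ * b → (t + b) + (a + a) ≤ t + (b + b)
    absorb t b a a≤ = ≤-trans (+-monoʳ-≤ (t + b) (+-mono-≤ a≤ a≤))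
      (≤-reflexive (solve 2 (λ t b → (t :+ b) :+ (con ½ :* b :+ con ½ :* b) := t :+ (b :+ b)) refl t b))

  ∣term∣≤ : ∀ {σ p f c} → ∣ σ ∣ ≤ 1ℚ → 0ℚ ≤ f → ∣ p ∣ ≤ c → ∣ σ * p * f ∣ ≤ c * f
  ∣term∣≤ {σ} {p} {f} {c} σ≤1 0≤f p≤c = begin
    ∣ σ * p * f ∣         ≡⟨ ∣p*q∣≡∣p∣*∣q∣ (σ * p) f ⟩
    ∣ σ * p ∣ * ∣ f ∣     ≡⟨ cong₂ _*_ (∣p*q∣≡∣p∣*∣q∣ σ p) (0≤p⇒∣p∣≡p 0≤f) ⟩
    ∣ σ ∣ * ∣ p ∣ * f     ≤⟨ *-monoʳ 0≤f (*-mono 0≤1 (0≤∣p∣ p) σ≤1 p≤c) ⟩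
    1ℚ * c * f            ≡⟨ cong (_* f) (*-identityˡ c) ⟩
    c * f                 ∎
    where open ≤-Reasoning

  ^-lipschitz : ∀ {B} p q → 1ℚ ≤ B → ∣ p ∣ ≤ B → ∣ q ∣ ≤ B →
    ∀ j → ∣ p ^ j - q ^ j ∣ ≤ ∣ p - q ∣ * (B + B) ^ j
  ^-lipschitz {B} p q 1≤B p≤B q≤B zero =
    subst₂ _≤_ (cong ∣_∣ (sym (+-inverseʳ 1ℚ))) (sym (*-identityʳ ∣ p - q ∣)) (0≤∣p∣ (p - q))
  ^-lipschitz {B} p q 1≤B p≤B q≤B (suc j) = begin
    ∣ p * p ^ j - q * q ^ j ∣
      ≡⟨ cong ∣_∣ (solve 4 (λ p q a b → p :* a :- q :* b := p :* (a :- b) :+ (p :- q) :* b)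
           refl p q (p ^ j) (q ^ j)) ⟩
    ∣ p * (p ^ j - q ^ j) + (p - q) * q ^ j ∣
      ≤⟨ ∣p+q∣≤∣p∣+∣q∣ (p * (p ^ j - q ^ j)) ((p - q) * q ^ j) ⟩
    ∣ p * (p ^ j - q ^ j) ∣ + ∣ (p - q) * q ^ j ∣
      ≡⟨ cong₂ _+_ (∣p*q∣≡∣p∣*∣q∣ p (p ^ j - q ^ j)) (∣p*q∣≡∣p∣*∣q∣ (p - q) (q ^ j)) ⟩
    ∣ p ∣ * ∣ p ^ j - q ^ j ∣ + Δ * ∣ q ^ j ∣
      ≤⟨ +-mono-≤
           (*-mono 0≤B (0≤∣p∣ (p ^ j - q ^ j)) p≤B (^-lipschitz p q 1≤B p≤B q≤B j))
           (*-monoˡ (0≤∣p∣ (p - q)) (≤-trans (∣^∣≤ q≤C j) (C^≤ j))) ⟩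
    B * (Δ * C ^ j) + Δ * (B * C ^ j)
      ≡⟨ solve 3 (λ b d c → b :* (d :* c) :+ d :* (b :* c) := d :* ((b :+ b) :* c)) refl B Δ (C ^ j) ⟩
    Δ * (C * C ^ j) ∎
    where
    open ≤-Reasoning
    C   = B + B
    Δ   = ∣ p - q ∣
    0≤B = ≤-trans 0≤1 1≤B
    q≤C : ∣ q ∣ ≤ C
    q≤C = ≤-trans q≤B (≤-by {B} {B + B} {B} 0≤B refl)
    C^≤ : ∀ i → C ^ i ≤ B * C ^ i
    C^≤ i = subst (_≤ B * C ^ i) (*-identityˡ (C ^ i)) (*-monoʳ (^≥0 (+≥0 0≤B 0≤B) i) 1≤B)

  module _ (s : ℕ → ℚ) (s≤1 : ∀ j → ∣ s j ∣ ≤ 1ℚ) where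

    partial-tail : ∀ {C} p → ∣ p ∣ ≤ C → ∀ m k →
      ∣ partial s p (k ℕ.+ m) - partial s p m ∣ ≤ E C (k ℕ.+ m) - E C m
    partial-tail {C} p p≤C m zero = subst₂ _≤_
      (cong ∣_∣ (sym (+-inverseʳ (partial s p m)))) (sym (+-inverseʳ (E C m))) ≤-refl
    partial-tail {C} p p≤C m (suc k) = begin
      ∣ (S + t) - S₀ ∣
        ≡⟨ cong ∣_∣ (solve 3 (λ a b c → (a :+ b) :- c := (a :- c) :+ b) refl S t S₀) ⟩
      ∣ (S - S₀) + t ∣
        ≤⟨ ∣p+q∣≤∣p∣+∣q∣ (S - S₀) t ⟩
      ∣ S - S₀ ∣ + ∣ t ∣
        ≤⟨ +-mono-≤ (partial-tail p p≤C m k) (∣term∣≤ (s≤1 i) (<⇒≤ (1/!>0 i)) (∣^∣≤ p≤C i)) ⟩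
      (E C i - E C m) + C ^ i * 1/! i
        ≡⟨ solve 3 (λ a b c → (a :- c) :+ b := (a :+ b) :- c) refl (E C i) (C ^ i * 1/! i) (E C m) ⟩
      (E C i + C ^ i * 1/! i) - E C m ∎
      where
      open ≤-Reasoning
      i  = k ℕ.+ m
      S  = partial s p i
      S₀ = partial s p m
      t  = s i * p ^ i * 1/! i

    partial-lipschitz : ∀ {B} p q → 1ℚ ≤ B → ∣ p ∣ ≤ B → ∣ q ∣ ≤ B → ∀ n →
      ∣ partial s p n - partial s q n ∣ ≤ ∣ p - q ∣ * E (B + B) n
    partial-lipschitz p q 1≤B p≤B q≤B zero =
      subst₂ _≤_ (cong ∣_∣ (sym (+-inverseʳ 0ℚ))) (sym (*-zeroʳ ∣ p - q ∣)) ≤-refl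
    partial-lipschitz {B} p q 1≤B p≤B q≤B (suc n) = begin
      ∣ (S + s n * p ^ n * f) - (T + s n * q ^ n * f) ∣
        ≡⟨ cong ∣_∣ (solve 6 (λ S T σ a b f → (S :+ σ :* a :* f) :- (T :+ σ :* b :* f)
             := (S :- T) :+ σ :* (a :- b) :* f) refl S T (s n) (p ^ n) (q ^ n) f) ⟩
      ∣ (S - T) + s n * (p ^ n - q ^ n) * f ∣
        ≤⟨ ∣p+q∣≤∣p∣+∣q∣ (S - T) (s n * (p ^ n - q ^ n) * f) ⟩
      ∣ S - T ∣ + ∣ s n * (p ^ n - q ^ n) * f ∣
        ≤⟨ +-mono-≤ (partial-lipschitz p q 1≤B p≤B q≤B n)
             (∣term∣≤ (s≤1 n) (<⇒≤ (1/!>0 n)) (^-lipschitz p q 1≤B p≤B q≤B n)) ⟩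
      Δ * E C n + Δ * C ^ n * f
        ≡⟨ solve 4 (λ d e c f → d :* e :+ d :* c :* f := d :* (e :+ c :* f)) refl Δ (E C n) (C ^ n) f ⟩
      Δ * (E C n + C ^ n * f) ∎
      where
      open ≤-Reasoning
      S = partial s p n
      T = partial s q n
      f = 1/! n
      C = B + B
      Δ = ∣ p - q ∣

    partial-cauchy : ∀ {x : ℕ → ℚ} → IsCauchy x → IsCauchy (λ n → partial s (x n) n)
    partial-cauchy {x} cx =
      let B , 1≤B , M , bx = eventual-bound cx
          0≤B = ≤-trans 0≤1 1≤B
          C   = B + B
          B≤C = ≤-by {B} {C} {B} 0≤B refl
          cE  = E-cauchy C (+≥0 0≤B 0≤B)
          U , 1≤U , N , bE = eventual-bound cE
      in controlled x (E C) (λ n → partial s (x n) n) cx cE (<-≤-trans 0<1 1≤U) (M ℕ.+ N)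
        λ m n le m≤n →
        let M≤m = ℕₚ.≤-trans (ℕₚ.m≤m+n M N) le
            N≤m = ℕₚ.≤-trans (ℕₚ.m≤n+m N M) le
            xm  = bx m M≤m
            xn  = bx n (ℕₚ.≤-trans M≤m m≤n)
        in combine (partial s (x m) m) (partial s (x n) m) (partial s (x n) n)
             ∣ x m - x n ∣ (E C m) (E C n) U (0≤∣p∣ (x m - x n)) 1≤U
             (≤-trans (≤∣∣ (E C m)) (bE m N≤m))
             (partial-lipschitz (x m) (x n) 1≤B xm xn m)
             (subst (λ i → ∣ partial s (x n) i - partial s (x n) m ∣ ≤ E C i - E C m)
               (ℕₚ.m∸n+n≡m m≤n) (partial-tail (x n) (≤-trans xn B≤C) m (n ℕ.∸ m)))
      where
      open ≤-Reasoning
      combine : ∀ a b c d e e′ u → 0ℚ ≤ d → 1ℚ ≤ u → e ≤ u → ∣ a - b ∣ ≤ d * e → ∣ c - b ∣ ≤ e′ - e →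
        ∣ a - c ∣ ≤ u * (d + ∣ e - e′ ∣)
      combine a b c d e e′ u 0≤d 1≤u e≤u h k = begin
        ∣ a - c ∣                    ≤⟨ ∣∣-triangle a b c ⟩
        ∣ a - b ∣ + ∣ b - c ∣        ≡⟨ cong (λ t → ∣ a - b ∣ + t) (∣∣-sym b c) ⟩
        ∣ a - b ∣ + ∣ c - b ∣        ≤⟨ +-mono-≤ h k ⟩
        d * e + (e′ - e)             ≤⟨ +-mono-≤ (*-monoˡ 0≤d e≤u)
                                          (subst (e′ - e ≤_) (∣∣-sym e′ e) (≤∣∣ (e′ - e))) ⟩
        d * u + ∣ e - e′ ∣           ≤⟨ +-monoʳ-≤ (d * u) (subst (_≤ u * ∣ e - e′ ∣) (*-identityˡ ∣ e - e′ ∣)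
                                          (*-monoʳ (0≤∣p∣ (e - e′)) 1≤u)) ⟩
        d * u + u * ∣ e - e′ ∣       ≡⟨ solve 3 (λ d u v → d :* u :+ u :* v := u :* (d :+ v))
                                          refl d u ∣ e - e′ ∣ ⟩
        u * (d + ∣ e - e′ ∣)         ∎

  -- Strict order of (the limits of) two sequences.
  _<ₛ_ : (ℕ → ℚ) → (ℕ → ℚ) → Set
  x <ₛ y = ∃[ ε ] (0ℚ < ε) × (∃[ N ] (∀ n → N ≤ₙ n → x n + ε ≤ y n))

  <ₛ-cotrans : ∀ {x y z} → IsCauchy x → IsCauchy y → IsCauchy z →
    x <ₛ z → (x <ₛ y) ⊎ (y <ₛ z)
  <ₛ-cotrans {x} {y} {z} cx cy cz (ε , 0<ε , N , h) =
    let A , a = cx η 0<η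
        B , b = cy η 0<η
        C , c = cz η 0<η
        M   = N ℕ.+ (A ℕ.+ (B ℕ.+ C))
        N≤M = ℕₚ.m≤m+n N (A ℕ.+ (B ℕ.+ C))
        R≤M = ℕₚ.m≤n+m (A ℕ.+ (B ℕ.+ C)) N
        A≤M = ℕₚ.≤-trans (ℕₚ.m≤m+n A (B ℕ.+ C)) R≤M
        S≤M = ℕₚ.≤-trans (ℕₚ.m≤n+m (B ℕ.+ C) A) R≤M
        B≤M = ℕₚ.≤-trans (ℕₚ.m≤m+n B C) S≤M
        C≤M = ℕₚ.≤-trans (ℕₚ.m≤n+m C B) S≤M
    in decide M (h M N≤M)
         (λ n M≤n → a M n A≤M (ℕₚ.≤-trans A≤M M≤n))
         (λ n M≤n → b M n B≤M (ℕₚ.≤-trans B≤M M≤n))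
         (λ n M≤n → c M n C≤M (ℕₚ.≤-trans C≤M M≤n))
    where
    η = ε * ½ * ½ * ½
    0<η : 0ℚ < η
    0<η = 0<half (0<half (0<half 0<ε))
    4η = ε * ½
    separated : ∀ p q p′ q′ → p + 4η ≤ q → ∣ p - p′ ∣ < η → ∣ q - q′ ∣ < η → p′ + (η + η) ≤ q′
    separated p q p′ q′ far near near′ = ≤-by
      (+≥0 (diff≥0 far) (+≥0 (diff≥0 (≤-trans (-≤∣∣ (p - p′)) (<⇒≤ near)))
        (diff≥0 (≤-trans (≤∣∣ (q - q′)) (<⇒≤ near′)))))
      (solve 5 (λ p q p′ q′ e →
        (p′ :+ (e :* con ½ :* con ½ :* con ½ :+ e :* con ½ :* con ½ :* con ½))
          :+ ((q :- (p :+ e :* con ½))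
            :+ ((e :* con ½ :* con ½ :* con ½ :- (:- (p :- p′)))
            :+ (e :* con ½ :* con ½ :* con ½ :- (q :- q′)))) := q′) refl p q p′ q′ ε)
    decide : ∀ M → x M + ε ≤ z M →
      (∀ n → M ≤ₙ n → ∣ x M - x n ∣ < η) →
      (∀ n → M ≤ₙ n → ∣ y M - y n ∣ < η) →
      (∀ n → M ≤ₙ n → ∣ z M - z n ∣ < η) → (x <ₛ y) ⊎ (y <ₛ z)
    decide M gap a b c with ≤-total (x M + 4η) (y M)
    ... | inj₁ le = inj₁ (η + η , +-mono-< 0<η 0<η , M ,
      λ n M≤n → separated (x M) (y M) (x n) (y n) le (a n M≤n) (b n M≤n))
    ... | inj₂ ge = inj₂ (η + η , +-mono-< 0<η 0<η , M ,
      λ n M≤n → separated (y M) (z M) (y n) (z n)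
        (≤-trans (+-monoˡ-≤ 4η ge) (subst (_≤ z M)
          (solve 2 (λ x e → x :+ e := (x :+ e :* con ½) :+ e :* con ½) refl (x M) ε) gap))
        (b n M≤n) (c n M≤n))

  square-mono : ∀ {p q} → 0ℚ ≤ p → p < q → p * p < q * q
  square-mono {p} {q} 0≤p p<q = <-by
    (*>0 (diff>0 p<q) (≤-<-trans 0≤p (<-≤-trans p<q (≤-by 0≤p (+-comm q p)))))
    (solve 2 (λ p q → p :* p :+ (q :- p) :* (p :+ q) := q :* q) refl p q)

  one : ℕ → ℚ
  one _ = 1ℚ

  exp-increasing : ∀ {p q} → 0ℚ ≤ p → p < q → partial one p <ₛ partial one q
  exp-increasing {p} {q} 0≤p p<q = q - p , diff>0 p<q , 2 , λ where
      (suc (suc n)) _ → go n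
      (suc zero) (ℕ.s≤s ())
    where
    go : ∀ n → partial one p (suc (suc n)) + (q - p) ≤ partial one q (suc (suc n))
    go zero    = ≤-reflexive (solve 2 (λ p q →
      ((con 0ℚ :+ con 1ℚ :* con 1ℚ :* con 1ℚ) :+ con 1ℚ :* (p :* con 1ℚ) :* con (1/! 1)) :+ (q :- p)
        := (con 0ℚ :+ con 1ℚ :* con 1ℚ :* con 1ℚ) :+ con 1ℚ :* (q :* con 1ℚ) :* con (1/! 1)) refl p q)
    go (suc n) = subst (_≤ partial one q (suc (suc (suc n))))
      (solve 3 (λ a b t → (a :+ b) :+ t := (a :+ t) :+ b) refl (partial one p (suc (suc n))) (q - p) _)
      (+-mono-≤ (go n) (*-monoʳ (<⇒≤ (1/!>0 (suc (suc n))))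
        (*-monoˡ 0≤1 (^-mono 0≤p (<⇒≤ p<q) (suc (suc n))))))

  -- The derivatives of cos and sin at 0.
  cosSign sinSign : ℕ → ℚ
  cosSign zero          = 1ℚ
  cosSign (suc zero)    = 0ℚ
  cosSign (suc (suc n)) = - cosSign n
  sinSign zero          = 0ℚ
  sinSign (suc zero)    = 1ℚ
  sinSign (suc (suc n)) = - sinSign n

  one≤1 : ∀ n → ∣ one n ∣ ≤ 1ℚ
  one≤1 n = ≤-refl

  cosSign≤1 : ∀ n → ∣ cosSign n ∣ ≤ 1ℚ
  cosSign≤1 zero          = ≤-refl
  cosSign≤1 (suc zero)    = 0≤1
  cosSign≤1 (suc (suc n)) = subst (_≤ 1ℚ) (sym (∣-p∣≡∣p∣ (cosSign n))) (cosSign≤1 n)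

  sinSign≤1 : ∀ n → ∣ sinSign n ∣ ≤ 1ℚ
  sinSign≤1 zero          = 0≤1
  sinSign≤1 (suc zero)    = ≤-refl
  sinSign≤1 (suc (suc n)) = subst (_≤ 1ℚ) (sym (∣-p∣≡∣p∣ (sinSign n))) (sinSign≤1 n)

  1/suc-antitone : ∀ {m n} → m ≤ₙ n → 1/suc n ≤ 1/suc m
  1/suc-antitone {m} {n} m≤n = subst₂ _≤_
    (trans (cong (_* 1/suc n) (suc*1/suc m)) (*-identityˡ (1/suc n)))
    (trans (solve 3 (λ a i j → (a :* i) :* j := (a :* j) :* i) refl (fromℕ (suc n)) (1/suc m) (1/suc n))
      (trans (cong (_* 1/suc m) (suc*1/suc n)) (*-identityˡ (1/suc m))))
    (*-monoʳ (<⇒≤ (1/suc>0 n)) (*-monoʳ (<⇒≤ (1/suc>0 m)) (fromℕ-mono (ℕ.s≤s m≤n))))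

  -- cos is strictly decreasing on [0 , 2]: the series for cos p - cos q is
  -- alternating with terms d 2 , d 4 , d 6 , …  which shrink by a factor ⅔.
  cos-decreasing : ∀ {p q} → 0ℚ ≤ p → p < q → q ≤ 2ℚ → partial cosSign q <ₛ partial cosSign p
  cos-decreasing {p} {q} 0≤p p<q q≤2 = L , *>0 0<⅓ d2>0 , 3 , λ where
      (suc (suc (suc n))) _ → subst (λ i → partial cosSign q i + L ≤ partial cosSign p i)
        (ℕₚ.+-comm n 3) (from-T (n ℕ.+ 3) (all n 0))
      (suc (suc zero)) (ℕ.s≤s (ℕ.s≤s ()))
      (suc zero) (ℕ.s≤s ())
    where
    0≤q = ≤-trans 0≤p (<⇒≤ p<q)
    d T : ℕ → ℚ
    d j = (q ^ j - p ^ j) * 1/! j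
    T n = partial cosSign p n - partial cosSign q n
    L = ⅓ * d 2
    d≥0 : ∀ j → 0ℚ ≤ d j
    d≥0 j = *≥0 (diff≥0 (^-mono 0≤p (<⇒≤ p<q) j)) (<⇒≤ (1/!>0 j))
    d2>0 : 0ℚ < d 2
    d2>0 = *>0 (subst₂ (λ a b → 0ℚ < a - b) (cong (q *_) (sym (*-identityʳ q)))
      (cong (p *_) (sym (*-identityʳ p))) (diff>0 (square-mono 0≤p p<q))) (1/!>0 2)
    from-T : ∀ n → L ≤ T n → partial cosSign q n + L ≤ partial cosSign p n
    from-T n h = subst (partial cosSign q n + L ≤_)
      (solve 2 (λ a b → b :+ (a :- b) := a) refl (partial cosSign p n) (partial cosSign q n))
      (+-monoʳ-≤ (partial cosSign q n) h)
    T-suc : ∀ j → T (suc j) ≡ T j - cosSign j * d j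
    T-suc j = solve 6 (λ a b s x y f → (a :+ s :* x :* f) :- (b :+ s :* y :* f) := (a :- b) :- s :* ((y :- x) :* f))
      refl (partial cosSign p j) (partial cosSign q j) (cosSign j) (p ^ j) (q ^ j) (1/! j)

    p²+q²≤8 : q * q + p * p ≤ fromℕ 8
    p²+q²≤8 = +-mono-≤ (*-mono 0≤2 0≤q q≤2 q≤2)
      (*-mono 0≤2 0≤p (≤-trans (<⇒≤ p<q) q≤2) (≤-trans (<⇒≤ p<q) q≤2))
    power-gap : ∀ i → q ^ (4 ℕ.+ i) - p ^ (4 ℕ.+ i) ≤ (q * q + p * p) * (q ^ (2 ℕ.+ i) - p ^ (2 ℕ.+ i))
    power-gap i = ≤-by
      (*≥0 (*≥0 (*≥0 0≤p 0≤p) (*≥0 0≤q 0≤q)) (diff≥0 (^-mono 0≤p (<⇒≤ p<q) i)))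
      (solve 4 (λ p q P Q →
        (q :* (q :* (q :* (q :* Q))) :- p :* (p :* (p :* (p :* P))))
          :+ (p :* p) :* (q :* q) :* (Q :- P)
        := (q :* q :+ p :* p) :* (q :* (q :* Q) :- p :* (p :* P))) refl p q (p ^ i) (q ^ i))
    shrink : ∀ i → d (4 ℕ.+ i) ≤ ⅔ * d (2 ℕ.+ i)
    shrink i = begin
      (q ^ (4 ℕ.+ i) - p ^ (4 ℕ.+ i)) * (1/suc (3 ℕ.+ i) * (1/suc (2 ℕ.+ i) * f))
        ≤⟨ *-mono (*≥0 8≥0 D≥0)
             (*≥0 (<⇒≤ (1/suc>0 (3 ℕ.+ i))) (*≥0 (<⇒≤ (1/suc>0 (2 ℕ.+ i))) f≥0))
             (≤-trans (power-gap i) (*-monoʳ D≥0 p²+q²≤8))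
             (*-mono ¼≥0 (*≥0 (<⇒≤ (1/suc>0 (2 ℕ.+ i))) f≥0) (1/suc-antitone (ℕₚ.m≤m+n 3 i))
               (*-monoʳ f≥0 (1/suc-antitone (ℕₚ.m≤m+n 2 i)))) ⟩
      (fromℕ 8 * D) * (1/suc 3 * (1/suc 2 * f))
        ≡⟨ solve 2 (λ D f → (con (fromℕ 8) :* D) :* (con (1/suc 3) :* (con (1/suc 2) :* f))
             := con ⅔ :* (D :* f)) refl D f ⟩
      ⅔ * (D * f) ∎
      where
      open ≤-Reasoning
      f   = 1/! (2 ℕ.+ i)
      D   = q ^ (2 ℕ.+ i) - p ^ (2 ℕ.+ i)
      f≥0 = <⇒≤ (1/!>0 (2 ℕ.+ i))
      D≥0 = diff≥0 (^-mono 0≤p (<⇒≤ p<q) (2 ℕ.+ i))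
      8≥0 = fromℕ≥0 8
      ¼≥0 = <⇒≤ (1/suc>0 3)

    quad : ℕ → ℕ
    quad zero    = 0
    quad (suc k) = 4 ℕ.+ quad k
    sign₀ : ∀ k → cosSign (quad k) ≡ 1ℚ
    sign₀ zero    = refl
    sign₀ (suc k) = trans (neg² (cosSign (quad k))) (sign₀ k)
    sign₁ : ∀ k → cosSign (1 ℕ.+ quad k) ≡ 0ℚ
    sign₁ zero    = refl
    sign₁ (suc k) = trans (neg² (cosSign (1 ℕ.+ quad k))) (sign₁ k)

    T-zero : ∀ j → cosSign j ≡ 0ℚ → T (suc j) ≡ T j
    T-zero j e = trans (T-suc j) (trans (cong (λ s → T j - s * d j) e)
      (solve 2 (λ t d → t :- con 0ℚ :* d := t) refl (T j) (d j)))
    T-pos : ∀ j → cosSign j ≡ 1ℚ → T (suc j) ≡ T j - d j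
    T-pos j e = trans (T-suc j) (cong (λ s → T j - s) (trans (cong (_* d j) e) (*-identityˡ (d j))))
    T-neg : ∀ j → cosSign j ≡ - 1ℚ → T (suc j) ≡ T j + d j
    T-neg j e = trans (T-suc j) (trans (cong (λ s → T j - s * d j) e)
      (solve 2 (λ t d → t :- con (- 1ℚ) :* d := t :+ d) refl (T j) (d j)))

    T3 : ∀ k → L + ⅔ * d (2 ℕ.+ quad k) ≤ T (3 ℕ.+ quad k)
    T4 : ∀ k → L + ⅔ * d (2 ℕ.+ quad k) ≤ T (4 ℕ.+ quad k)
    T5 : ∀ k → L ≤ T (5 ℕ.+ quad k)
    T6 : ∀ k → L ≤ T (6 ℕ.+ quad k)
    T3 zero    = ≤-reflexive (trans
      (solve 1 (λ d → con ⅓ :* d :+ con ⅔ :* d := con 0ℚ :+ d) refl (d 2))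
      (sym (trans (T-neg 2 refl) (cong (_+ d 2) (trans (T-zero 1 refl) (trans (T-pos 0 refl)
        (trans (cong (λ t → T 0 - t) (*-zeroˡ 1ℚ)) refl)))))))
    T3 (suc k) = subst (L + ⅔ * d j ≤_) (sym (T-neg j (cong -_ (sign₀ (suc k)))))
      (+-mono-≤ (T6 k) (subst (⅔ * d j ≤_) (*-identityˡ (d j)) (*-monoʳ (d≥0 j) ⅔≤1)))
      where
      j = 2 ℕ.+ quad (suc k)
      ⅔≤1 : ⅔ ≤ 1ℚ
      ⅔≤1 = ≤-by (<⇒≤ 0<⅓) refl
    T4 k = subst (L + ⅔ * d (2 ℕ.+ quad k) ≤_)
      (sym (T-zero (3 ℕ.+ quad k) (cong -_ (sign₁ k)))) (T3 k)
    T5 k = subst (L ≤_) (sym (T-pos (4 ℕ.+ quad k) (sign₀ (suc k))))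
      (≤-by (+≥0 (diff≥0 (T4 k)) (diff≥0 (shrink (quad k))))
        (solve 4 (λ l a t b → l :+ ((t :- (l :+ a)) :+ (a :- b)) := t :- b) refl
          L (⅔ * d (2 ℕ.+ quad k)) (T (4 ℕ.+ quad k)) (d (4 ℕ.+ quad k))))
    T6 k = subst (L ≤_) (sym (T-zero (5 ℕ.+ quad k) (sign₁ (suc k)))) (T5 k)

    weaken : ∀ k {t} → L + ⅔ * d (2 ℕ.+ quad k) ≤ t → L ≤ t
    weaken k = ≤-trans (≤-by {L} {L + ⅔ * d (2 ℕ.+ quad k)} (*≥0 0≤⅔ (d≥0 (2 ℕ.+ quad k))) refl)
    all : ∀ n k → L ≤ T (n ℕ.+ (3 ℕ.+ quad k))
    all 0 k = weaken k (T3 k)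
    all 1 k = weaken k (T4 k)
    all 2 k = T5 k
    all 3 k = T6 k
    all (suc (suc (suc (suc n)))) k = subst (λ i → L ≤ T i) (shift n (3 ℕ.+ quad k)) (all n (suc k))
      where
      shift : ∀ a b → a ℕ.+ (4 ℕ.+ b) ≡ 4 ℕ.+ a ℕ.+ b
      shift a b = trans (sym (ℕₚ.+-assoc a 4 b)) (cong (ℕ._+ b) (ℕₚ.+-comm a 4))

open RationalFacts using (IsCauchy; _<ₛ_)
private module F = RationalFacts

-- The real numbers, as Cauchy sequences of rationals.  Two of them denote the
-- same number when neither is less than the other; every function below
-- respects this.

record ℝ : Set where
  constructor real
  field
    seq    : ℕ → ℚ
    cauchy : IsCauchy seq
open ℝ public

infix  4 _<_ _≤_
infixl 6 _+_ _-_
infixl 7 _*_ _/ℕ_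
infix  8 -_
infix  9 √_ _²

_<_ _≤_ : ℝ → ℝ → Set
x < y = seq x <ₛ seq y
x ≤ y = ¬ (y < x)

fromℚ : ℚ → ℝ
fromℚ q = real (λ _ → q) (F.const-cauchy q)

fromℤ : ℤ → ℝ
fromℤ i = fromℚ (i ℚ./ 1)

fromℕ : ℕ → ℝ
fromℕ n = fromℤ (+ n)

0ℝ 1ℝ : ℝ
0ℝ = fromℕ 0
1ℝ = fromℕ 1

_+_ _*_ : ℝ → ℝ → ℝ
x + y = real (λ n → seq x n ℚ.+ seq y n) (F.+-cauchy {seq x} {seq y} (cauchy x) (cauchy y))
x * y = real (λ n → seq x n ℚ.* seq y n) (F.*-cauchy {seq x} {seq y} (cauchy x) (cauchy y))

-_ : ℝ → ℝ
- x = real (λ n → ℚ.- seq x n) (F.nonexpansive {seq x} {ℚ.-_} F.neg-nonexpansive (cauchy x))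

_-_ : ℝ → ℝ → ℝ
x - y = x + - y

-- With ε a lower bound for x extracted from 0 < x, this is the limit of
-- 1 / max(ε , x n).
reciprocal : (x : ℝ) → 0ℝ < x → ℝ
reciprocal x (ε , 0<ε , _) = real (λ n → F.inv⊔ 0<ε (seq x n)) (F.inv⊔-cauchy 0<ε {seq x} (cauchy x))

_/ℕ_ : ℝ → (n : ℕ) .{{_ : NonZero n}} → ℝ
x /ℕ n = x * fromℚ (+ 1 ℚ./ n)

<-cotrans : ∀ {x z} y → x < z → (x < y) ⊎ (y < z)
<-cotrans {x} {z} y = F.<ₛ-cotrans {seq x} {seq y} {seq z} (cauchy x) (cauchy y) (cauchy z)

-- a rational ≥ 1 and ≥ x
upperBound : ℝ → ℚ
upperBound x = proj₁ (F.eventual-bound {seq x} (cauchy x))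

0<upperBound : ∀ x → 0ℚ ℚ.< upperBound x
0<upperBound x = ℚₚ.<-≤-trans F.0<1 (proj₁ (proj₂ (F.eventual-bound {seq x} (cauchy x))))

-- solution is the point c of [a , b] with f c = y, for f strictly increasing
-- on [a , b] and y between f a and f b (y outside this range gives the nearer
-- endpoint).  It is found by trisection: [l , l + w] is replaced by
-- [l + w/3 , l + w] if f (l + w/3) < y, and by [l , l + 2w/3] if
-- y < f (l + 2w/3).
module Solve
  (f : ℚ → ℝ) (a b : ℚ) (a<b : a ℚ.< b)
  (increasing : ∀ {p q} → a ℚ.≤ p → p ℚ.< q → q ℚ.≤ b → f p < f q)
  (y : ℝ)
  where

  record Interval : Set where
    constructor interval
    field
      l w   : ℚ
      a≤l   : a ℚ.≤ l
      0<w   : 0ℚ ℚ.< w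
      l+w≤b : l ℚ.+ w ℚ.≤ b
  open Interval public

  start : Interval
  start = interval a (b ℚ.- a) ℚₚ.≤-refl (F.diff>0 a<b)
    (ℚₚ.≤-reflexive (solve 2 (λ a b → a :+ (b :- a) := b) refl a b))
    where open +-*-Solver

  module _ (I : Interval) where
    open +-*-Solver

    l⁺ r⁻ w⁻ : ℚ
    w⁻ = F.⅔ ℚ.* w I
    l⁺ = l I ℚ.+ F.⅓ ℚ.* w I
    r⁻ = l I ℚ.+ w⁻

    ⅓w>0 : 0ℚ ℚ.< F.⅓ ℚ.* w I
    ⅓w>0 = F.*>0 F.0<⅓ (0<w I)

    w⁻>0 : 0ℚ ℚ.< w⁻
    w⁻>0 = F.*>0 (ℚₚ.positive⁻¹ F.⅔) (0<w I)

    l≤l⁺ : l I ℚ.≤ l⁺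
    l≤l⁺ = F.≤-by (ℚₚ.<⇒≤ ⅓w>0) refl

    l⁺+w⁻≡ : l⁺ ℚ.+ w⁻ ≡ l I ℚ.+ w I
    l⁺+w⁻≡ = solve 2 (λ l w → (l :+ con F.⅓ :* w) :+ con F.⅔ :* w := l :+ w) refl (l I) (w I)

    l⁺<r⁻ : l⁺ ℚ.< r⁻
    l⁺<r⁻ = F.<-by ⅓w>0
      (solve 2 (λ l w → (l :+ con F.⅓ :* w) :+ con F.⅓ :* w := l :+ con F.⅔ :* w) refl (l I) (w I))

    r⁻≤ : r⁻ ℚ.≤ l I ℚ.+ w I
    r⁻≤ = F.≤-by (ℚₚ.<⇒≤ ⅓w>0)
      (solve 2 (λ l w → (l :+ con F.⅔ :* w) :+ con F.⅓ :* w := l :+ w) refl (l I) (w I))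

    choice : (f l⁺ < y) ⊎ (y < f r⁻)
    choice = <-cotrans {f l⁺} {f r⁻} y
      (increasing (ℚₚ.≤-trans (a≤l I) l≤l⁺) l⁺<r⁻ (ℚₚ.≤-trans r⁻≤ (l+w≤b I)))

    refine : (f l⁺ < y) ⊎ (y < f r⁻) → Interval
    refine (inj₁ _) = interval l⁺ w⁻ (ℚₚ.≤-trans (a≤l I) l≤l⁺) w⁻>0
                        (ℚₚ.≤-trans (ℚₚ.≤-reflexive l⁺+w⁻≡) (l+w≤b I))
    refine (inj₂ _) = interval (l I) w⁻ (a≤l I) w⁻>0 (ℚₚ.≤-trans r⁻≤ (l+w≤b I))

    refine-w : ∀ c → w (refine c) ≡ w⁻
    refine-w (inj₁ _) = refl
    refine-w (inj₂ _) = refl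

    refine-l : ∀ c → l I ℚ.≤ l (refine c)
    refine-l (inj₁ _) = l≤l⁺
    refine-l (inj₂ _) = ℚₚ.≤-refl

    refine-r : ∀ c → l (refine c) ℚ.+ w (refine c) ℚ.≤ l I ℚ.+ w I
    refine-r (inj₁ _) = ℚₚ.≤-reflexive l⁺+w⁻≡
    refine-r (inj₂ _) = r⁻≤

  trisect : ℕ → Interval
  trisect zero    = start
  trisect (suc n) = refine (trisect n) (choice (trisect n))

  solution : ℝ
  solution = real (λ n → l (trisect n)) (F.nested-cauchy
    (λ n → l (trisect n)) (λ n → w (trisect n))
    (λ n → ℚₚ.<⇒≤ (0<w (trisect n)))
    (λ n → ℚₚ.≤-reflexive (refine-w (trisect n) (choice (trisect n))))
    (λ n → refine-l (trisect n) (choice (trisect n)))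
    (λ n → refine-r (trisect n) (choice (trisect n))))

-- The square root of x ≥ 0: the solution c of c * c = x with
-- 0 ≤ c ≤ upperBound x.  (If x < 0 this is 0.)
√_ : ℝ → ℝ
√ x = Solve.solution (λ p → fromℚ (p ℚ.* p)) 0ℚ (upperBound x) (0<upperBound x)
  (λ {p} {q} 0≤p p<q _ →
    q ℚ.* q ℚ.- p ℚ.* p , F.diff>0 (F.square-mono 0≤p p<q) , 0 , λ _ _ →
      ℚₚ.≤-reflexive (+-*-Solver.solve 2 (λ s t → s :+ (t :- s) := t) refl (p ℚ.* p) (q ℚ.* q)))
  x
  where open +-*-Solver

-- The n-th approximation to exp x is Σ_{j<n} (x n)^j / j!; similarly for cos
-- and sin.
exp cos sin : ℝ → ℝ
exp x = real (λ n → F.partial F.one (seq x n) n) (F.partial-cauchy F.one F.one≤1 {seq x} (cauchy x))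
cos x = real (λ n → F.partial F.cosSign (seq x n) n) (F.partial-cauchy F.cosSign F.cosSign≤1 {seq x} (cauchy x))
sin x = real (λ n → F.partial F.sinSign (seq x n) n) (F.partial-cauchy F.sinSign F.sinSign≤1 {seq x} (cauchy x))

-- The natural logarithm of x ≥ 1: the solution c of exp c = x with
-- 0 ≤ c ≤ upperBound x.  (If x < 1 this is 0.)
log : ℝ → ℝ
log x = Solve.solution (λ p → exp (fromℚ p)) 0ℚ (upperBound x) (0<upperBound x)
  (λ {p} {q} 0≤p p<q _ → F.exp-increasing {p} {q} 0≤p p<q) x

-- π is twice the unique zero of cos in [0 , 2].
π : ℝ
π = fromℕ 2 * Solve.solution (λ p → - cos (fromℚ p)) 0ℚ F.2ℚ (ℚₚ.positive⁻¹ F.2ℚ)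
  (λ {p} {q} 0≤p p<q q≤2 → neg-flip {F.partial F.cosSign q} {F.partial F.cosSign p}
    (F.cos-decreasing {p} {q} 0≤p p<q q≤2)) 0ℝ
  where
  open +-*-Solver
  neg-flip : ∀ {x y : ℕ → ℚ} → x <ₛ y → (λ n → ℚ.- y n) <ₛ (λ n → ℚ.- x n)
  neg-flip {x} {y} (ε , 0<ε , N , h) = ε , 0<ε , N , λ n N≤n →
    subst₂ ℚ._≤_
      (solve 3 (λ x y e → (x :+ e) :+ (:- x :- y) := :- y :+ e) refl (x n) (y n) ε)
      (solve 2 (λ x y → y :+ (:- x :- y) := :- x) refl (x n) (y n))
      (ℚₚ.+-monoˡ-≤ (ℚ.- x n ℚ.- y n) (h n N≤n))

-- The torus ℝ/ℤ.  There are no quotient types, so a point is given by any real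
-- representative t; ∥ t ∥ (the distance from t to the nearest integer) and
-- e^{2πikt} for k ∈ ℤ depend only on t modulo ℤ.

𝕋 : Set
𝕋 = ℝ

∥_∥ : ℝ → ℝ
∥ t ∥ = real (λ n → F.toNearestℤ (seq t n)) (F.nonexpansive {seq t} {F.toNearestℤ} F.toNearestℤ-nonexpansive (cauchy t))

record ℂ : Set where
  constructor _+i_
  field
    re im : ℝ
open ℂ public

_+ᶜ_ : ℂ → ℂ → ℂ
z +ᶜ u = (re z + re u) +i (im z + im u)

∣_∣ : ℂ → ℝ
∣ z ∣ = √ (re z * re z + im z * im z)

_² : ℝ → ℝ
x ² = x * x

e^i_ : ℝ → ℂ
e^i θ = cos θ +i sin θ

∑ : ∀ {n} → (Fin n → ℂ) → ℂ
∑ = Vector.foldr _+ᶜ_ (0ℝ +i 0ℝ)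

∑ᴸ : {A : Set} → List A → (A → ℝ) → ℝ
∑ᴸ xs f = foldr _+_ 0ℝ (map f xs)

-- xs lists every element satisfying P exactly once, so that # {x : P x} is
-- length xs and the sum of f over {x : P x} is ∑ᴸ xs f.  P need not be
-- decidable, but a P contained in a finite list has an enumeration up to
-- double negation; as _≤_ is stable under double negation, nothing is lost by
-- stating an inequality for every enumeration of P.
Enumerates : {A : Set} → List A → (A → Set) → Set
Enumerates xs P = Unique xs × (∀ x → x ∈ xs ⇔ P x)

{-# OPTIONS --safe #-}

-- Replace x_n by an integer X_n with |x_n - X_n / M| ≤ 2 / M, where M = N H and
-- H is large, and put D ≈ 1 / δ, R = D H.  Let v(j) be the number of pairs (n , r)
-- with r < R and X_n + r ≡ j modulo M.  Its k-th Fourier coefficient on ℤ/M is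
-- (Σ_n e(k X_n / M)) (Σ_{r<R} e(k r / M)): for k = 0 this is N R, and for
-- |k| ≤ N / (16 D) the second factor has modulus at least R / √2.  Hence Bessel's
-- inequality reads
--   N² R² + ½ R² Σ_{k≠0} |Σ_n e(k X_n / M)|² ≤ M Σ_j v(j)².
-- The last sum counts coincidences X_m + r ≡ X_n + r′, so it is at most
-- N R + Σ_{t<R} #{m ≠ n : X_m - X_n is within t of a multiple of M}, and the
-- hypothesis with s = (t + 2H) / H bounds the right side by N² R² (1 + O(δ)).
-- The main terms N² R² cancel.  Only s ≤ 1 / δ is used, which is allowed because
-- 8 √(log N) ≥ 1 for N ≥ 2.

module Submission where

open import Algebra.Bundles using (CommutativeRing)
import Algebra.Properties.Semiring.Sum as SemiringSum
import Algebra.Solver.Ring as RingSolver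
open import Algebra.Solver.Ring.AlmostCommutativeRing
  using (AlmostCommutativeRing; fromCommutativeRing; _-Raw-AlmostCommutative⟶_)
open import Algebra.Structures using (IsCommutativeRing)
open import Data.Bool using (if_then_else_)
open import Data.Fin as Fin using (Fin; zero; suc; toℕ; fromℕ<)
import Data.Fin.Properties as Finₚ
open import Data.Integer as ℤ using (ℤ; +_; -[1+_]; 0ℤ)
import Data.Integer.DivMod as ℤᵈ
open import Data.Integer.Divisibility.Signed using (_∣_; divides; _∣?_; ∣⇒∣ᵤ; ∣m∣n⇒∣m-n)
import Data.Integer.Properties as ℤₚ
import Data.Integer.Solver as ℤ-Solver
open import Data.List as List using (List; []; _∷_; length; filter; map; foldr; cartesianProduct; allFin; tabulate)
open import Data.List.Membership.Propositional.Properties using (∈-filter⁺; ∈-filter⁻; ∈-cartesianProduct⁺; ∈-allFin)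
import Data.List.Properties as Listₚ
open import Data.List.Relation.Unary.All as All using (All; []; _∷_)
open import Data.List.Relation.Unary.AllPairs using (AllPairs; []; _∷_)
open import Data.List.Relation.Unary.Unique.Propositional using (Unique)
open import Data.List.Relation.Unary.Unique.Propositional.Properties using (filter⁺; cartesianProduct⁺; allFin⁺)
open import Data.Maybe using (Maybe; just; nothing)
open import Data.Nat as ℕ using (ℕ; zero; suc; NonZero; z≤n; s≤s)
import Data.Nat.Divisibility as ℕᵈ
open import Data.Nat.ListAction using () renaming (sum to sumˡ)
open import Data.Nat.ListAction.Properties using (sum-++)
import Data.Nat.Properties as ℕₚ
import Data.Nat.Solver as ℕ-Solver
open import Data.Product using (_×_; _,_; proj₁; proj₂; ∃-syntax; uncurry)
open import Data.Rational as ℚ using (ℚ; 0ℚ; 1ℚ; ½)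
import Data.Rational.Properties as ℚₚ
import Data.Rational.Solver as ℚ-Solver
open import Data.Sum using (_⊎_; inj₁; inj₂)
open import Data.Vec.Functional using (Vector)
open import Effect.Monad using (RawMonad)
open import Function using (_∘_; mk⇔; Equivalence)
open import Level using (0ℓ)
open import Relation.Binary.PropositionalEquality as ≡ using (_≡_; _≢_)
open import Relation.Nullary using (¬_; Dec; does; yes; no; contradiction; ¬¬-excluded-middle)
open import Relation.Nullary.Decidable using (decidable-stable)
open import Relation.Nullary.Negation using (¬¬-Monad; ¬¬-map)
open import Relation.Unary using (Decidable)
open import Defs using (module RationalFacts; Enumerates)

-- The hypothesis bounds pair counts only from above, so the counts must enter with nonnegative
-- weights. The box of length R supplies them: a difference w is counted R - |w| times, and this
-- Fejér weight is the sum of the indicators of the windows |w| ≤ t with t < R. Relative to N² R²,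
-- the excess left after the cancellation is at most 10 / D: 1 / D from the diagonal m = n, 1 / D
-- from the factor 1 + δ, and 8 / D from the enlargement of the radii by 2H. The factor ½ turns 10
-- into 20, the passage from rounded to given points turns 20 into 2 · 20 + 1 = 41, and 1 ≤ 2 D δ
-- gives C = 82. The value δ₀ = 1/256 makes √δ ≤ 1/16, which together with D δ ≤ 1 turns |k| ≤ δ √δ
-- N into |k| ≤ N / (16 D). The order of ℝ is undecidable, so the near pairs can be listed only up
-- to double negation. After rounding, every count is a statement about integers, where inequalities
-- are decidable and the double negation can be removed.

module Ordered where

  -- Ordered commutative ℚ-algebras.

  ℤ→ℚ : ℤ → ℚ
  ℤ→ℚ i = i ℚ./ 1

  -- `i / 1` passes through a gcd and is stuck for a variable `i`, whereas `RationalFacts.fromℤ i`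
  -- is a normal form. The rewrites move to the latter, where a sum unfolds to a quotient over 1.
  ℤ→ℚ-+ : ∀ i j → ℤ→ℚ (i ℤ.+ j) ≡ ℤ→ℚ i ℚ.+ ℤ→ℚ j
  ℤ→ℚ-+ i j rewrite ≡.sym (RationalFacts.fromℤ≡/1 i) | ≡.sym (RationalFacts.fromℤ≡/1 j) =
    ≡.cong (ℚ._/ 1) (≡.sym (≡.cong₂ ℤ._+_ (ℤₚ.*-identityʳ i) (ℤₚ.*-identityʳ j)))

  ℤ→ℚ-* : ∀ i j → ℤ→ℚ (i ℤ.* j) ≡ ℤ→ℚ i ℚ.* ℤ→ℚ j
  ℤ→ℚ-* i j rewrite ≡.sym (RationalFacts.fromℤ≡/1 i) | ≡.sym (RationalFacts.fromℤ≡/1 j) = ≡.refl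

  ℤ→ℚ-neg : ∀ i → ℤ→ℚ (ℤ.- i) ≡ ℚ.- ℤ→ℚ i
  ℤ→ℚ-neg i = inverseˡ-unique (ℤ→ℚ (ℤ.- i)) (ℤ→ℚ i)
    (≡.trans (≡.sym (ℤ→ℚ-+ (ℤ.- i) i)) (≡.cong ℤ→ℚ (ℤₚ.+-inverseˡ i)))
    where open import Algebra.Properties.Group ℚₚ.+-0-group using (inverseˡ-unique)

  ℤ→ℚ-mono : ∀ {i j} → i ℤ.≤ j → ℤ→ℚ i ℚ.≤ ℤ→ℚ j
  ℤ→ℚ-mono {i} {j} i≤j rewrite ≡.sym (RationalFacts.fromℤ≡/1 i) | ≡.sym (RationalFacts.fromℤ≡/1 j) =
    RationalFacts.fromℤ-mono i≤j

  ℤ→ℚ-cancel : ∀ {i j} → ℤ→ℚ i ℚ.≤ ℤ→ℚ j → i ℤ.≤ j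
  ℤ→ℚ-cancel {i} {j} p rewrite ≡.sym (RationalFacts.fromℤ≡/1 i) | ≡.sym (RationalFacts.fromℤ≡/1 j) =
    ≡.subst₂ ℤ._≤_ (ℤₚ.*-identityʳ i) (ℤₚ.*-identityʳ j) (ℚₚ.drop-*≤* p)

  -- ≤-total is doubly negated because the order of ℝ is not decidable; as ≤ is
  -- stable, an inequality may still be proved by comparing any two elements.
  record OrderedAlgebra : Set₁ where
    infix  4 _≈_ _≤_
    infixl 6 _+_
    infixl 7 _*_
    infix  8 -_
    field
      Carrier : Set
      _≈_ _≤_ : Carrier → Carrier → Set
      _+_ _*_ : Carrier → Carrier → Carrier
      -_      : Carrier → Carrier
      fromℚ   : ℚ → Carrier
      isCommutativeRing : IsCommutativeRing _≈_ _+_ _*_ -_ (fromℚ 0ℚ) (fromℚ 1ℚ)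
      fromℚ-+      : ∀ p q → fromℚ (p ℚ.+ q) ≈ fromℚ p + fromℚ q
      fromℚ-*      : ∀ p q → fromℚ (p ℚ.* q) ≈ fromℚ p * fromℚ q
      fromℚ-neg    : ∀ p → fromℚ (ℚ.- p) ≈ - fromℚ p
      fromℚ-mono   : ∀ {p q} → p ℚ.≤ q → fromℚ p ≤ fromℚ q
      fromℚ-cancel : ∀ {p q} → fromℚ p ≤ fromℚ q → p ℚ.≤ q
      ≤-reflexive  : ∀ {x y} → x ≈ y → x ≤ y
      ≤-trans      : ∀ {x y z} → x ≤ y → y ≤ z → x ≤ z
      ≤-antisym    : ∀ {x y} → x ≤ y → y ≤ x → x ≈ y
      +-monoʳ-≤    : ∀ z {x y} → x ≤ y → z + x ≤ z + y
      *-nonNeg     : ∀ {x y} → fromℚ 0ℚ ≤ x → fromℚ 0ℚ ≤ y → fromℚ 0ℚ ≤ x * y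
      ≤-stable     : ∀ {x y} → ¬ ¬ (x ≤ y) → x ≤ y
      ≤-total      : ∀ x y → ¬ ¬ (x ≤ y ⊎ y ≤ x)

  module OrderedAlgebraProperties (𝔸 : OrderedAlgebra) where

    open OrderedAlgebra 𝔸 public

    0# 1# : Carrier
    0# = fromℚ 0ℚ
    1# = fromℚ 1ℚ

    infixl 6 _-_
    _-_ : Carrier → Carrier → Carrier
    x - y = x + - y

    fromℤ : ℤ → Carrier
    fromℤ i = fromℚ (i ℚ./ 1)

    fromℕ : ℕ → Carrier
    fromℕ n = fromℤ (+ n)

    commutativeRing : CommutativeRing 0ℓ 0ℓ
    commutativeRing = record { isCommutativeRing = isCommutativeRing }

    open CommutativeRing commutativeRing public
      using (refl; sym; trans; reflexive; +-cong; +-congˡ; +-congʳ; *-cong; *-congˡ; *-congʳ; -‿cong;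
             +-identityˡ; +-identityʳ; +-comm; +-assoc; *-identityˡ; *-identityʳ; *-comm; *-assoc;
             zeroˡ; zeroʳ; distribˡ; -‿inverseʳ; -‿inverseˡ; semiring)

    open SemiringSum semiring public
      using (sum; sum-cong-≋; ∑-distrib-+; ∑-comm; *-distribˡ-sum; *-distribʳ-sum; sum-replicate-zero)

    fromℚ-cong : ∀ {p q} → p ≡ q → fromℚ p ≈ fromℚ q
    fromℚ-cong e = reflexive (≡.cong fromℚ e)

    private
      almostCommutativeRing : AlmostCommutativeRing 0ℓ 0ℓ
      almostCommutativeRing = fromCommutativeRing commutativeRing

      morphism : CommutativeRing.rawRing ℚₚ.+-*-commutativeRing -Raw-AlmostCommutative⟶ almostCommutativeRing
      morphism = record
        { ⟦_⟧ = fromℚ ; +-homo = fromℚ-+ ; *-homo = fromℚ-* ; -‿homo = fromℚ-neg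
        ; 0-homo = refl ; 1-homo = refl }

      fromℚ-≟ : ∀ p q → Maybe (fromℚ p ≈ fromℚ q)
      fromℚ-≟ p q with p ℚₚ.≟ q
      ... | yes e = just (fromℚ-cong e)
      ... | no  _ = nothing

    module Solver = RingSolver (CommutativeRing.rawRing ℚₚ.+-*-commutativeRing) almostCommutativeRing morphism fromℚ-≟
    open Solver using (solve; _:+_; _:*_; _:-_; :-_; _:=_; con)

    fromℤ-+ : ∀ i j → fromℤ (i ℤ.+ j) ≈ fromℤ i + fromℤ j
    fromℤ-+ i j = trans (fromℚ-cong (ℤ→ℚ-+ i j)) (fromℚ-+ _ _)

    fromℤ-* : ∀ i j → fromℤ (i ℤ.* j) ≈ fromℤ i * fromℤ j
    fromℤ-* i j = trans (fromℚ-cong (ℤ→ℚ-* i j)) (fromℚ-* _ _)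

    fromℤ-neg : ∀ i → fromℤ (ℤ.- i) ≈ - fromℤ i
    fromℤ-neg i = trans (fromℚ-cong (ℤ→ℚ-neg i)) (fromℚ-neg _)

    fromℤ-mono : ∀ {i j} → i ℤ.≤ j → fromℤ i ≤ fromℤ j
    fromℤ-mono i≤j = fromℚ-mono (ℤ→ℚ-mono i≤j)

    fromℕ-+ : ∀ m n → fromℕ (m ℕ.+ n) ≈ fromℕ m + fromℕ n
    fromℕ-+ m n = fromℤ-+ (+ m) (+ n)

    fromℕ-* : ∀ m n → fromℕ (m ℕ.* n) ≈ fromℕ m * fromℕ n
    fromℕ-* m n = trans (reflexive (≡.cong fromℤ (ℤₚ.pos-* m n))) (fromℤ-* (+ m) (+ n))

    fromℕ-mono : ∀ {m n} → m ℕ.≤ n → fromℕ m ≤ fromℕ n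
    fromℕ-mono m≤n = fromℤ-mono (ℤ.+≤+ m≤n)

    fromℕ-cancel : ∀ {m n} → fromℕ m ≤ fromℕ n → m ℕ.≤ n
    fromℕ-cancel p = ℤₚ.drop‿+≤+ (ℤ→ℚ-cancel (fromℚ-cancel p))

    fromℕ-nonNeg : ∀ n → 0# ≤ fromℕ n
    fromℕ-nonNeg n = fromℕ-mono (ℕ.z≤n {n})

    ≤-refl : ∀ {x} → x ≤ x
    ≤-refl = ≤-reflexive refl

    ≤-respˡ : ∀ {x y z} → x ≈ y → x ≤ z → y ≤ z
    ≤-respˡ e p = ≤-trans (≤-reflexive (sym e)) p

    ≤-respʳ : ∀ {x y z} → x ≈ y → z ≤ x → z ≤ y
    ≤-respʳ e p = ≤-trans p (≤-reflexive e)

    +-mono-≤ : ∀ {x y u v} → x ≤ y → u ≤ v → x + u ≤ y + v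
    +-mono-≤ {x} {y} {u} {v} p q = ≤-trans (+-monoʳ-≤ x q)
      (≤-respˡ (+-comm v x) (≤-respʳ (+-comm v y) (+-monoʳ-≤ v p)))

    +-nonNeg : ∀ {x y} → 0# ≤ x → 0# ≤ y → 0# ≤ x + y
    +-nonNeg p q = ≤-respˡ (+-identityˡ 0#) (+-mono-≤ p q)

    -- The usual shape of an inequality proof below: exhibit the nonnegative difference `r` and
    -- leave the identity to the ring solver.
    ≤-by : ∀ {x y r} → 0# ≤ r → x + r ≈ y → x ≤ y
    ≤-by {x} 0≤r e = ≤-respˡ (+-identityʳ x) (≤-respʳ e (+-monoʳ-≤ x 0≤r))

    x≤y⇒0≤y-x : ∀ {x y} → x ≤ y → 0# ≤ y - x
    x≤y⇒0≤y-x {x} {y} p = ≤-respˡ (-‿inverseˡ x) (≤-respʳ (+-comm (- x) y) (+-monoʳ-≤ (- x) p))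

    neg-mono-≤ : ∀ {x y} → x ≤ y → - y ≤ - x
    neg-mono-≤ {x} {y} p = ≤-by (x≤y⇒0≤y-x p) (solve 2 (λ x y → :- y :+ (y :- x) := :- x) refl x y)

    *-monoˡ-≤ : ∀ {x y z} → 0# ≤ z → x ≤ y → z * x ≤ z * y
    *-monoˡ-≤ {x} {y} {z} 0≤z p = ≤-by (*-nonNeg 0≤z (x≤y⇒0≤y-x p))
      (solve 3 (λ x y z → z :* x :+ z :* (y :- x) := z :* y) refl x y z)

    *-monoʳ-≤ : ∀ {x y z} → 0# ≤ z → x ≤ y → x * z ≤ y * z
    *-monoʳ-≤ {x} {y} {z} 0≤z p = ≤-respˡ (*-comm z x) (≤-respʳ (*-comm z y) (*-monoˡ-≤ 0≤z p))

    *-mono-≤ : ∀ {x y u v} → 0# ≤ x → 0# ≤ v → x ≤ y → u ≤ v → x * u ≤ y * v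
    *-mono-≤ 0≤x 0≤v p q = ≤-trans (*-monoˡ-≤ 0≤x q) (*-monoʳ-≤ 0≤v p)

    ≤-by-cases : ∀ {x y} u v → (u ≤ v → x ≤ y) → (v ≤ u → x ≤ y) → x ≤ y
    ≤-by-cases u v f g = ≤-stable λ k → ≤-total u v λ { (inj₁ p) → k (f p) ; (inj₂ p) → k (g p) }

    square-nonNeg : ∀ x → 0# ≤ x * x
    square-nonNeg x = ≤-by-cases 0# x (λ p → *-nonNeg p p)
      (λ p → ≤-respʳ (solve 1 (λ x → (con 0ℚ :- x) :* (con 0ℚ :- x) := x :* x) refl x)
        (*-nonNeg (x≤y⇒0≤y-x p) (x≤y⇒0≤y-x p)))

    *-cancelˡ-≤ : ∀ {p x y} → 0ℚ ℚ.< p → fromℚ p * x ≤ fromℚ p * y → x ≤ y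
    *-cancelˡ-≤ {p} {x} {y} 0<p h = ≤-respˡ (cancel x) (≤-respʳ (cancel y) (*-monoˡ-≤ 0≤i h))
      where
      i = RationalFacts.inv 0<p
      0≤i : 0# ≤ fromℚ i
      0≤i = fromℚ-mono (ℚₚ.<⇒≤ (RationalFacts.inv>0 0<p))
      cancel : ∀ z → fromℚ i * (fromℚ p * z) ≈ z
      cancel z = trans (solve 3 (λ i p z → i :* (p :* z) := (p :* i) :* z) refl (fromℚ i) (fromℚ p) z)
        (trans (*-congʳ (trans (sym (fromℚ-* p i)) (fromℚ-cong (RationalFacts.inv-inverse 0<p)))) (*-identityˡ z))

    -- Positivity of `a` is witnessed by a positive rational below it, since the algebra carries no
    -- strict order. If 0 ≤ b, then p b ≤ a b ≤ 0 = p · 0, and p cancels.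
    ≤-nonPos-cancel : ∀ {p a b} → 0ℚ ℚ.< p → fromℚ p ≤ a → a * b ≤ 0# → b ≤ 0#
    ≤-nonPos-cancel {p} {a} {b} 0<p p≤a ab≤0 = ≤-by-cases b 0# (λ h → h)
      (λ 0≤b → *-cancelˡ-≤ 0<p (≤-trans (*-monoʳ-≤ 0≤b p≤a) (≤-respʳ (sym (zeroʳ (fromℚ p))) ab≤0)))

    *≈0⇒≈0 : ∀ {p a b} → 0ℚ ℚ.< p → fromℚ p ≤ a → a * b ≈ 0# → b ≈ 0#
    *≈0⇒≈0 {p} {a} {b} 0<p p≤a e = ≤-antisym (≤-nonPos-cancel 0<p p≤a (≤-reflexive e))
      (≤-respʳ (solve 1 (λ b → :- (:- b) := b) refl b)
        (≤-respˡ (solve 0 (:- con 0ℚ := con 0ℚ) refl) (neg-mono-≤ (≤-nonPos-cancel 0<p p≤a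
          (≤-reflexive (trans (solve 2 (λ a b → a :* (:- b) := :- (a :* b)) refl a b)
            (trans (-‿cong e) (solve 0 (:- con 0ℚ := con 0ℚ) refl))))))))

    sum-mono : ∀ {n} {f g : Vector Carrier n} → (∀ i → f i ≤ g i) → sum f ≤ sum g
    sum-mono {zero}  h = ≤-refl
    sum-mono {suc n} h = +-mono-≤ (h zero) (sum-mono (λ i → h (suc i)))

    sum-nonNeg : ∀ {n} {f : Vector Carrier n} → (∀ i → 0# ≤ f i) → 0# ≤ sum f
    sum-nonNeg {zero}  h = ≤-refl
    sum-nonNeg {suc n} h = +-nonNeg (h zero) (sum-nonNeg (λ i → h (suc i)))

    sum-neg : ∀ {n} (f : Vector Carrier n) → sum (λ i → - f i) ≈ - sum f
    sum-neg {zero}  f = solve 0 (con 0ℚ := :- con 0ℚ) refl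
    sum-neg {suc n} f = trans (+-congˡ (sum-neg (λ i → f (suc i))))
      (solve 2 (λ a b → :- a :+ :- b := :- (a :+ b)) refl _ _)

    sum-const : ∀ n x → sum {n} (λ _ → x) ≈ fromℕ n * x
    sum-const zero    x = sym (zeroˡ x)
    sum-const (suc n) x = trans (+-congˡ (sum-const n x))
      (trans (solve 2 (λ x n → x :+ n :* x := (con 1ℚ :+ n) :* x) refl x (fromℕ n)) (*-congʳ (sym (fromℕ-+ 1 n))))

    -- Meant for x = 1/δ and y = √(log N): the range of radii in the hypothesis then reaches 1/δ.
    ≤-8* : ∀ {x y} → 0# ≤ x → fromℚ (+ 1 ℚ./ 8) ≤ y → x ≤ fromℕ 8 * x * y
    ≤-8* {x} {y} 0≤x h = ≤-by (*-nonNeg (*-nonNeg (fromℕ-nonNeg 8) 0≤x) (x≤y⇒0≤y-x h))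
      (solve 2 (λ x y → x :+ (con (+ 8 ℚ./ 1) :* x) :* (y :- con (+ 1 ℚ./ 8)) := con (+ 8 ℚ./ 1) :* x :* y) refl x y)

-- Trigonometry and the characters of the circle.

module Circle where

  open Ordered

  -- The constant 1/6 is 1/2 - 1/3, the quadratic coefficient of the cosine series less a bound for
  -- its tail. Periodicity is derived from `cos-halfπ` and the addition formulas.
  record Trigonometry (𝔸 : OrderedAlgebra) : Set where
    open OrderedAlgebraProperties 𝔸
    field
      cos sin   : Carrier → Carrier
      π         : Carrier
      cos-cong  : ∀ {x y} → x ≈ y → cos x ≈ cos y
      sin-cong  : ∀ {x y} → x ≈ y → sin x ≈ sin y
      cos-+     : ∀ x y → cos (x + y) ≈ cos x * cos y - sin x * sin y
      sin-+     : ∀ x y → sin (x + y) ≈ sin x * cos y + cos x * sin y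
      cos-neg   : ∀ x → cos (- x) ≈ cos x
      sin-neg   : ∀ x → sin (- x) ≈ - sin x
      1-cos≤    : ∀ {x} → - fromℚ ½ ≤ x → x ≤ fromℚ ½ → 1# - cos x ≤ x * x
      ≤1-cos    : ∀ {x} → - fromℚ ½ ≤ x → x ≤ fromℚ ½ → x * x * fromℚ (+ 1 ℚ./ 6) ≤ 1# - cos x
      cos-halfπ : cos (fromℚ ½ * π) ≈ 0#
      1≤π       : 1# ≤ π
      π≤4       : π ≤ fromℕ 4

  module TrigonometryProperties (𝔸 : OrderedAlgebra) (𝕋 : Trigonometry 𝔸) where

    open OrderedAlgebraProperties 𝔸
    open Trigonometry 𝕋
    open Solver using (solve; _:+_; _:*_; _:-_; :-_; _:=_; con)

    -- The two quadratic bounds at x = 0 squeeze 1 - cos 0 between 0 and 0.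
    cos-0 : cos 0# ≈ 1#
    cos-0 = ≤-antisym
      (≤-by (≤-trans (≤-reflexive (solve 0 (con 0ℚ := con 0ℚ :* con 0ℚ :* con (+ 1 ℚ./ 6)) refl)) (≤1-cos l u))
        (solve 1 (λ c → c :+ (con 1ℚ :- c) := con 1ℚ) refl (cos 0#)))
      (≤-by (x≤y⇒0≤y-x (1-cos≤ l u)) (solve 1 (λ c → con 1ℚ :+ (con 0ℚ :* con 0ℚ :- (con 1ℚ :- c)) := c) refl (cos 0#)))
      where
      l : - fromℚ ½ ≤ 0#
      l = ≤-respˡ (fromℚ-neg ½) (fromℚ-mono (ℚₚ.nonPositive⁻¹ (ℚ.- ½)))
      u : 0# ≤ fromℚ ½
      u = fromℚ-mono (ℚₚ.nonNegative⁻¹ ½)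

    -- Oddness gives 2 sin 0 = sin 0 - sin (-0) = 0.
    sin-0 : sin 0# ≈ 0#
    sin-0 = *≈0⇒≈0 {2ℚ} (ℚₚ.positive⁻¹ 2ℚ) ≤-refl (trans
      (solve 1 (λ s → con 2ℚ :* s := s :- (:- s)) refl (sin 0#))
      (trans (+-congˡ (-‿cong (sym (sin-neg 0#))))
        (trans (+-congˡ (-‿cong (sin-cong (solve 0 (:- con 0ℚ := con 0ℚ) refl)))) (-‿inverseʳ (sin 0#)))))
      where 2ℚ = + 2 ℚ./ 1

    -- The addition formula for cos (x + (-x)), with parity.
    cos²+sin²≈1 : ∀ x → cos x * cos x + sin x * sin x ≈ 1#
    cos²+sin²≈1 x = trans (solve 2 (λ c s → c :* c :+ s :* s := c :* c :- s :* (:- s)) refl (cos x) (sin x))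
      (trans (+-cong (*-congˡ (sym (cos-neg x))) (-‿cong (*-congˡ (sym (sin-neg x)))))
        (trans (sym (cos-+ x (- x))) (trans (cos-cong (-‿inverseʳ x)) cos-0)))

    -- The character t ↦ (c t , s t) = e^{2πit} of the circle.
    c s : Carrier → Carrier
    c t = cos (fromℕ 2 * π * t)
    s t = sin (fromℕ 2 * π * t)

    c-cong : ∀ {t u} → t ≈ u → c t ≈ c u
    c-cong e = cos-cong (*-congˡ e)

    s-cong : ∀ {t u} → t ≈ u → s t ≈ s u
    s-cong e = sin-cong (*-congˡ e)

    c-+ : ∀ t u → c (t + u) ≈ c t * c u - s t * s u
    c-+ t u = trans (cos-cong (distribˡ _ t u)) (cos-+ _ _)

    s-+ : ∀ t u → s (t + u) ≈ s t * c u + c t * s u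
    s-+ t u = trans (sin-cong (distribˡ _ t u)) (sin-+ _ _)

    c-neg : ∀ t → c (- t) ≈ c t
    c-neg t = trans (cos-cong (solve 2 (λ a t → a :* (:- t) := :- (a :* t)) refl (fromℕ 2 * π) t)) (cos-neg _)

    s-neg : ∀ t → s (- t) ≈ - s t
    s-neg t = trans (sin-cong (solve 2 (λ a t → a :* (:- t) := :- (a :* t)) refl (fromℕ 2 * π) t)) (sin-neg _)

    c-sub : ∀ t u → c (t - u) ≈ c t * c u + s t * s u
    c-sub t u = trans (c-+ t (- u)) (trans (+-cong (*-congˡ (c-neg u)) (-‿cong (*-congˡ (s-neg u))))
      (solve 4 (λ a b x y → a :* b :- x :* (:- y) := a :* b :+ x :* y) refl (c t) (c u) (s t) (s u)))

    s-sub : ∀ t u → s (t - u) ≈ s t * c u - c t * s u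
    s-sub t u = trans (s-+ t (- u)) (trans (+-cong (*-congˡ (c-neg u)) (*-congˡ (s-neg u)))
      (solve 4 (λ a b x y → x :* b :+ a :* (:- y) := x :* b :- a :* y) refl (c t) (c u) (s t) (s u)))

    c²+s²≈1 : ∀ t → c t * c t + s t * s t ≈ 1#
    c²+s²≈1 t = cos²+sin²≈1 _

    c-0 : c 0# ≈ 1#
    c-0 = trans (cos-cong (zeroʳ _)) cos-0

    s-0 : s 0# ≈ 0#
    s-0 = trans (sin-cong (zeroʳ _)) sin-0

    private
      h : Carrier
      h = fromℚ ½ * π
      h+h≈π : h + h ≈ π
      h+h≈π = solve 1 (λ p → con ½ :* p :+ con ½ :* p := p) refl π

      -- Doubling π/2 uses sin (π/2) only squared or multiplied by cos (π/2) = 0, so its sign never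
      -- has to be determined.
      sin²h≈1 : sin h * sin h ≈ 1#
      sin²h≈1 = trans (solve 1 (λ s → s :* s := con 0ℚ :* con 0ℚ :+ s :* s) refl (sin h))
        (trans (+-congʳ (*-cong (sym cos-halfπ) (sym cos-halfπ))) (cos²+sin²≈1 h))

      cos-π : cos π ≈ - 1#
      cos-π = trans (cos-cong (sym h+h≈π)) (trans (cos-+ h h)
        (trans (+-cong (*-cong cos-halfπ cos-halfπ) (-‿cong sin²h≈1)) (solve 0 (con 0ℚ :* con 0ℚ :- con 1ℚ := :- con 1ℚ) refl)))

      sin-π : sin π ≈ 0#
      sin-π = trans (sin-cong (sym h+h≈π)) (trans (sin-+ h h)
        (trans (+-cong (*-congˡ cos-halfπ) (*-congʳ cos-halfπ)) (solve 1 (λ s → s :* con 0ℚ :+ con 0ℚ :* s := con 0ℚ) refl (sin h))))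

      2π≈π+π : fromℕ 2 * π * 1# ≈ π + π
      2π≈π+π = solve 1 (λ p → con (+ 2 ℚ./ 1) :* p :* con 1ℚ := p :+ p) refl π

    c-1 : c 1# ≈ 1#
    c-1 = trans (cos-cong 2π≈π+π) (trans (cos-+ π π) (trans
      (+-cong (*-cong cos-π cos-π) (-‿cong (*-cong sin-π sin-π)))
      (solve 0 ((:- con 1ℚ) :* (:- con 1ℚ) :- con 0ℚ :* con 0ℚ := con 1ℚ) refl)))

    s-1 : s 1# ≈ 0#
    s-1 = trans (sin-cong 2π≈π+π) (trans (sin-+ π π) (trans
      (+-cong (*-congʳ sin-π) (*-congˡ sin-π))
      (solve 1 (λ c → con 0ℚ :* c :+ c :* con 0ℚ := con 0ℚ) refl (cos π))))

    c,s-fromℕ : ∀ n → (c (fromℕ n) ≈ 1#) × (s (fromℕ n) ≈ 0#)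
    c,s-fromℕ zero    = c-0 , s-0
    c,s-fromℕ (suc n) =
      trans (c-cong (fromℕ-+ 1 n)) (trans (c-+ 1# (fromℕ n)) (trans
        (+-cong (*-cong c-1 c-n) (-‿cong (*-cong s-1 s-n)))
        (solve 0 (con 1ℚ :* con 1ℚ :- con 0ℚ :* con 0ℚ := con 1ℚ) refl))) ,
      trans (s-cong (fromℕ-+ 1 n)) (trans (s-+ 1# (fromℕ n)) (trans
        (+-cong (*-cong s-1 c-n) (*-cong c-1 s-n))
        (solve 0 (con 0ℚ :* con 1ℚ :+ con 1ℚ :* con 0ℚ := con 0ℚ) refl)))
      where
      c-n = proj₁ (c,s-fromℕ n)
      s-n = proj₂ (c,s-fromℕ n)

    c-fromℤ : ∀ k → c (fromℤ k) ≈ 1#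
    c-fromℤ (+ n)    = proj₁ (c,s-fromℕ n)
    c-fromℤ -[1+ n ] = trans (c-cong (fromℤ-neg (+ suc n))) (trans (c-neg _) (proj₁ (c,s-fromℕ (suc n))))

    s-fromℤ : ∀ k → s (fromℤ k) ≈ 0#
    s-fromℤ (+ n)    = proj₂ (c,s-fromℕ n)
    s-fromℤ -[1+ n ] = trans (s-cong (fromℤ-neg (+ suc n))) (trans (s-neg _)
      (trans (-‿cong (proj₂ (c,s-fromℕ (suc n)))) (solve 0 (:- con 0ℚ := con 0ℚ) refl)))

    c-periodic : ∀ t k → c (t + fromℤ k) ≈ c t
    c-periodic t k = trans (c-+ t (fromℤ k)) (trans
      (+-cong (*-congˡ (c-fromℤ k)) (-‿cong (*-congˡ (s-fromℤ k))))
      (solve 2 (λ c s → c :* con 1ℚ :- s :* con 0ℚ := c) refl (c t) (s t)))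

    s-periodic : ∀ t k → s (t + fromℤ k) ≈ s t
    s-periodic t k = trans (s-+ t (fromℤ k)) (trans
      (+-cong (*-congˡ (c-fromℤ k)) (*-congˡ (s-fromℤ k)))
      (solve 2 (λ c s → s :* con 1ℚ :+ c :* con 0ℚ := s) refl (c t) (s t)))

    infix 4 ∣_∣≤_
    -- A two-sided bound in place of an absolute value, which is not among the operations of the
    -- algebra.
    ∣_∣≤_ : Carrier → Carrier → Set
    ∣ x ∣≤ y = (- y ≤ x) × (x ≤ y)

    module _ {t : Carrier} (near : ∣ t ∣≤ fromℚ (+ 1 ℚ./ 16)) where
      private
        θ = fromℕ 2 * π * t
        0≤π : 0# ≤ π
        0≤π = ≤-trans (fromℚ-mono (ℚₚ.nonNegative⁻¹ 1ℚ)) 1≤π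
        -- The reason for 1/16: with π ≤ 4 it brings 2πt into [-½ , ½], where the quadratic bounds
        -- for cos hold.
        2π/16≤½ : fromℕ 2 * π * fromℚ (+ 1 ℚ./ 16) ≤ fromℚ ½
        2π/16≤½ = ≤-by (*-nonNeg (fromℚ-mono (ℚₚ.nonNegative⁻¹ (+ 1 ℚ./ 8))) (x≤y⇒0≤y-x π≤4))
          (solve 1 (λ p → con (+ 2 ℚ./ 1) :* p :* con (+ 1 ℚ./ 16) :+ con (+ 1 ℚ./ 8) :* (con (+ 4 ℚ./ 1) :- p) := con ½) refl π)
        0≤2π : 0# ≤ fromℕ 2 * π
        0≤2π = *-nonNeg (fromℕ-nonNeg 2) 0≤π
        θ≤½ : θ ≤ fromℚ ½
        θ≤½ = ≤-trans (*-monoˡ-≤ 0≤2π (proj₂ near)) 2π/16≤½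
        -½≤θ : - fromℚ ½ ≤ θ
        -½≤θ = ≤-trans (neg-mono-≤ 2π/16≤½) (≤-respˡ
          (solve 2 (λ a b → a :* (:- b) := :- (a :* b)) refl (fromℕ 2 * π) (fromℚ (+ 1 ℚ./ 16)))
          (*-monoˡ-≤ 0≤2π (proj₁ near)))

      -- (2πt)² ≤ 64 t² because π ≤ 4.
      1-c≤ : 1# - c t ≤ fromℕ 64 * (t * t)
      1-c≤ = ≤-trans (1-cos≤ -½≤θ θ≤½)
        (≤-by (*-nonNeg (square-nonNeg t) (*-nonNeg (fromℕ-nonNeg 4) (+-nonNeg
            (*-nonNeg (fromℕ-nonNeg 4) (x≤y⇒0≤y-x π≤4)) (*-nonNeg 0≤π (x≤y⇒0≤y-x π≤4)))))
          (solve 2 (λ p t → (con (+ 2 ℚ./ 1) :* p :* t) :* (con (+ 2 ℚ./ 1) :* p :* t)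
              :+ (t :* t) :* (con (+ 4 ℚ./ 1) :* (con (+ 4 ℚ./ 1) :* (con (+ 4 ℚ./ 1) :- p) :+ p :* (con (+ 4 ℚ./ 1) :- p)))
              := con (+ 64 ℚ./ 1) :* (t :* t)) refl π t))

      -- (2πt)² / 6 ≥ 2t² / 3 because 1 ≤ π. This lower bound is what later keeps e(t) away from 1.
      ≤1-c : fromℚ ½ * (t * t) ≤ 1# - c t
      ≤1-c = ≤-trans
        (≤-by (*-nonNeg (square-nonNeg t) (*-nonNeg (fromℚ-mono (ℚₚ.nonNegative⁻¹ (+ 2 ℚ./ 3)))
            (+-nonNeg (+-nonNeg (x≤y⇒0≤y-x 1≤π) (*-nonNeg 0≤π (x≤y⇒0≤y-x 1≤π))) (fromℚ-mono (ℚₚ.nonNegative⁻¹ (+ 1 ℚ./ 4))))))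
          (solve 2 (λ p t → con ½ :* (t :* t) :+ (t :* t) :* (con (+ 2 ℚ./ 3) :* (((p :- con 1ℚ) :+ p :* (p :- con 1ℚ)) :+ con (+ 1 ℚ./ 4)))
              := (con (+ 2 ℚ./ 1) :* p :* t) :* (con (+ 2 ℚ./ 1) :* p :* t) :* con (+ 1 ℚ./ 6)) refl π t))
        (≤1-cos -½≤θ θ≤½)

      -- 64 · (1/16)² = 1/4.
      3/4≤c : fromℚ (+ 3 ℚ./ 4) ≤ c t
      3/4≤c = ≤-by (+-nonNeg (x≤y⇒0≤y-x 1-c≤) (*-nonNeg (fromℕ-nonNeg 64)
          (*-nonNeg (x≤y⇒0≤y-x (proj₂ near)) (x≤y⇒0≤y-x (proj₁ near)))))
        (solve 2 (λ c t → con (+ 3 ℚ./ 4) :+ ((con (+ 64 ℚ./ 1) :* (t :* t) :- (con 1ℚ :- c))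
            :+ con (+ 64 ℚ./ 1) :* ((con (+ 1 ℚ./ 16) :- t) :* (t :- (:- con (+ 1 ℚ./ 16))))) := c) refl (c t) t)

    -- |e(t) - e(u)|² = 2 (1 - cos 2π(t - u)), so `1-c≤` applies to t - u.
    chord : ∀ t u → ∣ t - u ∣≤ fromℚ (+ 1 ℚ./ 16) →
      (c t - c u) * (c t - c u) + (s t - s u) * (s t - s u) ≤ fromℕ 128 * ((t - u) * (t - u))
    chord t u near = ≤-respˡ expand (≤-respʳ
      (solve 1 (λ d → con (+ 2 ℚ./ 1) :* (con (+ 64 ℚ./ 1) :* d) := con (+ 128 ℚ./ 1) :* d) refl ((t - u) * (t - u)))
      (*-monoˡ-≤ (fromℕ-nonNeg 2) (1-c≤ near)))
      where
      expand : fromℕ 2 * (1# - c (t - u)) ≈ (c t - c u) * (c t - c u) + (s t - s u) * (s t - s u)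
      expand = trans (*-congˡ (+-congˡ (-‿cong (c-sub t u)))) (trans
        (solve 1 (λ p → con (+ 2 ℚ./ 1) :* (con 1ℚ :- p) := con 1ℚ :+ con 1ℚ :- con (+ 2 ℚ./ 1) :* p) refl (c t * c u + s t * s u))
        (trans (+-congʳ (+-cong (sym (c²+s²≈1 t)) (sym (c²+s²≈1 u))))
          (solve 4 (λ a b x y → ((a :* a :+ x :* x) :+ (b :* b :+ y :* y)) :- con (+ 2 ℚ./ 1) :* (a :* b :+ x :* y)
            := (a :- b) :* (a :- b) :+ (x :- y) :* (x :- y)) refl (c t) (c u) (s t) (s u))))

-- Bessel's inequality and the orthogonality of characters of ℤ/M.

module Bessel where

  open Ordered
  open Circle

  module Inequality (𝔸 : OrderedAlgebra) where

    open OrderedAlgebraProperties 𝔸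
    open Solver using (solve; _:+_; _:*_; _:-_; :-_; _:=_; con)

    sumᴸ : {A : Set} → List A → (A → Carrier) → Carrier
    sumᴸ xs f = foldr _+_ 0# (map f xs)

    sumᴸ-mono : {A : Set} {f g : A → Carrier} (xs : List A) → All (λ x → f x ≤ g x) xs → sumᴸ xs f ≤ sumᴸ xs g
    sumᴸ-mono []       []       = ≤-refl
    sumᴸ-mono (x ∷ xs) (p ∷ ps) = +-mono-≤ p (sumᴸ-mono xs ps)

    sum-linear : ∀ {n} x y z (f g h k : Vector Carrier n) →
      sum (λ i → f i + x * g i + y * h i + z * k i) ≈ sum f + x * sum g + y * sum h + z * sum k
    sum-linear {zero} x y z f g h k =
      solve 3 (λ x y z → con 0ℚ := con 0ℚ :+ x :* con 0ℚ :+ y :* con 0ℚ :+ z :* con 0ℚ) refl x y z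
    sum-linear {suc n} x y z f g h k = trans
      (+-congˡ (sum-linear x y z (λ i → f (suc i)) (λ i → g (suc i)) (λ i → h (suc i)) (λ i → k (suc i))))
      (solve 11 (λ x y z a b c d A B C D →
        (a :+ x :* b :+ y :* c :+ z :* d) :+ (A :+ x :* B :+ y :* C :+ z :* D)
          := (a :+ A) :+ x :* (b :+ B) :+ y :* (c :+ C) :+ z :* (d :+ D)) refl
        x y z (f zero) (g zero) (h zero) (k zero) _ _ _ _)

    module _ {M : ℕ} where

      record Wave : Set where
        field
          c s  : Vector Carrier M
          unit : ∀ j → c j * c j + s j * s j ≈ 1#
      open Wave

      -- The inner product of a + ib with the wave c + is is re a b + i im a b.
      re im energy : Vector Carrier M → Vector Carrier M → Wave → Carrier
      re a b w = sum (λ j → a j * c w j + b j * s w j)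
      im a b w = sum (λ j → b j * c w j - a j * s w j)
      energy a b w = re a b w * re a b w + im a b w * im a b w

      Orthogonal : Wave → Wave → Set
      Orthogonal v w = (re (c v) (s v) w ≈ 0#) × (im (c v) (s v) w ≈ 0#)

      norm² : Vector Carrier M → Vector Carrier M → Carrier
      norm² a b = sum (λ j → a j * a j + b j * b j)

      norm²-nonNeg : ∀ a b → 0# ≤ norm² a b
      norm²-nonNeg a b = sum-nonNeg λ j → +-nonNeg (square-nonNeg (a j)) (square-nonNeg (b j))

      -- One Gram-Schmidt step: `a′` + i `b′` is f - ⟨f , w⟩ w / M, because a wave has squared norm
      -- M.
      module Residual (μ : Carrier) (inverse : fromℕ M * μ ≈ 1#) (a b : Vector Carrier M) (w : Wave) where

        p q : Carrier
        p = re a b w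
        q = im a b w

        a′ b′ : Vector Carrier M
        a′ j = a j - μ * (p * c w j - q * s w j)
        b′ j = b j - μ * (p * s w j + q * c w j)

        private
          unorthogonal : ∀ x y {A B C} → B ≈ 0# → C ≈ 0# → A + x * B + y * C + 0# * 0# ≈ A
          unorthogonal x y {A} B≈0 C≈0 = trans (+-congʳ (+-cong (+-congˡ (*-congˡ B≈0)) (*-congˡ C≈0)))
            (solve 3 (λ A x y → A :+ x :* con 0ℚ :+ y :* con 0ℚ :+ con 0ℚ :* con 0ℚ := A) refl A x y)

        re-residual : ∀ v → Orthogonal w v → re a′ b′ v ≈ re a b v
        re-residual v (o , o′) = trans
          (trans (sum-cong-≋ {M} λ j → solve 9 (λ a b c s c′ s′ m p q →
              (a :- m :* (p :* c :- q :* s)) :* c′ :+ (b :- m :* (p :* s :+ q :* c)) :* s′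
                := (a :* c′ :+ b :* s′) :+ (:- (m :* p)) :* (c :* c′ :+ s :* s′) :+ (m :* q) :* (s :* c′ :- c :* s′) :+ con 0ℚ :* con 0ℚ)
              refl (a j) (b j) (c w j) (s w j) (c v j) (s v j) μ p q)
            (sum-linear {M} (- (μ * p)) (μ * q) 0# _ _ _ (λ _ → 0#)))
          (trans (+-congˡ (*-congˡ (sum-replicate-zero M))) (unorthogonal (- (μ * p)) (μ * q) o o′))

        im-residual : ∀ v → Orthogonal w v → im a′ b′ v ≈ im a b v
        im-residual v (o , o′) = trans
          (trans (sum-cong-≋ {M} λ j → solve 9 (λ a b c s c′ s′ m p q →
              (b :- m :* (p :* s :+ q :* c)) :* c′ :- (a :- m :* (p :* c :- q :* s)) :* s′
                := (b :* c′ :- a :* s′) :+ (:- (m :* q)) :* (c :* c′ :+ s :* s′) :+ (:- (m :* p)) :* (s :* c′ :- c :* s′) :+ con 0ℚ :* con 0ℚ)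
              refl (a j) (b j) (c w j) (s w j) (c v j) (s v j) μ p q)
            (sum-linear {M} (- (μ * q)) (- (μ * p)) 0# _ _ _ (λ _ → 0#)))
          (trans (+-congˡ (*-congˡ (sum-replicate-zero M))) (unorthogonal (- (μ * q)) (- (μ * p)) o o′))

        energy-residual : ∀ v → Orthogonal w v → energy a b v ≤ energy a′ b′ v
        energy-residual v o = ≤-reflexive (sym (+-cong (*-cong (re-residual v o) (re-residual v o)) (*-cong (im-residual v o) (im-residual v o))))

        -- Pythagoras, multiplied by M. Expanding leaves the extra term (1 - Mμ)² |⟨f , w⟩|², which
        -- vanishes because Mμ = 1.
        norm²-residual : energy a b w + fromℕ M * norm² a′ b′ ≈ fromℕ M * norm² a b
        norm²-residual = trans (+-congˡ (*-congˡ expand)) (trans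
          (solve 5 (λ S p q m M → (p :* p :+ q :* q) :+
              M :* (S :+ (:- (con 2ℚ :* m :* p)) :* p :+ (:- (con 2ℚ :* m :* q)) :* q :+ (m :* m :* (p :* p :+ q :* q)) :* M)
              := M :* S :+ (p :* p :+ q :* q) :* ((con 1ℚ :- M :* m) :* (con 1ℚ :- M :* m))) refl (norm² a b) p q μ (fromℕ M))
          (trans (+-congˡ (*-congˡ (*-cong (+-congˡ (-‿cong inverse)) (+-congˡ (-‿cong inverse)))))
            (solve 2 (λ X Y → X :+ Y :* ((con 1ℚ :- con 1ℚ) :* (con 1ℚ :- con 1ℚ)) := X) refl (fromℕ M * norm² a b) (p * p + q * q))))
          where
          2ℚ = + 2 ℚ./ 1
          expand : norm² a′ b′ ≈ norm² a b + (- (fromℚ 2ℚ * μ * p)) * p + (- (fromℚ 2ℚ * μ * q)) * q + (μ * μ * (p * p + q * q)) * fromℕ M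
          expand = trans
            (trans (sum-cong-≋ {M} λ j → solve 7 (λ a b c s m p q →
                (a :- m :* (p :* c :- q :* s)) :* (a :- m :* (p :* c :- q :* s)) :+ (b :- m :* (p :* s :+ q :* c)) :* (b :- m :* (p :* s :+ q :* c))
                := (a :* a :+ b :* b) :+ (:- (con 2ℚ :* m :* p)) :* (a :* c :+ b :* s) :+ (:- (con 2ℚ :* m :* q)) :* (b :* c :- a :* s)
                   :+ (m :* m :* (p :* p :+ q :* q)) :* (c :* c :+ s :* s)) refl (a j) (b j) (c w j) (s w j) μ p q)
              (sum-linear {M} (- (fromℚ 2ℚ * μ * p)) (- (fromℚ 2ℚ * μ * q)) (μ * μ * (p * p + q * q)) _ _ _ _))
            (+-congˡ (*-congˡ (trans (sum-cong-≋ {M} (unit w)) (trans (sum-const M 1#) (*-identityʳ _)))))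

      -- Induction on the list: passing to the residual of the first wave accounts for exactly its
      -- energy and leaves the inner products with the later, orthogonal waves unchanged.
      bessel : ∀ μ → fromℕ M * μ ≈ 1# → {K : Set} (wave : K → Wave) (ks : List K) →
        AllPairs (λ k l → Orthogonal (wave k) (wave l)) ks →
        ∀ a b → sumᴸ ks (λ k → energy a b (wave k)) ≤ fromℕ M * norm² a b
      bessel μ inverse wave []       []       a b = *-nonNeg (fromℕ-nonNeg M) (norm²-nonNeg a b)
      bessel μ inverse wave (k ∷ ks) (o ∷ os) a b = ≤-respʳ norm²-residual
        (+-mono-≤ ≤-refl (≤-trans (sumᴸ-mono ks (residuals o)) (bessel μ inverse wave ks os a′ b′)))
        where
        open Residual μ inverse a b (wave k)
        residuals : ∀ {ls} → All (λ l → Orthogonal (wave k) (wave l)) ls →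
          All (λ l → energy a b (wave l) ≤ energy a′ b′ (wave l)) ls
        residuals []       = []
        residuals {l ∷ _} (o ∷ os) = energy-residual (wave l) o ∷ residuals os

    -- Both sides are f 0 + ... + f n.
    sum-shift : ∀ n (f : ℕ → Carrier) → sum {n} (λ j → f (suc (toℕ j))) + f 0 ≈ sum {n} (λ j → f (toℕ j)) + f n
    sum-shift zero    f = refl
    sum-shift (suc n) f = trans
      (solve 3 (λ a b c → (b :+ a) :+ c := c :+ (a :+ b)) refl (sum {n} (λ j → f (suc (suc (toℕ j))))) (f 1) (f 0))
      (trans (+-congˡ (sum-shift n (λ i → f (suc i))))
        (solve 3 (λ a b c → a :+ (b :+ c) := (a :+ b) :+ c) refl (f 0) (sum {n} (λ j → f (suc (toℕ j)))) (f (suc n))))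

  module Grid (𝔸 : OrderedAlgebra) (𝕋 : Trigonometry 𝔸) where

    open OrderedAlgebraProperties 𝔸
    open TrigonometryProperties 𝔸 𝕋
    open Inequality 𝔸
    open Solver using (solve; _:+_; _:*_; _:-_; :-_; _:=_; con)

    -- Over a full number of turns, multiplying Σ e^{2πijt} by e^{2πit} permutes the terms.
    geometric-sum : ∀ M t k → fromℕ M * t ≈ fromℤ k → ∣ t ∣≤ fromℚ (+ 1 ℚ./ 16) →
      ∀ ε → 0ℚ ℚ.< ε → fromℚ ε ≤ t * t →
      (sum {M} (λ j → c (fromℕ (toℕ j) * t)) ≈ 0#) × (sum {M} (λ j → s (fromℕ (toℕ j) * t)) ≈ 0#)
    -- A + iB is fixed by multiplication by e(t). The vanishing of B is the same statement for -i (A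
    -- + iB) = B - iA.
    geometric-sum M t k Mt≈k near ε 0<ε ε≤t² = vanish A B A≈ B≈ , vanish B (- A) B≈′ A≈′
      where
      C S : ℕ → Carrier
      C j = c (fromℕ j * t)
      S j = s (fromℕ j * t)
      A = sum {M} (λ j → C (toℕ j))
      B = sum {M} (λ j → S (toℕ j))

      step : ∀ j → fromℕ (suc j) * t ≈ fromℕ j * t + t
      step j = trans (*-congʳ (fromℕ-+ 1 j)) (solve 2 (λ j t → (con 1ℚ :+ j) :* t := j :* t :+ t) refl (fromℕ j) t)

      C-last : C M ≈ C 0
      C-last = trans (c-cong (trans Mt≈k (trans (sym (+-identityˡ (fromℤ k))) (+-congʳ (sym (zeroˡ t)))))) (c-periodic _ k)
      S-last : S M ≈ S 0
      S-last = trans (s-cong (trans Mt≈k (trans (sym (+-identityˡ (fromℤ k))) (+-congʳ (sym (zeroˡ t)))))) (s-periodic _ k)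

      shifted : ∀ f → f M ≈ f 0 → sum {M} (λ j → f (suc (toℕ j))) ≈ sum {M} (λ j → f (toℕ j))
      shifted f e = trans (solve 2 (λ a b → a := (a :+ b) :- b) refl _ (f 0))
        (trans (+-congʳ (sum-shift M f)) (trans (+-congʳ (+-congˡ e)) (solve 2 (λ a b → (a :+ b) :- b := a) refl _ (f 0))))

      sum-combine : ∀ x y (f g : Vector Carrier M) → sum (λ j → x * f j + y * g j) ≈ x * sum f + y * sum g
      sum-combine x y f g = trans (∑-distrib-+ (λ j → x * f j) (λ j → y * g j)) (sym (+-cong (*-distribˡ-sum x f) (*-distribˡ-sum y g)))

      A≈ : A ≈ c t * A + (- s t) * B
      A≈ = trans (sym (shifted C C-last)) (trans
        (sum-cong-≋ {M} λ j → trans (c-cong (step (toℕ j))) (trans (c-+ _ t)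
          (solve 4 (λ a b x y → a :* b :- x :* y := b :* a :+ (:- y) :* x) refl (C (toℕ j)) (c t) (S (toℕ j)) (s t))))
        (sum-combine (c t) (- s t) _ _))

      B≈ : B ≈ s t * A + c t * B
      B≈ = trans (sym (shifted S S-last)) (trans
        (sum-cong-≋ {M} λ j → trans (s-cong (step (toℕ j))) (trans (s-+ _ t)
          (solve 4 (λ a b x y → x :* b :+ a :* y := y :* a :+ b :* x) refl (C (toℕ j)) (c t) (S (toℕ j)) (s t))))
        (sum-combine (s t) (c t) _ _))

      B≈′ : B ≈ c t * B + (- s t) * (- A)
      B≈′ = trans B≈ (solve 4 (λ a b x y → y :* a :+ x :* b := x :* b :+ (:- y) :* (:- a)) refl A B (c t) (s t))

      A≈′ : - A ≈ s t * B + c t * (- A)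
      A≈′ = trans (-‿cong A≈) (solve 4 (λ a b x y → :- (x :* a :+ (:- y) :* b) := y :* b :+ x :* (:- a)) refl A B (c t) (s t))

      -- If X + iY = e(t) (X + iY), multiplying by the conjugate of 1 - e(t) gives |1 - e(t)|² X = 2
      -- (1 - c t) X = 0, and 2 (1 - c t) ≥ t² ≥ ε > 0.
      vanish : ∀ X Y → X ≈ c t * X + (- s t) * Y → Y ≈ s t * X + c t * Y → X ≈ 0#
      vanish X Y X≈ Y≈ = *≈0⇒≈0 0<ε (≤-trans ε≤t² (≤-trans (≤-reflexive double) (*-monoˡ-≤ (fromℕ-nonNeg 2) (≤1-c near)))) eq
        where
        double : t * t ≈ fromℕ 2 * (fromℚ ½ * (t * t))
        double = solve 1 (λ x → x := con (+ 2 ℚ./ 1) :* (con ½ :* x)) refl (t * t)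
        eq : (fromℕ 2 * (1# - c t)) * X ≈ 0#
        eq = trans (solve 2 (λ X a → (con (+ 2 ℚ./ 1) :* (con 1ℚ :- a)) :* X := ((con 1ℚ :+ con 1ℚ) :- con (+ 2 ℚ./ 1) :* a) :* X) refl X (c t))
          (trans (*-congʳ (+-congʳ (+-congˡ (sym (c²+s²≈1 t)))))
            (trans (solve 4 (λ X Y a b → ((con 1ℚ :+ (a :* a :+ b :* b)) :- con (+ 2 ℚ./ 1) :* a) :* X
                := (con 1ℚ :- a) :* (X :- (a :* X :+ (:- b) :* Y)) :+ (:- b) :* (Y :- (b :* X :+ a :* Y))) refl X Y (c t) (s t))
              (trans (+-cong (*-congˡ (trans (+-congˡ (-‿cong (sym X≈))) (-‿inverseʳ X))) (*-congˡ (trans (+-congˡ (-‿cong (sym Y≈))) (-‿inverseʳ Y))))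
                (solve 2 (λ a b → a :* con 0ℚ :+ b :* con 0ℚ := con 0ℚ) refl (1# - c t) (- s t)))))

    module _ {M : ℕ} (μ : Carrier) (inverse : fromℕ M * μ ≈ 1#) where

      frequency : ℤ → Wave {M}
      frequency k = record
        { c = λ j → c (fromℤ k * (fromℕ (toℕ j) * μ)) ; s = λ j → s (fromℤ k * (fromℕ (toℕ j) * μ)) ; unit = λ j → c²+s²≈1 _ }

      -- Frequency k times the conjugate of frequency l is the geometric progression with t = (k -
      -- l) / M, and M t is an integer. The bound by ε certifies t ≠ 0.
      frequency-orthogonal : ∀ k l → ∣ fromℤ (k ℤ.- l) * μ ∣≤ fromℚ (+ 1 ℚ./ 16) →
        ∀ ε → 0ℚ ℚ.< ε → fromℚ ε ≤ (fromℤ (k ℤ.- l) * μ) * (fromℤ (k ℤ.- l) * μ) →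
        Orthogonal (frequency k) (frequency l)
      frequency-orthogonal k l near ε 0<ε ε≤ =
        trans (sum-cong-≋ {M} λ j → trans (sym (c-sub _ _)) (c-cong (difference (toℕ j)))) (proj₁ G) ,
        trans (sum-cong-≋ {M} λ j → trans (sym (s-sub _ _)) (s-cong (difference (toℕ j)))) (proj₂ G)
        where
        t = fromℤ (k ℤ.- l) * μ
        G = geometric-sum M t (k ℤ.- l)
          (trans (solve 3 (λ M k m → M :* (k :* m) := (M :* m) :* k) refl (fromℕ M) (fromℤ (k ℤ.- l)) μ)
            (trans (*-congʳ inverse) (*-identityˡ _))) near ε 0<ε ε≤
        difference : ∀ j → fromℤ k * (fromℕ j * μ) - fromℤ l * (fromℕ j * μ) ≈ fromℕ j * t
        difference j = trans (solve 4 (λ k l j m → k :* (j :* m) :- l :* (j :* m) := j :* ((k :- l) :* m)) refl (fromℤ k) (fromℤ l) (fromℕ j) μ)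
          (*-congˡ (*-congʳ (trans (+-congˡ (sym (fromℤ-neg l))) (sym (fromℤ-+ k (ℤ.- l))))))

-- Counting coincidences modulo M.

module Counting where

  open import Algebra.Properties.Semiring.Sum ℕₚ.+-*-semiring using (∑-distrib-+; ∑-comm) renaming (sum-cong-≗ to ∑-cong)
  open import Algebra.Properties.Semiring.Sum ℕₚ.+-*-semiring public using () renaming (sum to ∑)
  open import Data.Nat using (_+_; _*_; _≤_; _<_)
  open import Data.Integer using (_⊖_; ∣_∣; _/ℕ_)
  open ≡ using (refl; sym; trans; cong; cong₂; subst; subst₂)

  ∑-mono : ∀ {n} {f g : Vector ℕ n} → (∀ i → f i ≤ g i) → ∑ f ≤ ∑ g
  ∑-mono {zero}  h = z≤n
  ∑-mono {suc n} h = ℕₚ.+-mono-≤ (h zero) (∑-mono (h ∘ suc))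

  ∑-const : ∀ n x → ∑ {n} (λ _ → x) ≡ n * x
  ∑-const zero    x = refl
  ∑-const (suc n) x = cong (_+_ x) (∑-const n x)

  [_] : ∀ {P : Set} → Dec P → ℕ
  [ d ] = if does d then 1 else 0

  -- Says that v is at most the indicator of `P` without deciding `P`; the witness is kept so that
  -- it can be carried over to another predicate.
  AtMostOne : Set → ℕ → Set
  AtMostOne P v = (v ≡ 0) ⊎ ((v ≡ 1) × P)

  []-atMostOne : ∀ {P : Set} (d : Dec P) → AtMostOne P [ d ]
  []-atMostOne (yes p) = inj₂ (refl , p)
  []-atMostOne (no _)  = inj₁ refl

  atMostOne⇒≤1 : ∀ {P v} → AtMostOne P v → v ≤ 1
  atMostOne⇒≤1 (inj₁ refl)       = z≤n
  atMostOne⇒≤1 (inj₂ (refl , _)) = ℕₚ.≤-refl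

  atMostOne-map : ∀ {P Q v} → (P → Q) → AtMostOne P v → AtMostOne Q v
  atMostOne-map f (inj₁ e)       = inj₁ e
  atMostOne-map f (inj₂ (e , p)) = inj₂ (e , f p)

  []-mono : ∀ {P Q : Set} (p : Dec P) (q : Dec Q) → (P → Q) → [ p ] ≤ [ q ]
  []-mono (no _)  q       f = z≤n
  []-mono (yes p) (yes _) f = ℕₚ.≤-refl
  []-mono (yes p) (no ¬q) f = contradiction (f p) ¬q

  -- The events exclude each other, so at most one summand is nonzero.
  atMostOne-∑ : ∀ {n} {P : Fin n → Set} {f : Vector ℕ n} → (∀ i → AtMostOne (P i) (f i)) →
    (∀ {i j} → P i → P j → i ≡ j) → AtMostOne (∃[ i ] P i) (∑ f)
  atMostOne-∑ {zero}  h unique = inj₁ refl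
  atMostOne-∑ {suc n} h unique with h zero | atMostOne-∑ (h ∘ suc) (λ p q → Finₚ.suc-injective (unique p q))
  ... | inj₁ e       | inj₁ e′           = inj₁ (cong₂ _+_ e e′)
  ... | inj₁ e       | inj₂ (e′ , i , p) = inj₂ (cong₂ _+_ e e′ , suc i , p)
  ... | inj₂ (e , p) | inj₁ e′           = inj₂ (cong₂ _+_ e e′ , zero , p)
  ... | inj₂ (_ , p) | inj₂ (_ , _ , q)  = contradiction (unique p q) λ ()

  atMostOne-+ : ∀ {P Q : Set} {u v} → AtMostOne P u → AtMostOne Q v → ¬ (P × Q) → AtMostOne (P ⊎ Q) (u + v)
  atMostOne-+ (inj₁ refl)       (inj₁ refl)       _ = inj₁ refl
  atMostOne-+ (inj₁ refl)       (inj₂ (refl , q)) _ = inj₂ (refl , inj₂ q)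
  atMostOne-+ (inj₂ (refl , p)) (inj₁ refl)       _ = inj₂ (refl , inj₁ p)
  atMostOne-+ (inj₂ (_ , p))    (inj₂ (_ , q))    k = contradiction (p , q) k

  module Modulus (M : ℕ) .{{_ : NonZero M}} where

    -- v - w is a multiple of M of absolute value below M.
    close-multiples : ∀ d {v w} → + M ∣ d ℤ.+ v → + M ∣ d ℤ.+ w → ∣ v ∣ + ∣ w ∣ < M → v ≡ w
    close-multiples d {v} {w} p q small = ℤₚ.i-j≡0⇒i≡j v w (ℤₚ.∣i∣≡0⇒i≡0 (zero-multiple _
      (ℕₚ.≤-<-trans (ℤₚ.∣i-j∣≤∣i∣+∣j∣ v w) small)
      (subst (λ z → M ℕᵈ.∣ ∣ z ∣) (solve 3 (λ d v w → (d :+ v) :- (d :+ w) := v :- w) refl d v w) (∣⇒∣ᵤ (∣m∣n⇒∣m-n p q)))))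
      where
      open ℤ-Solver.+-*-Solver
      zero-multiple : ∀ n → n < M → M ℕᵈ.∣ n → n ≡ 0
      zero-multiple zero    _   _   = refl
      zero-multiple (suc n) n<M M∣n = contradiction M∣n (ℕᵈ.>⇒∤ n<M)

    divisible : ℤ → ℕ
    divisible z = [ + M ∣? z ]

    -- A difference w = r - r′ occurs R - |w| times, so this is the Fejér weight of length R, summed
    -- over the w with M | d + w.
    square : ℕ → ℤ → ℕ
    square R d = ∑ {R} λ r → ∑ {R} λ r′ → divisible (d ℤ.+ (toℕ r ⊖ toℕ r′))

    -- The unweighted count over |w| ≤ t. Zero belongs to the first sum, hence `suc t`; the second
    -- starts at -1.
    window : ℕ → ℤ → ℕ
    window t d = ∑ {suc t} (λ u → divisible (d ℤ.+ + toℕ u)) + ∑ {t} (λ u → divisible (d ℤ.+ -[1+ toℕ u ]))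

    -- The border of [0 , R]² contributes each of the differences -R , … , R once.
    square-suc : ∀ R d → square (suc R) d ≡ window R d + square R d
    square-suc R d = trans
      (cong (_+_ (x + negative)) (trans
        (∑-cong {R} (λ r → cong (_+_ (divisible (d ℤ.+ + suc (toℕ r))))
          (∑-cong {R} λ r′ → cong (λ z → divisible (d ℤ.+ z)) (ℤₚ.[1+m]⊖[1+n]≡m⊖n (toℕ r) (toℕ r′)))))
        (∑-distrib-+ {R} (λ r → divisible (d ℤ.+ + suc (toℕ r))) _)))
      (solve 4 (λ x n p s → (x :+ n) :+ (p :+ s) := ((x :+ p) :+ n) :+ s) refl x negative positive (square R d))
      where
      open ℕ-Solver.+-*-Solver
      x = divisible (d ℤ.+ + 0)
      positive = ∑ {R} λ r → divisible (d ℤ.+ + suc (toℕ r))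
      negative = ∑ {R} λ r → divisible (d ℤ.+ -[1+ toℕ r ])

    -- Two solutions w would differ by a multiple of M of size at most 2t < M.
    window-atMostOne : ∀ t d → t + t < M → AtMostOne (∃[ w ] (∣ w ∣ ≤ t) × (+ M ∣ d ℤ.+ w)) (window t d)
    window-atMostOne t d 2t<M = atMostOne-map witness (atMostOne-+
      (atMostOne-∑ {suc t} (λ u → []-atMostOne (+ M ∣? (d ℤ.+ + toℕ u)))
        (λ {u} {v} p q → Finₚ.toℕ-injective (ℤₚ.+-injective (close-multiples d p q (small (toℕ u) (toℕ v) (Finₚ.toℕ≤pred[n] u) (Finₚ.toℕ≤pred[n] v))))))
      (atMostOne-∑ {t} (λ u → []-atMostOne (+ M ∣? (d ℤ.+ -[1+ toℕ u ])))
        (λ {u} {v} p q → Finₚ.toℕ-injective (ℤₚ.-[1+-injective (close-multiples d p q (small (suc (toℕ u)) (suc (toℕ v)) (Finₚ.toℕ<n u) (Finₚ.toℕ<n v))))))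
      λ ((u , p) , (v , q)) → contradiction (close-multiples d p q (small (toℕ u) (suc (toℕ v)) (Finₚ.toℕ≤pred[n] u) (Finₚ.toℕ<n v))) λ ())
      where
      small : ∀ a b → a ≤ t → b ≤ t → a + b < M
      small a b a≤t b≤t = ℕₚ.≤-<-trans (ℕₚ.+-mono-≤ a≤t b≤t) 2t<M
      witness : (∃[ u ] (+ M ∣ d ℤ.+ + toℕ {suc t} u)) ⊎ (∃[ u ] (+ M ∣ d ℤ.+ -[1+ toℕ {t} u ])) → ∃[ w ] (∣ w ∣ ≤ t) × (+ M ∣ d ℤ.+ w)
      witness (inj₁ (u , p)) = + toℕ u , Finₚ.toℕ≤pred[n] u , p
      witness (inj₂ (u , p)) = -[1+ toℕ u ] , Finₚ.toℕ<n u , p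

    -- `square R` is the sum of the windows t < R, and 2t < 2R ≤ M makes each of them at most 1.
    -- This serves the diagonal terms, where the hypothesis says nothing.
    square≤ : ∀ R d → R + R ≤ M → square R d ≤ R
    square≤ zero    d _    = z≤n
    square≤ (suc R) d 2R≤M = subst (_≤ suc R) (sym (square-suc R d))
      (ℕₚ.+-mono-≤ (atMostOne⇒≤1 (window-atMostOne R d R+R<M)) (square≤ R d (ℕₚ.<⇒≤ R+R<M)))
      where
      R+R<M : R + R < M
      R+R<M = ℕₚ.≤-trans (s≤s (ℕₚ.+-monoʳ-≤ R (ℕₚ.n≤1+n R))) 2R≤M

    residue : ℤ → Fin M
    residue z = fromℕ< (ℤᵈ.n%ℕd<d z M)

    residue-decomposition : ∀ z → z ≡ + toℕ (residue z) ℤ.+ (z /ℕ M) ℤ.* + M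
    residue-decomposition z = trans (ℤᵈ.a≡a%ℕn+[a/ℕn]*n z M)
      (cong (λ r → + r ℤ.+ (z /ℕ M) ℤ.* + M) (sym (Finₚ.toℕ-fromℕ< (ℤᵈ.n%ℕd<d z M))))

    residue-≡ : ∀ y z → residue y ≡ residue z → + M ∣ z ℤ.- y
    residue-≡ y z e = divides ((z /ℕ M) ℤ.- (y /ℕ M)) (trans
      (cong₂ ℤ._-_ (trans (residue-decomposition z) (cong (λ r → + toℕ r ℤ.+ (z /ℕ M) ℤ.* + M) (sym e))) (residue-decomposition y))
      (solve 4 (λ r a b m → (r :+ a :* m) :- (r :+ b :* m) := (a :- b) :* m) refl (+ toℕ (residue y)) (z /ℕ M) (y /ℕ M) (+ M)))
      where open ℤ-Solver.+-*-Solver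

  offDiagonal : ∀ {N} → Fin N → Fin N → ℕ → ℕ
  offDiagonal i j v = if does (i Fin.≟ j) then 0 else v

  offDiagonal-+ : ∀ {N} (i j : Fin N) u v → offDiagonal i j (u + v) ≡ offDiagonal i j u + offDiagonal i j v
  offDiagonal-+ i j u v with i Fin.≟ j
  ... | yes _ = refl
  ... | no  _ = refl

  ∑-offDiagonal : ∀ {N R} i (f : Vector ℕ N) → f i ≤ R → ∑ f ≤ R + ∑ (λ j → offDiagonal i j (f j))
  ∑-offDiagonal {suc N} zero    f f≤R = ℕₚ.+-monoˡ-≤ (∑ (f ∘ suc)) f≤R
  ∑-offDiagonal {suc N} {R} (suc i) f f≤R = ℕₚ.≤-trans (ℕₚ.+-monoʳ-≤ (f zero) (∑-offDiagonal i (f ∘ suc) f≤R))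
    (ℕₚ.≤-reflexive (solve 3 (λ a r s → a :+ (r :+ s) := r :+ (a :+ s)) refl (f zero) R (∑ λ j → offDiagonal i j (f (suc j)))))
    where open ℕ-Solver.+-*-Solver

  offDiagonal-atMostOne : ∀ {N} {P : Set} (i j : Fin N) {v} → AtMostOne P v → AtMostOne (¬ (i ≡ j) × P) (offDiagonal i j v)
  offDiagonal-atMostOne i j h with i Fin.≟ j
  ... | yes _  = inj₁ refl
  ... | no i≢j = atMostOne-map (i≢j ,_) h

  pairs : ∀ N → List (Fin N × Fin N)
  pairs N = cartesianProduct (allFin N) (allFin N)

  sum-allFin : ∀ {n} (f : Vector ℕ n) → sumˡ (List.map f (allFin n)) ≡ ∑ f
  sum-allFin {n} f = trans (cong sumˡ (Listₚ.map-tabulate {n = n} (λ i → i) f)) (sum-tabulate f)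
    where
    sum-tabulate : ∀ {n} (f : Vector ℕ n) → sumˡ (tabulate f) ≡ ∑ f
    sum-tabulate {zero}  f = refl
    sum-tabulate {suc n} f = cong (_+_ (f zero)) (sum-tabulate (f ∘ suc))

  sum-cartesianProduct : {A B : Set} (g : A × B → ℕ) (xs : List A) (ys : List B) →
    sumˡ (List.map g (cartesianProduct xs ys)) ≡ sumˡ (List.map (λ x → sumˡ (List.map (λ y → g (x , y)) ys)) xs)
  sum-cartesianProduct g []       ys = refl
  sum-cartesianProduct g (x ∷ xs) ys = trans (cong sumˡ (Listₚ.map-++ g (List.map (x ,_) ys) (cartesianProduct xs ys)))
    (trans (sum-++ (List.map g (List.map (x ,_) ys)) (List.map g (cartesianProduct xs ys)))
      (cong₂ _+_ (cong sumˡ (sym (Listₚ.map-∘ ys))) (sum-cartesianProduct g xs ys)))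

  ∑∑≡sum-pairs : ∀ {N} (g : Fin N × Fin N → ℕ) → ∑ (λ i → ∑ (λ j → g (i , j))) ≡ sumˡ (List.map g (pairs N))
  ∑∑≡sum-pairs {N} g = sym (trans (sum-cartesianProduct g (allFin N) (allFin N))
    (trans (sum-allFin λ i → sumˡ (List.map (λ j → g (i , j)) (allFin N))) (∑-cong λ i → sum-allFin λ j → g (i , j))))

  sum≤length-filter : {A : Set} {P : A → Set} (P? : Decidable P) (g : A → ℕ) → (∀ x → AtMostOne (P x) (g x)) →
    ∀ xs → sumˡ (List.map g xs) ≤ length (filter P? xs)
  sum≤length-filter P? g h []       = z≤n
  sum≤length-filter P? g h (x ∷ xs) with P? x | h x
  ... | yes _ | h′            = ℕₚ.+-mono-≤ (atMostOne⇒≤1 h′) (sum≤length-filter P? g h xs)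
  ... | no ¬p | inj₁ e        = subst (λ v → v + sumˡ (List.map g xs) ≤ length (filter P? xs)) (sym e) (sum≤length-filter P? g h xs)
  ... | no ¬p | inj₂ (_ , p)  = contradiction p ¬p

  module PairCounts {N M : ℕ} .{{_ : NonZero M}} (X : Fin N → ℤ) where

    open Modulus M

    difference : Fin N → Fin N → ℤ
    difference i j = X i ℤ.- X j

    ∑-distinct : (ℤ → ℕ) → ℕ
    ∑-distinct g = ∑ λ i → ∑ λ j → offDiagonal i j (g (difference i j))

    ∑-distinct-square-suc : ∀ R → ∑-distinct (square (suc R)) ≡ ∑-distinct (window R) + ∑-distinct (square R)
    ∑-distinct-square-suc R = trans
      (∑-cong λ i → trans
        (∑-cong λ j → trans (cong (offDiagonal i j) (square-suc R (difference i j))) (offDiagonal-+ i j _ _))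
        (∑-distrib-+ (λ j → offDiagonal i j (window R (difference i j))) _))
      (∑-distrib-+ (λ i → ∑ λ j → offDiagonal i j (window R (difference i j))) _)

    -- Sums the window bounds over t < R: Σ 2 (t + 2H) = R (R - 1) + 4HR. The integers `c` and `K`
    -- keep denominators out of the count.
    ∑-distinct-square≤ : ∀ c K H R → (∀ t → t < R → c * ∑-distinct (window t) ≤ K * (2 * (t + 2 * H))) →
      c * ∑-distinct (square R) ≤ K * (R * R + 4 * H * R)
    ∑-distinct-square≤ c K H zero    h = subst (_≤ K * (0 + 4 * H * 0)) (sym (trans (cong (c *_) zeros) (ℕₚ.*-zeroʳ c))) z≤n
      where
      zeros : ∑-distinct (square 0) ≡ 0
      zeros = trans (∑-cong λ i → trans (∑-cong λ j → offDiagonal-0 i j) (trans (∑-const N 0) (ℕₚ.*-zeroʳ N))) (trans (∑-const N 0) (ℕₚ.*-zeroʳ N))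
        where
        offDiagonal-0 : ∀ i j → offDiagonal {N} i j 0 ≡ 0
        offDiagonal-0 i j with i Fin.≟ j
        ... | yes _ = refl
        ... | no  _ = refl
    ∑-distinct-square≤ c K H (suc R) h = begin
      c * ∑-distinct (square (suc R))
        ≡⟨ cong (c *_) (∑-distinct-square-suc R) ⟩
      c * (∑-distinct (window R) + ∑-distinct (square R))
        ≡⟨ ℕₚ.*-distribˡ-+ c _ _ ⟩
      c * ∑-distinct (window R) + c * ∑-distinct (square R)
        ≤⟨ ℕₚ.+-mono-≤ (h R ℕₚ.≤-refl) (∑-distinct-square≤ c K H R λ t t<R → h t (ℕₚ.m<n⇒m<1+n t<R)) ⟩
      K * (2 * (R + 2 * H)) + K * (R * R + 4 * H * R)
        -- The spare K completes R² + 2R to (R + 1)².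
        ≤⟨ ℕₚ.m≤m+n _ K ⟩
      K * (2 * (R + 2 * H)) + K * (R * R + 4 * H * R) + K
        ≡⟨ solve 3 (λ K R H → K :* (con 2 :* (R :+ con 2 :* H)) :+ K :* (R :* R :+ con 4 :* H :* R) :+ K
             := K :* ((con 1 :+ R) :* (con 1 :+ R) :+ con 4 :* H :* (con 1 :+ R))) refl K R H ⟩
      K * (suc R * suc R + 4 * H * suc R) ∎
      where
      open ℕₚ.≤-Reasoning
      open ℕ-Solver.+-*-Solver

    point : ∀ {R} → Fin N → Fin R → Fin M
    point i r = residue (X i ℤ.+ + toℕ r)

    -- This is Σ_j v(j)² of the overview, written as a count of pairs of shifted points.
    coincidences : ℕ → ℕ
    coincidences R = ∑ λ i → ∑ {R} λ r → ∑ λ j → ∑ {R} λ r′ → [ point j r′ Fin.≟ point i r ]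

    -- Equal residues make M divide X_i - X_j + r - r′. The N terms with i = j are at most R each.
    coincidences≤ : ∀ R → R + R ≤ M → coincidences R ≤ N * R + ∑-distinct (square R)
    coincidences≤ R 2R≤M = begin
      coincidences R
        ≤⟨ (∑-mono λ i → ∑-mono {R} λ r → ∑-mono λ j → ∑-mono {R} λ r′ →
             []-mono (point j r′ Fin.≟ point i r) (+ M ∣? (difference i j ℤ.+ (toℕ r ⊖ toℕ r′))) λ e →
               subst (+ M ∣_) (shift i j (toℕ r) (toℕ r′)) (residue-≡ (X j ℤ.+ + toℕ r′) (X i ℤ.+ + toℕ r) e)) ⟩
      ∑ (λ i → ∑ {R} λ r → ∑ λ j → ∑ {R} λ r′ → divisible (difference i j ℤ.+ (toℕ r ⊖ toℕ r′)))
        ≡⟨ (∑-cong λ i → ∑-comm {R} {N} λ r j → ∑ {R} λ r′ → divisible (difference i j ℤ.+ (toℕ r ⊖ toℕ r′))) ⟩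
      ∑ (λ i → ∑ λ j → square R (difference i j))
        ≤⟨ (∑-mono λ i → ∑-offDiagonal i (λ j → square R (difference i j)) (square≤ R (difference i i) 2R≤M)) ⟩
      ∑ (λ i → R + ∑ λ j → offDiagonal i j (square R (difference i j)))
        ≡⟨ ∑-distrib-+ {N} (λ _ → R) (λ i → ∑ λ j → offDiagonal i j (square R (difference i j))) ⟩
      ∑ (λ (_ : Fin N) → R) + ∑-distinct (square R)
        ≡⟨ cong (_+ ∑-distinct (square R)) (∑-const N R) ⟩
      N * R + ∑-distinct (square R) ∎
      where
      open ℕₚ.≤-Reasoning
      open ℤ-Solver.+-*-Solver
      shift : ∀ i j r r′ → (X i ℤ.+ + r) ℤ.- (X j ℤ.+ + r′) ≡ difference i j ℤ.+ (r ⊖ r′)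
      shift i j r r′ = trans (solve 4 (λ x y a b → (x :+ a) :- (y :+ b) := (x :- y) :+ (a :- b)) refl (X i) (X j) (+ r) (+ r′))
        (cong (ℤ._+_ (difference i j)) (ℤₚ.m-n≡m⊖n r r′))

    ∑-distinct-window≤ : ∀ t → t + t < M → {P : Fin N × Fin N → Set} (P? : Decidable P) →
      (∀ i j → ¬ (i ≡ j) → (∃[ w ] (∣ w ∣ ≤ t) × (+ M ∣ difference i j ℤ.+ w)) → P (i , j)) →
      ∑-distinct (window t) ≤ length (filter P? (pairs N))
    ∑-distinct-window≤ t 2t<M P? h = subst (_≤ length (filter P? (pairs N))) (sym (∑∑≡sum-pairs g))
      (sum≤length-filter P? g (λ (i , j) → atMostOne-map (λ (i≢j , e) → h i j i≢j e)
        (offDiagonal-atMostOne i j (window-atMostOne t (difference i j) 2t<M))) (pairs N))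
      where
      g : Fin N × Fin N → ℕ
      g (i , j) = offDiagonal i j (window t (difference i j))

-- Exponential sums over points rounded to the grid.

module Estimation where

  open import Data.Integer using (_/ℕ_)
  open Ordered
  open Circle
  open Bessel
  open Counting

  ℕ-inverse : ∀ n .{{_ : NonZero n}} → (+ n ℚ./ 1) ℚ.* (+ 1 ℚ./ n) ≡ 1ℚ
  ℕ-inverse (suc n) = ≡.trans (≡.cong (ℚ._* (+ 1 ℚ./ suc n)) (≡.sym (RationalFacts.fromℤ≡/1 (+ suc n)))) (RationalFacts.suc*1/suc n)

  1≤i*i : ∀ i → i ≢ 0ℤ → + 1 ℤ.≤ i ℤ.* i
  1≤i*i (+ zero)   i≢0 = contradiction ≡.refl i≢0
  1≤i*i (+ suc n)  _   = ℤ.+≤+ (s≤s z≤n)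
  1≤i*i -[1+ n ]   _   = ℤ.+≤+ (s≤s z≤n)

  module Estimates (𝔸 : OrderedAlgebra) (𝕋 : Trigonometry 𝔸) where

    open OrderedAlgebraProperties 𝔸
    open TrigonometryProperties 𝔸 𝕋
    open Inequality 𝔸
    open Grid 𝔸 𝕋
    open Solver using (solve; _:+_; _:*_; _:-_; :-_; _:=_; con)

    fromℕ-∑ : ∀ {n} (f : Vector ℕ n) → fromℕ (∑ f) ≈ sum (λ i → fromℕ (f i))
    fromℕ-∑ {zero}  f = refl
    fromℕ-∑ {suc n} f = trans (fromℕ-+ (f zero) (∑ (f ∘ suc))) (+-congˡ (fromℕ-∑ (f ∘ suc)))

    sum-indicator : ∀ {n} (i : Fin n) (f : Vector Carrier n) → sum (λ j → fromℕ [ i Fin.≟ j ] * f j) ≈ f i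
    sum-indicator {suc n} zero f = trans
      (+-cong (*-identityˡ (f zero)) (trans (sum-cong-≋ {n} λ j → zeroˡ (f (suc j))) (sum-replicate-zero n)))
      (+-identityʳ (f zero))
    sum-indicator {suc n} (suc i) f = trans (+-cong (zeroˡ (f zero)) (sum-indicator i (f ∘ suc))) (+-identityˡ (f (suc i)))

    -- Cauchy-Schwarz against the constant 1, from xy ≤ (x² + y²) / 2 summed over all pairs.
    square-sum≤ : ∀ {n} (f : Vector Carrier n) → sum f * sum f ≤ fromℕ n * sum (λ i → f i * f i)
    square-sum≤ {n} f = ≤-respˡ (sym double) (≤-respʳ halved (sum-mono λ i → sum-mono λ j → amgm (f i) (f j)))
      where
      S = sum f
      Q = sum (λ i → f i * f i)
      double : S * S ≈ sum (λ i → sum (λ j → f i * f j))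
      double = trans (*-distribʳ-sum S f) (sum-cong-≋ {n} λ i → *-distribˡ-sum (f i) f)
      amgm : ∀ x y → x * y ≤ fromℚ ½ * (x * x) + fromℚ ½ * (y * y)
      amgm x y = ≤-by (*-nonNeg (fromℚ-mono (ℚₚ.nonNegative⁻¹ ½)) (square-nonNeg (x - y)))
        (solve 2 (λ x y → x :* y :+ con ½ :* ((x :- y) :* (x :- y)) := con ½ :* (x :* x) :+ con ½ :* (y :* y)) refl x y)
      halved : sum (λ i → sum (λ j → fromℚ ½ * (f i * f i) + fromℚ ½ * (f j * f j))) ≈ fromℕ n * Q
      halved = trans
        (sum-cong-≋ {n} λ i → trans (∑-distrib-+ {n} (λ _ → fromℚ ½ * (f i * f i)) (λ j → fromℚ ½ * (f j * f j)))
          (+-cong (sum-const n _) (sym (*-distribˡ-sum (fromℚ ½) (λ j → f j * f j)))))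
        (trans (∑-distrib-+ {n} (λ i → fromℕ n * (fromℚ ½ * (f i * f i))) (λ _ → fromℚ ½ * Q))
          (trans (+-cong (trans (sum-cong-≋ {n} λ i → solve 2 (λ n x → n :* (con ½ :* x) := (con ½ :* n) :* x) refl (fromℕ n) (f i * f i))
              (sym (*-distribˡ-sum (fromℚ ½ * fromℕ n) (λ i → f i * f i)))) (sum-const n _))
            (solve 2 (λ n q → (con ½ :* n) :* q :+ n :* (con ½ :* q) := n :* q) refl (fromℕ n) Q)))

    ∣∣≤-trans : ∀ {x y z} → ∣ x ∣≤ y → y ≤ z → ∣ x ∣≤ z
    ∣∣≤-trans (l , u) p = ≤-trans (neg-mono-≤ p) l , ≤-trans u p

    ∣∣≤-resp : ∀ {x y z} → x ≈ y → ∣ x ∣≤ z → ∣ y ∣≤ z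
    ∣∣≤-resp e (l , u) = ≤-respʳ e l , ≤-respˡ e u

    ∣∣≤⇒square≤ : ∀ {x y} → ∣ x ∣≤ y → x * x ≤ y * y
    ∣∣≤⇒square≤ {x} {y} (l , u) = ≤-by (*-nonNeg (x≤y⇒0≤y-x u) (x≤y⇒0≤y-x l))
      (solve 2 (λ x y → x :* x :+ (y :- x) :* (x :- (:- y)) := y :* y) refl x y)

    ∣fromℤ*∣≤ : ∀ k {x y} → ∣ x ∣≤ y → ∣ fromℤ k * x ∣≤ fromℕ (ℤ.∣ k ∣) * y
    ∣fromℤ*∣≤ (+ n) {x} {y} (l , u) =
      ≤-respˡ (solve 2 (λ n y → n :* (:- y) := :- (n :* y)) refl (fromℕ n) y) (*-monoˡ-≤ (fromℕ-nonNeg n) l) ,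
      *-monoˡ-≤ (fromℕ-nonNeg n) u
    ∣fromℤ*∣≤ -[1+ n ] {x} {y} (l , u) = ∣∣≤-resp (sym (*-congʳ (fromℤ-neg (+ suc n))))
      ( ≤-respʳ (solve 2 (λ n x → :- (n :* x) := :- n :* x) refl m x) (neg-mono-≤ (*-monoˡ-≤ (fromℕ-nonNeg (suc n)) u))
      , ≤-respˡ (solve 2 (λ n x → :- (n :* x) := :- n :* x) refl m x)
          (≤-respʳ (solve 2 (λ n y → :- (n :* (:- y)) := n :* y) refl m y) (neg-mono-≤ (*-monoˡ-≤ (fromℕ-nonNeg (suc n)) l))))
      where m = fromℕ (suc n)

    -- |Σ e^{2πi x_n}|²
    power : ∀ {N} → Vector Carrier N → Carrier
    power x = sum (c ∘ x) * sum (c ∘ x) + sum (s ∘ x) * sum (s ∘ x)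

    power-nonNeg : ∀ {N} (x : Vector Carrier N) → 0# ≤ power x
    power-nonNeg x = +-nonNeg (square-nonNeg _) (square-nonNeg _)

    -- |z + w|² ≤ 2|z|² + 2|w|², where w is the sum of the chords e(x_n) - e(y_n). Cauchy-Schwarz
    -- and `chord` give |w|² ≤ 128 N² τ².
    power-perturb : ∀ {N} (x y : Vector Carrier N) {τ} → τ ≤ fromℚ (+ 1 ℚ./ 16) → (∀ n → ∣ x n - y n ∣≤ τ) →
      power x ≤ fromℕ 2 * power y + fromℕ 256 * (fromℕ N * fromℕ N * (τ * τ))
    power-perturb {N} x y {τ} small near = ≤-trans split (+-monoʳ-≤ _ error)
      where
      dc ds : Vector Carrier N
      dc n = c (x n) - c (y n)
      ds n = s (x n) - s (y n)

      decompose : ∀ (f g : Vector Carrier N) → sum f ≈ sum g + sum (λ n → f n - g n)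
      decompose f g = trans (sum-cong-≋ {N} λ n → solve 2 (λ a b → a := b :+ (a :- b)) refl (f n) (g n)) (∑-distrib-+ {N} g (λ n → f n - g n))

      squares : ∀ a b → (a + b) * (a + b) ≤ fromℕ 2 * (a * a) + fromℕ 2 * (b * b)
      squares a b = ≤-by (square-nonNeg (a - b))
        (solve 2 (λ a b → (a :+ b) :* (a :+ b) :+ (a :- b) :* (a :- b) := con (+ 2 ℚ./ 1) :* (a :* a) :+ con (+ 2 ℚ./ 1) :* (b :* b)) refl a b)

      split : power x ≤ fromℕ 2 * power y + fromℕ 2 * (sum dc * sum dc + sum ds * sum ds)
      split = ≤-respˡ (sym (+-cong (*-cong ec ec) (*-cong es es)))
        (≤-respʳ (solve 4 (λ a b d e → (con (+ 2 ℚ./ 1) :* a :+ con (+ 2 ℚ./ 1) :* b) :+ (con (+ 2 ℚ./ 1) :* d :+ con (+ 2 ℚ./ 1) :* e)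
            := con (+ 2 ℚ./ 1) :* (a :+ d) :+ con (+ 2 ℚ./ 1) :* (b :+ e)) refl _ _ _ _)
          (+-mono-≤ (squares (sum (c ∘ y)) (sum dc)) (squares (sum (s ∘ y)) (sum ds))))
        where
        ec = decompose (c ∘ x) (c ∘ y)
        es = decompose (s ∘ x) (s ∘ y)

      chords : sum (λ n → dc n * dc n) + sum (λ n → ds n * ds n) ≤ fromℕ N * (fromℕ 128 * (τ * τ))
      chords = ≤-respˡ (∑-distrib-+ {N} (λ n → dc n * dc n) (λ n → ds n * ds n)) (≤-respʳ (sum-const N _)
        (sum-mono λ n → ≤-trans (chord (x n) (y n) (∣∣≤-trans (near n) small)) (*-monoˡ-≤ (fromℕ-nonNeg 128) (∣∣≤⇒square≤ (near n)))))

      error : fromℕ 2 * (sum dc * sum dc + sum ds * sum ds) ≤ fromℕ 256 * (fromℕ N * fromℕ N * (τ * τ))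
      error = ≤-trans (*-monoˡ-≤ (fromℕ-nonNeg 2) (≤-trans (+-mono-≤ (square-sum≤ dc) (square-sum≤ ds))
          (≤-respˡ (distribˡ (fromℕ N) _ _) (*-monoˡ-≤ (fromℕ-nonNeg N) chords))))
        (≤-reflexive (solve 2 (λ n t → con (+ 2 ℚ./ 1) :* (n :* (n :* (con (+ 128 ℚ./ 1) :* t))) := con (+ 256 ℚ./ 1) :* (n :* n :* t)) refl (fromℕ N) (τ * τ)))

    module _ (M : ℕ) .{{_ : NonZero M}} where

      μ : Carrier
      μ = fromℚ (+ 1 ℚ./ M)

      M*μ≈1 : fromℕ M * μ ≈ 1#
      M*μ≈1 = trans (sym (fromℚ-* _ _)) (fromℚ-cong (ℕ-inverse M))

      0<1/M : 0ℚ ℚ.< + 1 ℚ./ M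
      0<1/M = ℚₚ.positive⁻¹ _ {{ℚₚ.normalize-pos 1 M}}

      0≤μ : 0# ≤ μ
      0≤μ = fromℚ-mono (ℚₚ.<⇒≤ 0<1/M)

      ∣fromℤ*μ∣≤ : ∀ z → 16 ℕ.* ℤ.∣ z ∣ ℕ.≤ M → ∣ fromℤ z * μ ∣≤ fromℚ (+ 1 ℚ./ 16)
      ∣fromℤ*μ∣≤ z h = ∣∣≤-trans (∣fromℤ*∣≤ z {μ} {μ} (≤-trans (≤-respʳ (solve 0 (:- con 0ℚ := con 0ℚ) refl) (neg-mono-≤ 0≤μ)) 0≤μ , ≤-refl))
        (*-cancelˡ-≤ (ℚₚ.positive⁻¹ (+ 16 ℚ./ 1)) (≤-respʳ (solve 0 (con 1ℚ := con (+ 16 ℚ./ 1) :* con (+ 1 ℚ./ 16)) refl)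
          (≤-respʳ M*μ≈1 (≤-respˡ (trans (*-congʳ (fromℕ-* 16 ℤ.∣ z ∣)) (*-assoc _ _ _)) (*-monoʳ-≤ 0≤μ (fromℕ-mono h))))))

      module Points {N : ℕ} (X : Fin N → ℤ) (R : ℕ) where

        open PairCounts {N} {M} X
        open Modulus M using (residue; residue-decomposition)

        multiplicity : Fin M → ℕ
        multiplicity j = ∑ λ n → ∑ {R} λ r → [ point n r Fin.≟ j ]

        -- Change of variables from grid points j to pairs (n , r): the sums are exchanged and the
        -- indicator picks out one j.
        sum-multiplicity : ∀ (f : Vector Carrier M) →
          sum (λ j → fromℕ (multiplicity j) * f j) ≈ sum (λ n → sum {R} λ r → f (point n r))
        sum-multiplicity f = trans
          (sum-cong-≋ {M} λ j → trans (*-congʳ (trans (fromℕ-∑ {N} _) (sum-cong-≋ {N} λ n → fromℕ-∑ {R} _)))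
            (trans (*-distribʳ-sum {N} (f j) _) (sum-cong-≋ {N} λ n → *-distribʳ-sum {R} (f j) _)))
          (trans (∑-comm {M} {N} _) (sum-cong-≋ {N} λ n → trans (∑-comm {M} {R} _) (sum-cong-≋ {R} λ r → sum-indicator (point n r) f)))

        signal zeros : Vector Carrier M
        signal j = fromℕ (multiplicity j)
        zeros _ = 0#

        -- Σ_j v(j)² is the sum of v over all points, that is, the number of ordered coincidences.
        norm²-signal : norm² signal zeros ≈ fromℕ (coincidences R)
        norm²-signal = trans (sum-cong-≋ {M} λ j → solve 1 (λ a → a :* a :+ con 0ℚ :* con 0ℚ := a :* a) refl (signal j))
          (trans (sum-multiplicity signal) (sym (trans (fromℕ-∑ {N} _) (sum-cong-≋ {N} λ n → fromℕ-∑ {R} _))))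

        phase : ℤ → Vector Carrier N
        phase k n = fromℤ k * (fromℤ (X n) * μ)

        offset : ℤ → Vector Carrier R
        offset k r = fromℤ k * (fromℕ (toℕ r) * μ)

        private
          -- The residue is X_n + r - wM, and k w M μ = k w is an integer; periodicity then removes
          -- the reduction modulo M from every character.
          unwrap : ∀ k n r → fromℤ k * (fromℕ (toℕ (point {R} n r)) * μ) + fromℤ (k ℤ.* ((X n ℤ.+ + toℕ r) /ℕ M)) ≈ phase k n + offset k r
          unwrap k n r = trans
            (+-congˡ (trans (fromℤ-* k w) (trans (solve 2 (λ k w → k :* w := k :* (w :* con 1ℚ)) refl (fromℤ k) (fromℤ w))
              (*-congˡ (*-congˡ (sym M*μ≈1))))))
            (trans (solve 5 (λ k p m w M → k :* (p :* m) :+ k :* (w :* (M :* m)) := k :* ((p :+ w :* M) :* m)) refl (fromℤ k) (fromℤ (+ toℕ (residue z))) μ (fromℤ w) (fromℕ M))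
              (trans (*-congˡ (*-congʳ (trans (+-congˡ (sym (fromℤ-* w (+ M)))) (trans (sym (fromℤ-+ (+ toℕ (residue z)) (w ℤ.* + M)))
                  (trans (reflexive (≡.cong fromℤ (≡.sym (residue-decomposition z)))) (fromℤ-+ (X n) (+ toℕ r)))))))
                (solve 4 (λ k x r m → k :* ((x :+ r) :* m) := k :* (x :* m) :+ k :* (r :* m)) refl (fromℤ k) (fromℤ (X n)) (fromℤ (+ toℕ r)) μ)))
            where
            z = X n ℤ.+ + toℕ r
            w = z /ℕ M

          c-point : ∀ k n r → c (fromℤ k * (fromℕ (toℕ (point {R} n r)) * μ)) ≈ c (phase k n) * c (offset k r) - s (phase k n) * s (offset k r)
          c-point k n r = trans (sym (c-periodic _ (k ℤ.* ((X n ℤ.+ + toℕ r) /ℕ M)))) (trans (c-cong (unwrap k n r)) (c-+ _ _))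

          s-point : ∀ k n r → s (fromℤ k * (fromℕ (toℕ (point {R} n r)) * μ)) ≈ s (phase k n) * c (offset k r) + c (phase k n) * s (offset k r)
          s-point k n r = trans (sym (s-periodic _ (k ℤ.* ((X n ℤ.+ + toℕ r) /ℕ M)))) (trans (s-cong (unwrap k n r)) (s-+ _ _))

          sum-product : ∀ (f : Vector Carrier N) (g : Vector Carrier R) → sum (λ n → sum (λ r → f n * g r)) ≈ sum f * sum g
          sum-product f g = sym (trans (*-distribʳ-sum (sum g) f) (sum-cong-≋ {N} λ n → *-distribˡ-sum (f n) g))

          sum-products : ∀ (f f′ : Vector Carrier N) (g g′ : Vector Carrier R) →
            sum (λ n → sum (λ r → f n * g r + f′ n * g′ r)) ≈ sum f * sum g + sum f′ * sum g′
          sum-products f f′ g g′ = trans (sum-cong-≋ {N} λ n → ∑-distrib-+ {R} (λ r → f n * g r) (λ r → f′ n * g′ r))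
            (trans (∑-distrib-+ {N} (λ n → sum (λ r → f n * g r)) (λ n → sum (λ r → f′ n * g′ r)))
              (+-cong (sum-product f g) (sum-product f′ g′)))

        -- The signal is the convolution of the points with a box, so its Fourier coefficient
        -- factors. The inner product yields the conjugate of the product (P + iQ)(U + iV), hence
        -- the minus sign in `im≈`.
        energy-signal : ∀ k → energy signal zeros (frequency {M} μ M*μ≈1 k) ≈ power (phase k) * power (offset k)
        energy-signal k = trans (+-cong (*-cong re≈ re≈) (*-cong im≈ im≈))
          (solve 4 (λ P Q U V → (P :* U :+ (:- Q) :* V) :* (P :* U :+ (:- Q) :* V) :+ (:- (Q :* U :+ P :* V)) :* (:- (Q :* U :+ P :* V))
            := (P :* P :+ Q :* Q) :* (U :* U :+ V :* V)) refl P Q U V)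
          where
          P = sum (c ∘ phase k)
          Q = sum (s ∘ phase k)
          U = sum (c ∘ offset k)
          V = sum (s ∘ offset k)
          w = frequency {M} μ M*μ≈1 k
          re≈ : re signal zeros w ≈ P * U + (- Q) * V
          re≈ = trans (sum-cong-≋ {M} λ j → solve 3 (λ a c s → a :* c :+ con 0ℚ :* s := a :* c) refl (signal j) (Wave.c w j) (Wave.s w j))
            (trans (sum-multiplicity (Wave.c w)) (trans
              (sum-cong-≋ {N} λ n → sum-cong-≋ {R} λ r → trans (c-point k n r)
                (solve 4 (λ a b x y → a :* b :- x :* y := a :* b :+ (:- x) :* y) refl (c (phase k n)) (c (offset k r)) (s (phase k n)) (s (offset k r))))
              (trans (sum-products (c ∘ phase k) (λ n → - s (phase k n)) (c ∘ offset k) (s ∘ offset k))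
                (+-congˡ (*-congʳ (sum-neg (s ∘ phase k)))))))
          im≈ : im signal zeros w ≈ - (Q * U + P * V)
          im≈ = trans (trans (sum-cong-≋ {M} λ j → solve 3 (λ a c s → con 0ℚ :* c :- a :* s := :- (a :* s)) refl (signal j) (Wave.c w j) (Wave.s w j))
              (sum-neg (λ j → signal j * Wave.s w j)))
            (-‿cong (trans (sum-multiplicity (Wave.s w)) (trans (sum-cong-≋ {N} λ n → sum-cong-≋ {R} λ r → s-point k n r)
              (sum-products (s ∘ phase k) (c ∘ phase k) (c ∘ offset k) (s ∘ offset k)))))

        energy-0 : (fromℕ N * fromℕ N) * (fromℕ R * fromℕ R) ≤ energy signal zeros (frequency {M} μ M*μ≈1 0ℤ)
        energy-0 = ≤-respʳ (sym (energy-signal 0ℤ)) (≤-reflexive (sym (*-cong (power-0 N λ n → zeroˡ _) (power-0 R λ r → zeroˡ _))))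
          where
          power-0 : ∀ n {x : Vector Carrier n} → (∀ i → x i ≈ 0#) → power x ≈ fromℕ n * fromℕ n
          power-0 n {x} h = trans (+-cong (*-cong cs cs) (*-cong ss ss)) (solve 1 (λ n → n :* n :+ con 0ℚ :* con 0ℚ := n :* n) refl (fromℕ n))
            where
            cs : sum (c ∘ x) ≈ fromℕ n
            cs = trans (sum-cong-≋ {n} λ i → trans (c-cong (h i)) c-0) (trans (sum-const n 1#) (*-identityʳ _))
            ss : sum (s ∘ x) ≈ 0#
            ss = trans (sum-cong-≋ {n} λ i → trans (s-cong (h i)) s-0) (sum-replicate-zero n)

        -- All phases k r / M with r < R lie within 1/16 of 0, so every cosine is at least 3/4. The
        -- real part alone gives modulus squared at least 9/16 R² ≥ ½ R².
        energy-lower : ∀ k → 16 ℕ.* (ℤ.∣ k ∣ ℕ.* R) ℕ.≤ M →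
          (fromℚ ½ * (fromℕ R * fromℕ R)) * power (phase k) ≤ energy signal zeros (frequency {M} μ M*μ≈1 k)
        energy-lower k h = ≤-respʳ (sym (energy-signal k)) (≤-respˡ (*-comm _ _) (*-monoˡ-≤ (power-nonNeg (phase k)) power-offset))
          where
          U = sum (c ∘ offset k)
          3/4R = fromℕ R * fromℚ (+ 3 ℚ./ 4)
          U≥ : 3/4R ≤ U
          U≥ = ≤-respˡ (sum-const R _) (sum-mono λ r → 3/4≤c (∣∣≤-resp (trans (*-congʳ (fromℤ-* k (+ toℕ r))) (*-assoc _ _ _))
            (∣fromℤ*μ∣≤ (k ℤ.* + toℕ r) (ℕₚ.≤-trans (ℕₚ.*-monoʳ-≤ 16 (≡.subst (ℕ._≤ ℤ.∣ k ∣ ℕ.* R) (≡.sym (ℤₚ.∣i*j∣≡∣i∣*∣j∣ k (+ toℕ r)))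
              (ℕₚ.*-monoʳ-≤ ℤ.∣ k ∣ (ℕₚ.<⇒≤ (Finₚ.toℕ<n r))))) h))))
          power-offset : fromℚ ½ * (fromℕ R * fromℕ R) ≤ power (offset k)
          power-offset = ≤-trans
            (≤-by (*-nonNeg (square-nonNeg (fromℕ R)) (fromℚ-mono (ℚₚ.nonNegative⁻¹ (+ 1 ℚ./ 16))))
              (solve 1 (λ r → con ½ :* (r :* r) :+ (r :* r) :* con (+ 1 ℚ./ 16) := (r :* con (+ 3 ℚ./ 4)) :* (r :* con (+ 3 ℚ./ 4))) refl (fromℕ R)))
            (≤-trans (*-mono-≤ 0≤3/4R (≤-trans 0≤3/4R U≥) U≥ U≥)
              (≤-by (square-nonNeg (sum (s ∘ offset k))) refl))
            where
            0≤3/4R : 0# ≤ 3/4R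
            0≤3/4R = *-nonNeg (fromℕ-nonNeg R) (fromℚ-mono (ℚₚ.nonNegative⁻¹ (+ 3 ℚ./ 4)))

        -- The bound 32 |k| ≤ M makes |k - l| ≤ M / 16. For distinct k and l the square of (k - l) /
        -- M is at least 1 / M², the ε that orthogonality asks for.
        frequencies-orthogonal : ∀ {ks} → All (λ k → 32 ℕ.* ℤ.∣ k ∣ ℕ.≤ M) ks → Unique ks →
          AllPairs (λ k l → Orthogonal (frequency {M} μ M*μ≈1 k) (frequency {M} μ M*μ≈1 l)) ks
        frequencies-orthogonal []       []       = []
        frequencies-orthogonal {k ∷ ks} (b ∷ bs) (n ∷ ns) = All.zipWith (λ {l} (bl , k≢l) → orthogonal l bl k≢l) (bs , n) ∷ frequencies-orthogonal bs ns
          where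
          orthogonal : ∀ l → 32 ℕ.* ℤ.∣ l ∣ ℕ.≤ M → k ≢ l → Orthogonal (frequency {M} μ M*μ≈1 k) (frequency {M} μ M*μ≈1 l)
          orthogonal l bl k≢l = frequency-orthogonal {M} μ M*μ≈1 k l (∣fromℤ*μ∣≤ d (ℕₚ.*-cancelˡ-≤ 2 small))
            ((+ 1 ℚ./ M) ℚ.* (+ 1 ℚ./ M)) (RationalFacts.*>0 0<1/M 0<1/M)
            (≤-respˡ (sym (fromℚ-* _ _)) (≤-respˡ (*-identityˡ (μ * μ))
              (≤-respʳ (trans (*-congʳ (fromℤ-* d d)) (solve 2 (λ d m → d :* d :* (m :* m) := d :* m :* (d :* m)) refl (fromℤ d) μ))
                (*-monoʳ-≤ (square-nonNeg μ) (fromℤ-mono (1≤i*i d λ d≡0 → k≢l (ℤₚ.i-j≡0⇒i≡j k l d≡0)))))))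
            where
            d = k ℤ.- l
            small : 2 ℕ.* (16 ℕ.* ℤ.∣ d ∣) ℕ.≤ 2 ℕ.* M
            small = begin
              2 ℕ.* (16 ℕ.* ℤ.∣ d ∣)                    ≡⟨ ℕₚ.*-assoc 2 16 ℤ.∣ d ∣ ⟨
              32 ℕ.* ℤ.∣ d ∣                            ≤⟨ ℕₚ.*-monoʳ-≤ 32 (ℤₚ.∣i-j∣≤∣i∣+∣j∣ k l) ⟩
              32 ℕ.* (ℤ.∣ k ∣ ℕ.+ ℤ.∣ l ∣)              ≡⟨ ℕₚ.*-distribˡ-+ 32 ℤ.∣ k ∣ ℤ.∣ l ∣ ⟩
              32 ℕ.* ℤ.∣ k ∣ ℕ.+ 32 ℕ.* ℤ.∣ l ∣         ≤⟨ ℕₚ.+-mono-≤ b bl ⟩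
              M ℕ.+ M                                   ≡⟨ ≡.cong (M ℕ.+_) (≡.sym (ℕₚ.+-identityʳ M)) ⟩
              2 ℕ.* M                                   ∎
              where open ℕₚ.≤-Reasoning

        -- The contribution of k = 0 is N²R², the expected size of the right side.
        bessel-points : ∀ ks → Unique (0ℤ ∷ ks) → All (λ k → 32 ℕ.* ℤ.∣ k ∣ ℕ.≤ M) ks → All (λ k → 16 ℕ.* (ℤ.∣ k ∣ ℕ.* R) ℕ.≤ M) ks →
          (fromℕ N * fromℕ N) * (fromℕ R * fromℕ R) + (fromℚ ½ * (fromℕ R * fromℕ R)) * sumᴸ ks (λ k → power (phase k))
            ≤ fromℕ M * fromℕ (coincidences R)
        bessel-points ks unique near small = ≤-trans (+-mono-≤ energy-0 (≤-trans (≤-reflexive (sumᴸ-distrib ks)) (sumᴸ-mono ks (All.map (λ {k} → energy-lower k) small))))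
          (≤-respʳ (*-congˡ norm²-signal)
            (bessel {M} μ M*μ≈1 (frequency {M} μ M*μ≈1) (0ℤ ∷ ks) (frequencies-orthogonal (z≤n ∷ near) unique) signal zeros))
          where
          sumᴸ-distrib : ∀ ls → (fromℚ ½ * (fromℕ R * fromℕ R)) * sumᴸ ls (λ k → power (phase k)) ≈ sumᴸ ls (λ k → (fromℚ ½ * (fromℕ R * fromℕ R)) * power (phase k))
          sumᴸ-distrib []       = zeroʳ _
          sumᴸ-distrib (l ∷ ls) = trans (distribˡ _ _ _) (+-congˡ (sumᴸ-distrib ls))

  module ExponentialSums (𝔸 : OrderedAlgebra) (𝕋 : Trigonometry 𝔸)
    (N D H : ℕ) .{{_ : NonZero (N ℕ.* H)}} (X : Fin N → ℤ) where

    open OrderedAlgebraProperties 𝔸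
    open TrigonometryProperties 𝔸 𝕋
    open Inequality 𝔸
    open Estimates 𝔸 𝕋
    open Solver using (solve; _:+_; _:*_; _:-_; :-_; _:=_; con)

    M R : ℕ
    M = N ℕ.* H
    R = D ℕ.* H

    open PairCounts {N} {M} X
    open Modulus M using (square; window)
    open Points M X R

    module _
      (1≤D : 1 ℕ.≤ D) (32≤H : 32 ℕ.≤ H) (2D≤N : 2 ℕ.* D ℕ.≤ N)
      (sparse : ∀ t → t ℕ.< R → R ℕ.* ∑-distinct (window t) ℕ.≤ N ℕ.* (D ℕ.+ 1) ℕ.* (2 ℕ.* (t ℕ.+ 2 ℕ.* H)))
      (ks : List ℤ) (unique : Unique (0ℤ ∷ ks)) (low : All (λ k → 16 ℕ.* (D ℕ.* ℤ.∣ k ∣) ℕ.≤ N) ks)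
      where

      2≤H : 2 ℕ.≤ H
      2≤H = ℕₚ.≤-trans (s≤s (s≤s z≤n)) 32≤H

      1≤R : 1 ℕ.≤ R
      1≤R = ℕₚ.*-mono-≤ 1≤D (ℕₚ.≤-trans (s≤s z≤n) 32≤H)

      2R≤M : R ℕ.+ R ℕ.≤ M
      2R≤M = ℕₚ.≤-trans (ℕₚ.≤-reflexive (ℕ-Solver.+-*-Solver.solve 2 (λ d h → d ⊗ h ⊕ d ⊗ h ⊜ (⟨ 2 ⟩ ⊗ d) ⊗ h) ≡.refl D H)) (ℕₚ.*-monoˡ-≤ H 2D≤N)
        where open ℕ-Solver.+-*-Solver renaming (_:*_ to _⊗_; _:+_ to _⊕_; _:=_ to _⊜_; con to ⟨_⟩)

      -- In units of N² R², the diagonal contributes 1, the main window term D + 1, and the shift by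
      -- 2H at most 8, because 4HR (D + 1) ≤ 4HR · 2D = 8R².
      coincidences-bound : D ℕ.* (M ℕ.* coincidences R) ℕ.≤ N ℕ.* N ℕ.* (R ℕ.* R) ℕ.* (D ℕ.+ 10)
      coincidences-bound = begin
        D ℕ.* (M ℕ.* coincidences R)
          ≤⟨ ℕₚ.*-monoʳ-≤ D (ℕₚ.*-monoʳ-≤ M (coincidences≤ R 2R≤M)) ⟩
        D ℕ.* (N ℕ.* H ℕ.* (N ℕ.* (D ℕ.* H) ℕ.+ T))
          ≡⟨ S.solve 4 (λ d n h t → d ⊗ (n ⊗ h ⊗ (n ⊗ (d ⊗ h) ⊕ t)) ⊜ n ⊗ n ⊗ ((d ⊗ h) ⊗ (d ⊗ h)) ⊕ n ⊗ (d ⊗ h ⊗ t)) ≡.refl D N H T ⟩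
        N ℕ.* N ℕ.* (R ℕ.* R) ℕ.+ N ℕ.* (R ℕ.* T)
          ≤⟨ ℕₚ.+-monoʳ-≤ (N ℕ.* N ℕ.* (R ℕ.* R)) (ℕₚ.*-monoʳ-≤ N (∑-distinct-square≤ R (N ℕ.* (D ℕ.+ 1)) H R sparse)) ⟩
        N ℕ.* N ℕ.* (R ℕ.* R) ℕ.+ N ℕ.* (N ℕ.* (D ℕ.+ 1) ℕ.* (R ℕ.* R ℕ.+ 4 ℕ.* H ℕ.* R))
          ≡⟨ S.solve 4 (λ d n h r → n ⊗ n ⊗ (r ⊗ r) ⊕ n ⊗ (n ⊗ (d ⊕ ⟨ 1 ⟩) ⊗ (r ⊗ r ⊕ ⟨ 4 ⟩ ⊗ h ⊗ r))
               ⊜ n ⊗ n ⊗ (r ⊗ r ⊗ (d ⊕ ⟨ 2 ⟩)) ⊕ n ⊗ n ⊗ ((d ⊕ ⟨ 1 ⟩) ⊗ (⟨ 4 ⟩ ⊗ h ⊗ r))) ≡.refl D N H R ⟩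
        N ℕ.* N ℕ.* (R ℕ.* R ℕ.* (D ℕ.+ 2)) ℕ.+ N ℕ.* N ℕ.* ((D ℕ.+ 1) ℕ.* (4 ℕ.* H ℕ.* R))
          ≤⟨ ℕₚ.+-monoʳ-≤ (N ℕ.* N ℕ.* (R ℕ.* R ℕ.* (D ℕ.+ 2))) (ℕₚ.*-monoʳ-≤ (N ℕ.* N) (ℕₚ.*-monoˡ-≤ (4 ℕ.* H ℕ.* R) (ℕₚ.+-monoʳ-≤ D 1≤D))) ⟩
        N ℕ.* N ℕ.* (R ℕ.* R ℕ.* (D ℕ.+ 2)) ℕ.+ N ℕ.* N ℕ.* ((D ℕ.+ D) ℕ.* (4 ℕ.* H ℕ.* (D ℕ.* H)))
          ≡⟨ S.solve 3 (λ d n h → n ⊗ n ⊗ ((d ⊗ h) ⊗ (d ⊗ h) ⊗ (d ⊕ ⟨ 2 ⟩)) ⊕ n ⊗ n ⊗ ((d ⊕ d) ⊗ (⟨ 4 ⟩ ⊗ h ⊗ (d ⊗ h)))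
               ⊜ n ⊗ n ⊗ ((d ⊗ h) ⊗ (d ⊗ h)) ⊗ (d ⊕ ⟨ 10 ⟩)) ≡.refl D N H ⟩
        N ℕ.* N ℕ.* (R ℕ.* R) ℕ.* (D ℕ.+ 10) ∎
        where
        open ℕₚ.≤-Reasoning
        module S = ℕ-Solver.+-*-Solver
        open S using () renaming (_:*_ to _⊗_; _:+_ to _⊕_; _:=_ to _⊜_; con to ⟨_⟩)
        T = ∑-distinct (square R)

      16∣k∣≤16D∣k∣ : ∀ k → 16 ℕ.* ℤ.∣ k ∣ ℕ.≤ 16 ℕ.* (D ℕ.* ℤ.∣ k ∣)
      16∣k∣≤16D∣k∣ k = ℕₚ.*-monoʳ-≤ 16 (ℕₚ.≤-trans (ℕₚ.≤-reflexive (≡.sym (ℕₚ.*-identityˡ _))) (ℕₚ.*-monoˡ-≤ ℤ.∣ k ∣ 1≤D))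

      32∣k∣≤M : ∀ {k} → 16 ℕ.* (D ℕ.* ℤ.∣ k ∣) ℕ.≤ N → 32 ℕ.* ℤ.∣ k ∣ ℕ.≤ M
      32∣k∣≤M {k} h = ℕₚ.≤-trans (ℕₚ.≤-reflexive (≡.trans (ℕₚ.*-assoc 2 16 ℤ.∣ k ∣) (ℕₚ.*-comm 2 (16 ℕ.* ℤ.∣ k ∣))))
        (ℕₚ.*-mono-≤ (ℕₚ.≤-trans (16∣k∣≤16D∣k∣ k) h) 2≤H)

      16∣k∣R≤M : ∀ {k} → 16 ℕ.* (D ℕ.* ℤ.∣ k ∣) ℕ.≤ N → 16 ℕ.* (ℤ.∣ k ∣ ℕ.* R) ℕ.≤ M
      16∣k∣R≤M {k} h = ℕₚ.≤-trans (ℕₚ.≤-reflexive (rearrange ℤ.∣ k ∣)) (ℕₚ.*-monoˡ-≤ H h)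
        where
        open ℕ-Solver.+-*-Solver renaming (solve to solve′; _:*_ to _⊗_; _:=_ to _⊜_; con to ⟨_⟩)
        rearrange : ∀ k → 16 ℕ.* (k ℕ.* R) ≡ 16 ℕ.* (D ℕ.* k) ℕ.* H
        rearrange k = solve′ 3 (λ k d h → ⟨ 16 ⟩ ⊗ (k ⊗ (d ⊗ h)) ⊜ ⟨ 16 ⟩ ⊗ (d ⊗ k) ⊗ h) ≡.refl k D H

      -- In D (N² R² + ½ R² Σ) ≤ N² R² (D + 10) the main terms cancel and leave ½ D Σ ≤ 10 N².
      -- Taking `slack` twice clears the ½.
      grid-sum-bound : fromℕ D * sumᴸ ks (λ k → power (phase k)) ≤ fromℕ 20 * (fromℕ N * fromℕ N)
      grid-sum-bound = *-cancelˡ-≤ {+ (R ℕ.* R) ℚ./ 1} 0<R² (≤-respˡ (*-congʳ (sym R²)) (≤-respʳ (*-congʳ (sym R²))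
        (≤-by (+-nonNeg slack slack) (solve 4 (λ d n r S →
            (r :* r) :* (d :* S) :+ ((n :* n :* (r :* r) :* (d :+ con (+ 10 ℚ./ 1)) :- d :* (n :* n :* (r :* r) :+ (con ½ :* (r :* r)) :* S))
              :+ (n :* n :* (r :* r) :* (d :+ con (+ 10 ℚ./ 1)) :- d :* (n :* n :* (r :* r) :+ (con ½ :* (r :* r)) :* S)))
            := (r :* r) :* (con (+ 20 ℚ./ 1) :* (n :* n))) refl (fromℕ D) (fromℕ N) (fromℕ R) Σ))))
        where
        Σ = sumᴸ ks (λ k → power (phase k))
        R² : fromℕ (R ℕ.* R) ≈ fromℕ R * fromℕ R
        R² = fromℕ-* R R
        0<R² : 0ℚ ℚ.< + (R ℕ.* R) ℚ./ 1
        0<R² = ℚₚ.<-≤-trans (ℚₚ.positive⁻¹ 1ℚ) (ℤ→ℚ-mono (ℤ.+≤+ (ℕₚ.*-mono-≤ 1≤R 1≤R)))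
        slack : 0# ≤ fromℕ N * fromℕ N * (fromℕ R * fromℕ R) * (fromℕ D + fromℕ 10)
          - fromℕ D * (fromℕ N * fromℕ N * (fromℕ R * fromℕ R) + fromℚ ½ * (fromℕ R * fromℕ R) * Σ)
        slack = x≤y⇒0≤y-x (≤-trans
          (*-monoˡ-≤ (fromℕ-nonNeg D) (bessel-points ks unique (All.map (λ {k} → 32∣k∣≤M {k}) low) (All.map (λ {k} → 16∣k∣R≤M {k}) low)))
          (≤-respˡ (trans (fromℕ-* D (M ℕ.* coincidences R)) (*-congˡ (fromℕ-* M (coincidences R))))
            (≤-respʳ (trans (fromℕ-* (N ℕ.* N ℕ.* (R ℕ.* R)) (D ℕ.+ 10)) (*-cong (trans (fromℕ-* (N ℕ.* N) (R ℕ.* R)) (*-cong (fromℕ-* N N) R²)) (fromℕ-+ D 10)))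
              (fromℕ-mono coincidences-bound))))

      sumᴸ-affine : ∀ {A : Set} a b (f : A → Carrier) ls → sumᴸ ls (λ k → a * f k + b) ≈ a * sumᴸ ls f + fromℕ (length ls) * b
      sumᴸ-affine a b f []       = solve 2 (λ a b → con 0ℚ := a :* con 0ℚ :+ con 0ℚ :* b) refl a b
      sumᴸ-affine a b f (l ∷ ls) = trans (+-congˡ (sumᴸ-affine a b f ls))
        (trans (solve 5 (λ a b x S n → (a :* x :+ b) :+ (a :* S :+ n :* b) := a :* (x :+ S) :+ (con 1ℚ :+ n) :* b) refl a b (f l) (sumᴸ ls f) (fromℕ (length ls)))
          (+-congˡ (*-congʳ (sym (fromℕ-+ 1 (length ls))))))

      -- Rounding doubles the grid bound and adds `E` for each frequency. Since H τ = 2, the total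
      -- error D · |ks| · 256 N² τ² is 1024 D |ks| N² / H² ≤ N², whence 41 = 2 · 20 + 1.
      power-sum≤ : 1024 ℕ.* (D ℕ.* length ks) ℕ.≤ H ℕ.* H →
        (x : Fin N → Carrier) → (∀ n → ∣ x n * fromℕ M - fromℤ (X n) ∣≤ fromℕ 2) →
        fromℕ D * sumᴸ ks (λ k → power (λ n → fromℤ k * x n)) ≤ fromℕ 41 * (fromℕ N * fromℕ N)
      power-sum≤ fine x near = ≤-trans
        (*-monoˡ-≤ (fromℕ-nonNeg D) (≤-respʳ (sumᴸ-affine (fromℕ 2) E (λ k → power (phase k)) ks)
          (sumᴸ-mono ks (All.map (λ {k} → perturb k) low))))
        (≤-by (+-nonNeg (*-nonNeg (fromℕ-nonNeg 2) (x≤y⇒0≤y-x grid-sum-bound)) (*-nonNeg (square-nonNeg (fromℕ N)) error))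
          (solve 5 (λ d S l n t → d :* (con (+ 2 ℚ./ 1) :* S :+ l :* (con (+ 256 ℚ./ 1) :* (n :* n :* t)))
              :+ (con (+ 2 ℚ./ 1) :* (con (+ 20 ℚ./ 1) :* (n :* n) :- d :* S) :+ (n :* n) :* (con 1ℚ :- con (+ 256 ℚ./ 1) :* (d :* l) :* t))
              := con (+ 41 ℚ./ 1) :* (n :* n)) refl (fromℕ D) (sumᴸ ks (λ k → power (phase k))) (fromℕ (length ks)) (fromℕ N) (τ * τ)))
        where
        m = μ M
        τ E : Carrier
        -- The largest phase error |k| · 2 / M, with |k| ≤ N; it equals 2 / H.
        τ = fromℕ N * (fromℕ 2 * m)
        E = fromℕ 256 * (fromℕ N * fromℕ N * (τ * τ))

        0≤2m : 0# ≤ fromℕ 2 * m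
        0≤2m = *-nonNeg (fromℕ-nonNeg 2) (0≤μ M)

        Hτ≈2 : fromℕ H * τ ≈ fromℕ 2
        Hτ≈2 = trans (solve 3 (λ h n m → h :* (n :* (con (+ 2 ℚ./ 1) :* m)) := con (+ 2 ℚ./ 1) :* ((n :* h) :* m)) refl (fromℕ H) (fromℕ N) m)
          (trans (*-congˡ (trans (*-congʳ (sym (fromℕ-* N H))) (M*μ≈1 M))) (*-identityʳ _))

        τ≤1/16 : τ ≤ fromℚ (+ 1 ℚ./ 16)
        τ≤1/16 = *-cancelˡ-≤ (ℚₚ.positive⁻¹ (+ 32 ℚ./ 1)) (≤-respʳ (trans Hτ≈2 (solve 0 (con (+ 2 ℚ./ 1) := con (+ 32 ℚ./ 1) :* con (+ 1 ℚ./ 16)) refl))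
          (*-monoʳ-≤ (*-nonNeg (fromℕ-nonNeg N) 0≤2m) (fromℕ-mono 32≤H)))

        error : 0# ≤ 1# - fromℕ 256 * (fromℕ D * fromℕ (length ks)) * (τ * τ)
        error = x≤y⇒0≤y-x (*-cancelˡ-≤ (ℚₚ.positive⁻¹ (+ 4 ℚ./ 1)) (≤-respˡ
          (trans (*-congʳ (trans (fromℕ-* 1024 (D ℕ.* length ks)) (*-congˡ (fromℕ-* D (length ks)))))
            (solve 2 (λ d t → (con (+ 1024 ℚ./ 1) :* d) :* t := con (+ 4 ℚ./ 1) :* (con (+ 256 ℚ./ 1) :* d :* t)) refl (fromℕ D * fromℕ (length ks)) (τ * τ)))
          (≤-respʳ (trans (trans (*-congʳ (fromℕ-* H H)) (solve 2 (λ h t → (h :* h) :* (t :* t) := (h :* t) :* (h :* t)) refl (fromℕ H) τ))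
              (trans (*-cong Hτ≈2 Hτ≈2) (solve 0 (con (+ 2 ℚ./ 1) :* con (+ 2 ℚ./ 1) := con (+ 4 ℚ./ 1) :* con 1ℚ) refl)))
            (*-monoʳ-≤ (square-nonNeg τ) (fromℕ-mono fine)))))

        close : ∀ n → ∣ x n - fromℤ (X n) * m ∣≤ fromℕ 2 * m
        close n = ∣∣≤-resp (trans (solve 4 (λ x M X m → (x :* M :- X) :* m := x :* (M :* m) :- X :* m) refl (x n) (fromℕ M) (fromℤ (X n)) m)
            (+-congʳ (trans (*-congˡ (M*μ≈1 M)) (*-identityʳ (x n)))))
          ( ≤-respˡ (solve 2 (λ a m → (:- a) :* m := :- (a :* m)) refl (fromℕ 2) m) (*-monoʳ-≤ (0≤μ M) (proj₁ (near n)))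
          , *-monoʳ-≤ (0≤μ M) (proj₂ (near n)))

        perturb : ∀ k → 16 ℕ.* (D ℕ.* ℤ.∣ k ∣) ℕ.≤ N → power (λ n → fromℤ k * x n) ≤ fromℕ 2 * power (phase k) + E
        perturb k h = power-perturb (λ n → fromℤ k * x n) (phase k) τ≤1/16 λ n →
          ∣∣≤-resp (solve 3 (λ k x y → k :* (x :- y) := k :* x :- k :* y) refl (fromℤ k) (x n) (fromℤ (X n) * m))
            (∣∣≤-trans (∣fromℤ*∣≤ k (close n)) (*-monoʳ-≤ 0≤2m (fromℕ-mono (ℕₚ.≤-trans (ℕₚ.m≤n*m ℤ.∣ k ∣ 16) (ℕₚ.≤-trans (16∣k∣≤16D∣k∣ k) h)))))

-- From the pair correlation hypothesis to the bound for the sum.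

module Correlation where

  open Ordered
  open Circle
  open Bessel
  open Counting
  open Estimation

  -- Over finite index sets double negation commutes with ∀, so the instances of excluded middle
  -- assemble into one decision procedure.
  ¬¬-decidable : ∀ {m n} (P : Fin m × Fin n → Set) → ¬ ¬ Decidable P
  ¬¬-decidable P = ¬¬-map uncurry (shift λ i → shift λ j → ¬¬-excluded-middle)
    where
    shift : ∀ {n} {Q : Fin n → Set} → (∀ i → ¬ ¬ Q i) → ¬ ¬ (∀ i → Q i)
    shift = Finₚ.sequence (RawMonad.rawApplicative ¬¬-Monad)

  enumerate-pairs : ∀ {N} {P : Fin N × Fin N → Set} (P? : Decidable P) → Enumerates (filter P? (pairs N)) P
  enumerate-pairs {N} P? = filter⁺ P? (cartesianProduct⁺ (allFin⁺ N) (allFin⁺ N)) ,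
    λ (i , j) → mk⇔ (λ p → proj₂ (∈-filter⁻ P? {xs = pairs N} p)) (∈-filter⁺ P? (∈-cartesianProduct⁺ (∈-allFin i) (∈-allFin j)))

  module PairCorrelation (𝔸 : OrderedAlgebra) (𝕋 : Trigonometry 𝔸) where

    open OrderedAlgebraProperties 𝔸
    open Trigonometry 𝕋 using (cos; sin; π; cos-cong; sin-cong)
    open TrigonometryProperties 𝔸 𝕋
    open Inequality 𝔸
    open Estimates 𝔸 𝕋
    open Solver using (solve; _:+_; _:*_; _:-_; :-_; _:=_; con)

    module _
      (∥_∥ : Carrier → Carrier)
      (∥∥-upper : ∀ x k r → x - fromℤ k ≤ r → fromℤ k - x ≤ r → ∥ x ∥ ≤ r)
      (integerPart : ∀ x → ∃[ z ] (x ≤ fromℤ z + fromℕ 2) × (fromℤ z ≤ x + fromℕ 2))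
      where

      -- D = z - 4 for an integer z within 2 of ρ = 1/δ. Then D + 2 = z - 2 ≤ ρ, which makes the
      -- largest radius (R + 2H) / H admissible, and ρ ≤ D + 6 ≤ 2D because ρ ≥ 256 makes D large.
      natural-scale : ∀ {δ ρ} → 0# ≤ δ → δ ≤ fromℚ (+ 1 ℚ./ 256) → 0# ≤ ρ → δ * ρ ≈ 1# →
        ∃[ D ] (1 ℕ.≤ D) × (fromℕ D + fromℕ 2 ≤ ρ) × (1# ≤ fromℕ 2 * (fromℕ D * δ))
      natural-scale {δ} {ρ} 0≤δ δ≤ 0≤ρ δρ≈1 = D , ℕₚ.≤-trans (s≤s z≤n) 6≤D , D+2≤ρ , 1≤2Dδ
        where
        z = proj₁ (integerPart ρ)
        D = ℤ.∣ z ∣ ℕ.∸ 4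
        256≤ρ : fromℕ 256 ≤ ρ
        256≤ρ = ≤-by (*-nonNeg (*-nonNeg (fromℕ-nonNeg 256) (x≤y⇒0≤y-x δ≤)) 0≤ρ) (trans
          (solve 2 (λ d r → con (+ 256 ℚ./ 1) :+ con (+ 256 ℚ./ 1) :* (con (+ 1 ℚ./ 256) :- d) :* r
            := r :+ con (+ 256 ℚ./ 1) :* (con 1ℚ :- d :* r)) refl δ ρ)
          (trans (+-congˡ (*-congˡ (+-congˡ (-‿cong δρ≈1)))) (solve 1 (λ r → r :+ con (+ 256 ℚ./ 1) :* (con 1ℚ :- con 1ℚ) := r) refl ρ)))
        10≤z : + 10 ℤ.≤ z
        10≤z = ℤ→ℚ-cancel (fromℚ-cancel (≤-by
          (+-nonNeg (x≤y⇒0≤y-x (≤-trans 256≤ρ (proj₁ (proj₂ (integerPart ρ))))) (fromℕ-nonNeg 244))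
          (solve 1 (λ z → con (+ 10 ℚ./ 1) :+ ((z :+ con (+ 2 ℚ./ 1) :- con (+ 256 ℚ./ 1)) :+ con (+ 244 ℚ./ 1)) := z) refl (fromℤ z))))
        +∣z∣≡z : + ℤ.∣ z ∣ ≡ z
        +∣z∣≡z = ℤₚ.0≤i⇒+∣i∣≡i (ℤₚ.≤-trans (ℤ.+≤+ z≤n) 10≤z)
        10≤∣z∣ : 10 ℕ.≤ ℤ.∣ z ∣
        10≤∣z∣ = ℤₚ.drop‿+≤+ (≡.subst (+ 10 ℤ.≤_) (≡.sym +∣z∣≡z) 10≤z)
        6≤D : 6 ℕ.≤ D
        6≤D = ℕₚ.∸-monoˡ-≤ 4 10≤∣z∣
        z≈D+4 : fromℤ z ≈ fromℕ D + fromℕ 4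
        z≈D+4 = trans (reflexive (≡.cong fromℤ (≡.trans (≡.sym +∣z∣≡z) (≡.cong +_ (≡.sym (ℕₚ.m∸n+n≡m (ℕₚ.≤-trans (s≤s (s≤s (s≤s (s≤s z≤n)))) 10≤∣z∣))))))) (fromℕ-+ D 4)
        D+2≤ρ : fromℕ D + fromℕ 2 ≤ ρ
        D+2≤ρ = ≤-by (x≤y⇒0≤y-x (≤-respˡ z≈D+4 (proj₂ (proj₂ (integerPart ρ)))))
          (solve 2 (λ d r → d :+ con (+ 2 ℚ./ 1) :+ (r :+ con (+ 2 ℚ./ 1) :- (d :+ con (+ 4 ℚ./ 1))) := r) refl (fromℕ D) ρ)
        ρ≤2D : ρ ≤ fromℕ 2 * fromℕ D
        ρ≤2D = ≤-trans (≤-respʳ (+-congʳ z≈D+4) (proj₁ (proj₂ (integerPart ρ))))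
          (≤-by (x≤y⇒0≤y-x (fromℕ-mono 6≤D)) (solve 1 (λ d → d :+ con (+ 4 ℚ./ 1) :+ con (+ 2 ℚ./ 1) :+ (d :- con (+ 6 ℚ./ 1)) := con (+ 2 ℚ./ 1) :* d) refl (fromℕ D)))
        1≤2Dδ : 1# ≤ fromℕ 2 * (fromℕ D * δ)
        1≤2Dδ = ≤-respˡ δρ≈1 (≤-respʳ (solve 2 (λ d e → e :* (con (+ 2 ℚ./ 1) :* d) := con (+ 2 ℚ./ 1) :* (d :* e)) refl (fromℕ D) δ) (*-monoˡ-≤ 0≤δ ρ≤2D))

      module _ (N : ℕ) .{{_ : NonZero N}} (x : Fin N → Carrier) where

        Near : Carrier → Fin N × Fin N → Set
        Near r (m , n) = m ≢ n × ∥ x m - x n ∥ ≤ r * fromℚ (+ 1 ℚ./ N)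

        Sparse : Carrier → Carrier → Set
        Sparse δ σ = ∀ r → 1# ≤ r → r ≤ σ → ∀ ps → Enumerates ps (Near r) → fromℕ (length ps) * fromℚ (+ 1 ℚ./ N) ≤ (1# + δ) * (fromℕ 2 * r)

        module Windows (H : ℕ) .{{_ : NonZero H}} .{{_ : NonZero (N ℕ.* H)}} (2≤H : 2 ℕ.≤ H) (X : Fin N → ℤ)
          (close : ∀ n → ∣ x n * fromℕ (N ℕ.* H) - fromℤ (X n) ∣≤ fromℕ 2) where

          open PairCounts {N} {N ℕ.* H} X
          open Modulus (N ℕ.* H) using (window)

          M : ℕ
          M = N ℕ.* H

          -- Adding 2H makes the radius at least 1 for every t, so that the hypothesis
          -- applies to all windows; it absorbs the rounding errors and costs only O(H R)
          -- in the sum of the window counts.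
          radius : ℕ → Carrier
          radius t = fromℕ (t ℕ.+ 2 ℕ.* H) * fromℚ (+ 1 ℚ./ H)

          H*radius : ∀ t → fromℕ H * radius t ≈ fromℕ (t ℕ.+ 2 ℕ.* H)
          H*radius t = trans (solve 3 (λ h r i → h :* (r :* i) := r :* (h :* i)) refl (fromℕ H) (fromℕ (t ℕ.+ 2 ℕ.* H)) (fromℚ (+ 1 ℚ./ H)))
            (trans (*-congˡ (M*μ≈1 H)) (*-identityʳ _))

          0<ℕ : ∀ n .{{_ : NonZero n}} → 0ℚ ℚ.< + n ℚ./ 1
          0<ℕ (suc n) = ℚₚ.<-≤-trans (ℚₚ.positive⁻¹ 1ℚ) (ℤ→ℚ-mono {+ 1} {+ suc n} (ℤ.+≤+ (s≤s z≤n)))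

          -- M (x_i - x_j - q) is the difference of two rounding errors of size at most 2, minus w.
          -- Its size is at most t + 4 ≤ t + 2H, which is M times the radius over N.
          window-near : ∀ t i j → i ≢ j → (∃[ w ] (ℤ.∣ w ∣ ℕ.≤ t) × (+ M ∣ difference i j ℤ.+ w)) → Near (radius t) (i , j)
          window-near t i j i≢j (w , w≤t , divides q eq) = i≢j , ∥∥-upper (x i - x j) q _
            (*-cancelˡ-≤ (0<ℕ M) (≤-respʳ (sym scaled) (≤-by slack₁ (trans (+-congʳ expand)
              (solve 4 (λ a b w r → (a :- b :- w) :+ (((con (+ 2 ℚ./ 1) :- a) :+ (b :- (:- con (+ 2 ℚ./ 1)))) :+ ((w :- (:- (r :- con (+ 4 ℚ./ 1)))))) := r) refl a b (fromℤ w) B)))))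
            (*-cancelˡ-≤ (0<ℕ M) (≤-respʳ (sym scaled) (≤-by slack₂ (trans (+-congʳ (trans
                (solve 3 (λ M q y → M :* (q :- y) := :- (M :* (y :- q))) refl (fromℕ M) (fromℤ q) (x i - x j)) (-‿cong expand)))
              (solve 4 (λ a b w r → (:- (a :- b :- w)) :+ (((a :- (:- con (+ 2 ℚ./ 1))) :+ (con (+ 2 ℚ./ 1) :- b)) :+ ((r :- con (+ 4 ℚ./ 1)) :- w)) := r) refl a b (fromℤ w) B)))))
            where
            a = x i * fromℕ M - fromℤ (X i)
            b = x j * fromℕ M - fromℤ (X j)
            B = fromℕ (t ℕ.+ 2 ℕ.* H)
            ν = fromℚ (+ 1 ℚ./ N)
            scaled : fromℕ M * (radius t * ν) ≈ B
            scaled = trans (*-congʳ (fromℕ-* N H)) (trans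
              (solve 4 (λ n h r v → (n :* h) :* (r :* v) := (h :* r) :* (n :* v)) refl (fromℕ N) (fromℕ H) (radius t) ν)
              (trans (*-cong (H*radius t) (M*μ≈1 N)) (*-identityʳ B)))
            w-bound : ∣ fromℤ w ∣≤ (B - fromℕ 4)
            w-bound = ∣∣≤-trans (∣∣≤-resp (*-identityʳ (fromℤ w)) (∣fromℤ*∣≤ w {1#} {1#} (≤-trans (≤-respˡ (fromℚ-neg 1ℚ) (fromℚ-mono (ℚₚ.nonPositive⁻¹ (ℚ.- 1ℚ)))) (fromℕ-nonNeg 1) , ≤-refl)))
              (≤-respˡ (sym (*-identityʳ (fromℕ ℤ.∣ w ∣))) (≤-by (x≤y⇒0≤y-x (fromℕ-mono (ℕₚ.+-mono-≤ w≤t (ℕₚ.*-monoʳ-≤ 2 2≤H))))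
                (trans (+-congˡ (+-congˡ (-‿cong (fromℕ-+ ℤ.∣ w ∣ 4)))) (solve 2 (λ w b → w :+ (b :- (w :+ con (+ 4 ℚ./ 1))) := b :- con (+ 4 ℚ./ 1)) refl (fromℕ ℤ.∣ w ∣) B))))
            slack₁ : 0# ≤ ((fromℕ 2 - a) + (b - (- fromℕ 2))) + (fromℤ w - (- (B - fromℕ 4)))
            slack₁ = +-nonNeg (+-nonNeg (x≤y⇒0≤y-x (proj₂ (close i))) (x≤y⇒0≤y-x (proj₁ (close j)))) (x≤y⇒0≤y-x (proj₁ w-bound))
            slack₂ : 0# ≤ ((a - (- fromℕ 2)) + (fromℕ 2 - b)) + ((B - fromℕ 4) - fromℤ w)
            slack₂ = +-nonNeg (+-nonNeg (x≤y⇒0≤y-x (proj₁ (close i))) (x≤y⇒0≤y-x (proj₂ (close j)))) (x≤y⇒0≤y-x (proj₂ w-bound))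
            congruence : (fromℤ (X i) - fromℤ (X j)) + fromℤ w ≈ fromℤ q * fromℕ M
            congruence = trans (+-congʳ (trans (+-congˡ (sym (fromℤ-neg (X j)))) (sym (fromℤ-+ (X i) (ℤ.- X j)))))
              (trans (sym (fromℤ-+ (difference i j) w)) (trans (reflexive (≡.cong fromℤ eq)) (fromℤ-* q (+ M))))
            expand : fromℕ M * ((x i - x j) - fromℤ q) ≈ a - b - fromℤ w
            expand = trans (solve 4 (λ M u v q → M :* ((u :- v) :- q) := (u :* M :- v :* M) :- q :* M) refl (fromℕ M) (x i) (x j) (fromℤ q))
              (trans (+-congˡ (-‿cong (sym congruence)))
                (solve 5 (λ u v p r w → (u :- v) :- ((p :- r) :+ w) := (u :- p) :- (v :- r) :- w) refl (x i * fromℕ M) (x j * fromℕ M) (fromℤ (X i)) (fromℤ (X j)) (fromℤ w)))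

          -- The radius (t + 2H) / H lies between 1 and D + 2 ≤ ρ. Multiplying the hypothesis by N D
          -- H clears the denominators, and D (1 + δ) ≤ D + 1.
          window-sparse : ∀ {δ ρ D} → 0# ≤ δ → δ * ρ ≈ 1# → fromℕ D + fromℕ 2 ≤ ρ → 2 ℕ.* D ℕ.≤ N → Sparse δ ρ →
            ∀ t → t ℕ.< D ℕ.* H → D ℕ.* H ℕ.* ∑-distinct (window t) ℕ.≤ N ℕ.* (D ℕ.+ 1) ℕ.* (2 ℕ.* (t ℕ.+ 2 ℕ.* H))
          -- Nearness is decidable only up to double negation, but the conclusion compares natural
          -- numbers and is therefore stable.
          window-sparse {δ} {ρ} {D} 0≤δ δρ≈1 D+2≤ρ 2D≤N sparse t t<R = decidable-stable (_ ℕₚ.≤? _)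
            (¬¬-map bound (¬¬-decidable (Near (radius t))))
            where
            H≤t+2H : H ℕ.≤ t ℕ.+ 2 ℕ.* H
            H≤t+2H = ℕₚ.≤-trans (ℕₚ.m≤m+n H (H ℕ.+ 0)) (ℕₚ.m≤n+m (2 ℕ.* H) t)
            1≤r : 1# ≤ radius t
            1≤r = *-cancelˡ-≤ (0<ℕ H) (≤-respˡ (sym (*-identityʳ (fromℕ H))) (≤-respʳ (sym (H*radius t)) (fromℕ-mono H≤t+2H)))
            t+2H≤ : t ℕ.+ 2 ℕ.* H ℕ.≤ H ℕ.* (D ℕ.+ 2)
            t+2H≤ = ℕₚ.≤-trans (ℕₚ.+-monoˡ-≤ (2 ℕ.* H) (ℕₚ.<⇒≤ t<R)) (ℕₚ.≤-reflexive (≡.trans (≡.sym (ℕₚ.*-distribʳ-+ H D 2)) (ℕₚ.*-comm (D ℕ.+ 2) H)))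
            r≤ρ : radius t ≤ ρ
            r≤ρ = ≤-trans (*-cancelˡ-≤ (0<ℕ H) (≤-respˡ (sym (H*radius t)) (≤-respʳ (trans (fromℕ-* H (D ℕ.+ 2)) (*-congˡ (fromℕ-+ D 2))) (fromℕ-mono t+2H≤)))) D+2≤ρ
            Dδ≤1 : fromℕ D * δ ≤ 1#
            Dδ≤1 = ≤-trans (≤-by (*-nonNeg (fromℕ-nonNeg 2) 0≤δ) (solve 2 (λ d e → d :* e :+ con (+ 2 ℚ./ 1) :* e := e :* (d :+ con (+ 2 ℚ./ 1))) refl (fromℕ D) δ))
              (≤-respʳ δρ≈1 (*-monoˡ-≤ 0≤δ D+2≤ρ))
            2t<M : t ℕ.+ t ℕ.< M
            2t<M = ℕₚ.<-≤-trans (ℕₚ.+-mono-< t<R t<R) (≡.subst (ℕ._≤ M) (≡.trans (≡.cong (ℕ._* H) (≡.cong (D ℕ.+_) (ℕₚ.+-identityʳ D))) (ℕₚ.*-distribʳ-+ H D D)) (ℕₚ.*-monoˡ-≤ H 2D≤N))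
            bound : Decidable (Near (radius t)) → D ℕ.* H ℕ.* ∑-distinct (window t) ℕ.≤ N ℕ.* (D ℕ.+ 1) ℕ.* (2 ℕ.* (t ℕ.+ 2 ℕ.* H))
            bound P? = ℕₚ.≤-trans (ℕₚ.*-monoʳ-≤ (D ℕ.* H) (∑-distinct-window≤ t 2t<M P? (window-near t))) (fromℕ-cancel real-bound)
              where
              L = length (filter P? (pairs N))
              ν = fromℚ (+ 1 ℚ./ N)
              B = fromℕ (t ℕ.+ 2 ℕ.* H)
              counted : fromℕ L * ν ≤ (1# + δ) * (fromℕ 2 * radius t)
              counted = sparse (radius t) 1≤r r≤ρ (filter P? (pairs N)) (enumerate-pairs P?)
              real-bound : fromℕ (D ℕ.* H ℕ.* L) ≤ fromℕ (N ℕ.* (D ℕ.+ 1) ℕ.* (2 ℕ.* (t ℕ.+ 2 ℕ.* H)))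
              real-bound = ≤-respˡ left (≤-respʳ right (≤-trans
                  (*-monoˡ-≤ (*-nonNeg (*-nonNeg (fromℕ-nonNeg N) (fromℕ-nonNeg D)) (fromℕ-nonNeg H)) counted)
                  (≤-trans (≤-reflexive (trans
                      (solve 5 (λ n d h e r → (n :* d :* h) :* ((con 1ℚ :+ e) :* (con (+ 2 ℚ./ 1) :* r)) := (n :* (d :+ d :* e)) :* (con (+ 2 ℚ./ 1) :* (h :* r))) refl
                        (fromℕ N) (fromℕ D) (fromℕ H) δ (radius t))
                      (*-congˡ (*-congˡ (H*radius t)))))
                    (*-monoʳ-≤ (*-nonNeg (fromℕ-nonNeg 2) (fromℕ-nonNeg (t ℕ.+ 2 ℕ.* H))) (*-monoˡ-≤ (fromℕ-nonNeg N) (+-monoʳ-≤ (fromℕ D) Dδ≤1))))))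
                where
                left : (fromℕ N * fromℕ D * fromℕ H) * (fromℕ L * ν) ≈ fromℕ (D ℕ.* H ℕ.* L)
                left = trans (solve 5 (λ n d h l v → (n :* d :* h) :* (l :* v) := (d :* h :* l) :* (n :* v)) refl (fromℕ N) (fromℕ D) (fromℕ H) (fromℕ L) ν)
                  (trans (*-congˡ (M*μ≈1 N)) (trans (*-identityʳ _) (sym (trans (fromℕ-* (D ℕ.* H) L) (*-congʳ (fromℕ-* D H))))))
                right : (fromℕ N * (fromℕ D + 1#)) * (fromℕ 2 * B) ≈ fromℕ (N ℕ.* (D ℕ.+ 1) ℕ.* (2 ℕ.* (t ℕ.+ 2 ℕ.* H)))
                right = sym (trans (fromℕ-* (N ℕ.* (D ℕ.+ 1)) (2 ℕ.* (t ℕ.+ 2 ℕ.* H)))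
                  (*-cong (trans (fromℕ-* N (D ℕ.+ 1)) (*-congˡ (fromℕ-+ D 1))) (fromℕ-* 2 (t ℕ.+ 2 ℕ.* H))))

        -- 16 D |k| ≤ 16 D δ σ N ≤ D δ N ≤ N, with σ = √δ in the application.
        low-frequency : ∀ {δ ρ σ D} → 0# ≤ δ → δ * ρ ≈ 1# → fromℕ D + fromℕ 2 ≤ ρ → σ ≤ fromℚ (+ 1 ℚ./ 16) →
          ∀ k → fromℕ ℤ.∣ k ∣ ≤ δ * σ * fromℕ N → 16 ℕ.* (D ℕ.* ℤ.∣ k ∣) ℕ.≤ N
        low-frequency {δ} {ρ} {σ} {D} 0≤δ δρ≈1 D+2≤ρ σ≤ k k≤ = fromℕ-cancel {16 ℕ.* (D ℕ.* ℤ.∣ k ∣)} {N} (≤-respˡ (sym (trans (fromℕ-* 16 (D ℕ.* ℤ.∣ k ∣)) (*-congˡ (fromℕ-* D ℤ.∣ k ∣)))) (≤-trans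
          (*-monoˡ-≤ (fromℕ-nonNeg 16) (*-monoˡ-≤ (fromℕ-nonNeg D) k≤))
          (≤-by (+-nonNeg (*-nonNeg (*-nonNeg (fromℕ-nonNeg 16) (*-nonNeg (fromℕ-nonNeg D) 0≤δ)) (*-nonNeg (x≤y⇒0≤y-x σ≤) (fromℕ-nonNeg N)))
              (+-nonNeg (*-nonNeg (*-nonNeg 0≤δ (x≤y⇒0≤y-x D+2≤ρ)) (fromℕ-nonNeg N)) (*-nonNeg (*-nonNeg (fromℕ-nonNeg 2) 0≤δ) (fromℕ-nonNeg N))))
            (trans (solve 5 (λ d e s n r → con (+ 16 ℚ./ 1) :* (d :* (e :* s :* n)) :+ ((con (+ 16 ℚ./ 1) :* (d :* e)) :* ((con (+ 1 ℚ./ 16) :- s) :* n)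
                :+ ((e :* (r :- (d :+ con (+ 2 ℚ./ 1)))) :* n :+ (con (+ 2 ℚ./ 1) :* e) :* n)) := (e :* r) :* n) refl (fromℕ D) δ σ (fromℕ N) ρ)
              (trans (*-congʳ δρ≈1) (*-identityˡ (fromℕ N)))))))

        -- The split on the list sets the empty sum aside. Any frequency k₀ ≠ 0 forces 16 D ≤ 16 D
        -- |k₀| ≤ N, hence 2D ≤ N and 2 ≤ N, and the latter releases the guarded hypothesis.
        power-sum-bound : ∀ {δ ρ σ} → 0# ≤ δ → δ ≤ fromℚ (+ 1 ℚ./ 256) → 0# ≤ ρ → δ * ρ ≈ 1# → σ ≤ fromℚ (+ 1 ℚ./ 16) →
          (2 ℕ.≤ N → Sparse δ ρ) →
          ∀ ks → Unique ks → All (λ k → k ≢ 0ℤ × fromℕ ℤ.∣ k ∣ ≤ δ * σ * fromℕ N) ks →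
          sumᴸ ks (λ k → power (λ n → fromℤ k * x n)) ≤ fromℕ 82 * δ * (fromℕ N * fromℕ N)
        power-sum-bound 0≤δ δ≤ 0≤ρ δρ≈1 σ≤ sparse [] unique low = *-nonNeg (*-nonNeg (fromℕ-nonNeg 82) 0≤δ) (square-nonNeg (fromℕ N))
        power-sum-bound {δ} {ρ} {σ} 0≤δ δ≤ 0≤ρ δρ≈1 σ≤ sparse (k₀ ∷ ks′) unique low = ≤-trans
          (≤-respˡ (*-identityʳ _) (*-monoˡ-≤ (sumᴸ-nonNeg ks) (proj₂ (proj₂ (proj₂ scale)))))
          (≤-by (*-nonNeg (*-nonNeg (fromℕ-nonNeg 2) 0≤δ) (x≤y⇒0≤y-x large))
            (solve 4 (λ d e S n → S :* (con (+ 2 ℚ./ 1) :* (d :* e)) :+ (con (+ 2 ℚ./ 1) :* e) :* (con (+ 41 ℚ./ 1) :* (n :* n) :- d :* S)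
              := con (+ 82 ℚ./ 1) :* e :* (n :* n)) refl (fromℕ D) δ (Σ ks) (fromℕ N)))
          where
          ks = k₀ ∷ ks′
          Σ : List ℤ → Carrier
          Σ ls = sumᴸ ls (λ k → power (λ n → fromℤ k * x n))
          sumᴸ-nonNeg : ∀ ls → 0# ≤ Σ ls
          sumᴸ-nonNeg []       = ≤-refl
          sumᴸ-nonNeg (l ∷ ls) = +-nonNeg (power-nonNeg (λ n → fromℤ l * x n)) (sumᴸ-nonNeg ls)
          scale = natural-scale 0≤δ δ≤ 0≤ρ δρ≈1
          D = proj₁ scale
          1≤D = proj₁ (proj₂ scale)
          D+2≤ρ = proj₁ (proj₂ (proj₂ scale))
          -- The mesh may depend on the list, since no final constant involves it. The summand 32
          -- gives τ ≤ 1/16; the other one keeps the rounding error of all frequencies together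
          -- below N².
          H = 32 ℕ.+ 1024 ℕ.* (D ℕ.* length ks)
          instance
            NH≢0 : NonZero (N ℕ.* H)
            NH≢0 = ℕₚ.m*n≢0 N H
          lows : All (λ k → 16 ℕ.* (D ℕ.* ℤ.∣ k ∣) ℕ.≤ N) ks
          lows = All.map (λ {k} (_ , h) → low-frequency {σ = σ} {D = D} 0≤δ δρ≈1 D+2≤ρ σ≤ k h) low
          ≢0⇒1≤∣∣ : ∀ k → k ≢ 0ℤ → 1 ℕ.≤ ℤ.∣ k ∣
          ≢0⇒1≤∣∣ k k≢0 = ℕₚ.n≢0⇒n>0 λ e → k≢0 (ℤₚ.∣i∣≡0⇒i≡0 e)
          16D≤N : 16 ℕ.* D ℕ.≤ N
          16D≤N = ℕₚ.≤-trans (ℕₚ.*-monoʳ-≤ 16 (ℕₚ.≤-trans (ℕₚ.≤-reflexive (≡.sym (ℕₚ.*-identityʳ D)))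
            (ℕₚ.*-monoʳ-≤ D (≢0⇒1≤∣∣ k₀ (proj₁ (All.head low)))))) (All.head lows)
          2D≤N : 2 ℕ.* D ℕ.≤ N
          2D≤N = ℕₚ.≤-trans (ℕₚ.*-monoˡ-≤ D {2} {16} (s≤s (s≤s z≤n))) 16D≤N
          2≤N : 2 ℕ.≤ N
          2≤N = ℕₚ.≤-trans (ℕₚ.*-monoʳ-≤ 2 1≤D) 2D≤N
          approximation : ∀ n → ∃[ z ] ∣ x n * fromℕ (N ℕ.* H) - fromℤ z ∣≤ fromℕ 2
          approximation n = let z , u , l = integerPart (x n * fromℕ (N ℕ.* H)) in z ,
            ≤-by (x≤y⇒0≤y-x l) (solve 2 (λ y z → (:- con (+ 2 ℚ./ 1)) :+ (y :+ con (+ 2 ℚ./ 1) :- z) := y :- z) refl _ _) ,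
            ≤-by (x≤y⇒0≤y-x u) (solve 2 (λ y z → (y :- z) :+ (z :+ con (+ 2 ℚ./ 1) :- y) := con (+ 2 ℚ./ 1)) refl _ _)
          X : Fin N → ℤ
          X n = proj₁ (approximation n)
          fine : 1024 ℕ.* (D ℕ.* length ks) ℕ.≤ H ℕ.* H
          fine = ℕₚ.≤-trans (ℕₚ.m≤n+m _ 32) (ℕₚ.m≤m*n H H)
          large : fromℕ D * Σ ks ≤ fromℕ 41 * (fromℕ N * fromℕ N)
          large = ExponentialSums.power-sum≤ 𝔸 𝕋 N D H X 1≤D (ℕₚ.m≤m+n 32 _) 2D≤N
            (Windows.window-sparse H (s≤s (s≤s z≤n)) X (λ n → proj₂ (approximation n)) 0≤δ δρ≈1 D+2≤ρ 2D≤N (sparse 2≤N))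
            ks (All.map (λ (k≢0 , _) 0≡k → k≢0 (≡.sym 0≡k)) low ∷ unique) lows fine x (λ n → proj₂ (approximation n))

        -- Interface to the concrete sum: `F` is the squared modulus, `C` and `S` are the real and
        -- imaginary parts, and `a` and `b` are their summands.
        exponential-sum-bound : ∀ {δ ρ σ} → 0# ≤ δ → δ ≤ fromℚ (+ 1 ℚ./ 256) → 0# ≤ ρ → δ * ρ ≈ 1# → σ ≤ fromℚ (+ 1 ℚ./ 16) →
          (2 ℕ.≤ N → Sparse δ ρ) →
          (F C S : ℤ → Carrier) (a b : ℤ → Fin N → Carrier) → (∀ k → F k ≤ C k * C k + S k * S k) →
          (∀ k → C k ≈ sum (a k)) → (∀ k → S k ≈ sum (b k)) →
          (∀ k n → a k n ≈ cos (fromℕ 2 * π * (fromℤ k * x n))) → (∀ k n → b k n ≈ sin (fromℕ 2 * π * (fromℤ k * x n))) →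
          ∀ ks → Unique ks → All (λ k → k ≢ 0ℤ × fromℕ ℤ.∣ k ∣ ≤ δ * σ * fromℕ N) ks →
          sumᴸ ks F ≤ fromℕ 82 * δ * (fromℕ N * fromℕ N)
        exponential-sum-bound 0≤δ δ≤ 0≤ρ δρ≈1 σ≤ sparse F C S a b F≤ C≈ S≈ a≈ b≈ ks unique low = ≤-trans
          (sumᴸ-mono ks (All.tabulate λ {k} _ → ≤-respʳ (+-cong (*-cong (C≈′ k) (C≈′ k)) (*-cong (S≈′ k) (S≈′ k))) (F≤ k)))
          (power-sum-bound 0≤δ δ≤ 0≤ρ δρ≈1 σ≤ sparse ks unique low)
          where
          C≈′ : ∀ k → C k ≈ sum (λ n → c (fromℤ k * x n))
          C≈′ k = trans (C≈ k) (sum-cong-≋ {N} (a≈ k))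
          S≈′ : ∀ k → S k ≈ sum (λ n → s (fromℤ k * x n))
          S≈′ k = trans (S≈ k) (sum-cong-≋ {N} (b≈ k))

-- The Cauchy reals as an ordered algebra.

module Real where

  open import Defs
  private module F = RationalFacts
  open ≡ using (refl; sym; trans; cong; cong₂; subst; subst₂)
  open Ordered

  Eventually : (ℕ → Set) → Set
  Eventually P = ∃[ N ] (∀ n → N ℕ.≤ n → P n)

  always : ∀ {P : ℕ → Set} → (∀ n → P n) → Eventually P
  always h = 0 , λ n _ → h n

  eventually-map : ∀ {P Q : ℕ → Set} → (∀ n → P n → Q n) → Eventually P → Eventually Q
  eventually-map f (N , h) = N , λ n le → f n (h n le)

  infixr 5 _∧ᵉ_
  _∧ᵉ_ : ∀ {P Q : ℕ → Set} → Eventually P → Eventually Q → Eventually (λ n → P n × Q n)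
  (M , g) ∧ᵉ (N , h) = M ℕ.+ N , λ n le →
    g n (ℕₚ.≤-trans (ℕₚ.m≤m+n M N) le) , h n (ℕₚ.≤-trans (ℕₚ.m≤n+m N M) le)

  eventually-witness : ∀ {P : ℕ → Set} → Eventually P → ∃[ n ] P n
  eventually-witness (N , h) = N , h N ℕₚ.≤-refl

  ∣-∣≤⇒≤+ : ∀ p q {r} → ℚ.∣ p ℚ.- q ∣ ℚ.≤ r → p ℚ.≤ q ℚ.+ r
  ∣-∣≤⇒≤+ p q {r} h = F.≤-by (F.diff≥0 (ℚₚ.≤-trans (F.≤∣∣ (p ℚ.- q)) h))
    (solve 3 (λ p q r → p :+ (r :- (p :- q)) := q :+ r) refl p q r)
    where open ℚ-Solver.+-*-Solver

  ≤+⇒∣-∣≤ : ∀ p q {r} → p ℚ.≤ q ℚ.+ r → q ℚ.≤ p ℚ.+ r → ℚ.∣ p ℚ.- q ∣ ℚ.≤ r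
  ≤+⇒∣-∣≤ p q {r} g h = F.∣∣≤
    (F.≤-by (F.diff≥0 g) (solve 3 (λ p q r → (p :- q) :+ (q :+ r :- p) := r) refl p q r))
    (F.≤-by (F.diff≥0 h) (solve 3 (λ p q r → :- (p :- q) :+ (p :+ r :- q) := r) refl p q r))
    where open ℚ-Solver.+-*-Solver

  cauchy-≤ : ∀ x ε → 0ℚ ℚ.< ε → ∃[ N ] (∀ m n → N ℕ.≤ m → N ℕ.≤ n → seq x m ℚ.≤ seq x n ℚ.+ ε)
  cauchy-≤ x ε 0<ε = proj₁ (cauchy x ε 0<ε) , λ m n M N →
    ∣-∣≤⇒≤+ (seq x m) (seq x n) (ℚₚ.<⇒≤ (proj₂ (cauchy x ε 0<ε) m n M N))

  bounded : ∀ x → ∃[ B ] (1ℚ ℚ.≤ B) × Eventually (λ n → ℚ.∣ seq x n ∣ ℚ.≤ B)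
  bounded x = F.eventual-bound {seq x} (cauchy x)

  ≤-intro : ∀ x y → (∀ ε → 0ℚ ℚ.< ε → Eventually (λ n → seq x n ℚ.≤ seq y n ℚ.+ ε)) → x ≤ y
  ≤-intro x y h (ε , 0<ε , N , gap) =
    let n , (le , le′) = eventually-witness ((N , gap) ∧ᵉ h (ε ℚ.* ½) (F.0<half 0<ε))
    in contradiction (ℚₚ.<-≤-trans
         (F.<-by (F.0<half 0<ε) (solve 2 (λ y e → (y :+ e :* con ½) :+ e :* con ½ := y :+ e) refl (seq y n) ε))
         (ℚₚ.≤-trans le le′)) (ℚₚ.<-irrefl refl)
    where open ℚ-Solver.+-*-Solver

  -- It suffices to compare rationals at one index M beyond the Cauchy moduli for ε/8. If x_M ≤ y_M
  -- + ε/2, the bound persists with ε at all later indices; otherwise y_n + ε/4 ≤ x_n from M on,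
  -- that is, y < x.
  ≤-elim : ∀ x y → x ≤ y → ∀ ε → 0ℚ ℚ.< ε → Eventually (λ n → seq x n ℚ.≤ seq y n ℚ.+ ε)
  ≤-elim x y x≤y ε 0<ε = go (ℚₚ.≤-total (seq x M) (seq y M ℚ.+ ε ℚ.* ½))
    where
    open ℚ-Solver.+-*-Solver
    η = ε ℚ.* ½ ℚ.* ½ ℚ.* ½
    0<η = F.0<half (F.0<half (F.0<half 0<ε))
    A = proj₁ (cauchy-≤ x η 0<η)
    a = proj₂ (cauchy-≤ x η 0<η)
    B = proj₁ (cauchy-≤ y η 0<η)
    b = proj₂ (cauchy-≤ y η 0<η)
    M = A ℕ.+ B
    A≤M = ℕₚ.m≤m+n A B
    B≤M = ℕₚ.m≤n+m B A
    go : (seq x M ℚ.≤ seq y M ℚ.+ ε ℚ.* ½) ⊎ (seq y M ℚ.+ ε ℚ.* ½ ℚ.≤ seq x M) →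
      Eventually (λ n → seq x n ℚ.≤ seq y n ℚ.+ ε)
    go (inj₁ le) = M , λ n M≤n → F.≤-by
      (F.+≥0 (F.diff≥0 le) (F.+≥0 (F.diff≥0 (a n M (ℕₚ.≤-trans A≤M M≤n) A≤M))
        (F.+≥0 (F.diff≥0 (b M n B≤M (ℕₚ.≤-trans B≤M M≤n))) (ℚₚ.<⇒≤ (F.0<half (F.0<half 0<ε))))))
      (solve 5 (λ xn yn xM yM e → xn :+ ((yM :+ e :* con ½ :- xM)
          :+ ((xM :+ e :* con ½ :* con ½ :* con ½ :- xn)
          :+ ((yn :+ e :* con ½ :* con ½ :* con ½ :- yM) :+ e :* con ½ :* con ½))) := yn :+ e)
        refl (seq x n) (seq y n) (seq x M) (seq y M) ε)
    go (inj₂ ge) = contradiction (ε ℚ.* ½ ℚ.* ½ , F.0<half (F.0<half 0<ε) , M , λ n M≤n → F.≤-by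
      (F.+≥0 (F.diff≥0 ge) (F.+≥0 (F.diff≥0 (a M n A≤M (ℕₚ.≤-trans A≤M M≤n)))
        (F.diff≥0 (b n M (ℕₚ.≤-trans B≤M M≤n) B≤M))))
      (solve 5 (λ xn yn xM yM e → (yn :+ e :* con ½ :* con ½) :+ ((xM :- (yM :+ e :* con ½))
          :+ ((xn :+ e :* con ½ :* con ½ :* con ½ :- xM)
          :+ (yM :+ e :* con ½ :* con ½ :* con ½ :- yn))) := xn)
        refl (seq x n) (seq y n) (seq x M) (seq y M) ε)) x≤y

  infix 4 _≈_
  _≈_ : ℝ → ℝ → Set
  x ≈ y = (x ≤ y) × (y ≤ x)

  ≈-intro : ∀ x y → (∀ ε → 0ℚ ℚ.< ε → Eventually (λ n → ℚ.∣ seq x n ℚ.- seq y n ∣ ℚ.≤ ε)) → x ≈ y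
  ≈-intro x y h =
    ≤-intro x y (λ ε 0<ε → eventually-map (λ n → ∣-∣≤⇒≤+ (seq x n) (seq y n)) (h ε 0<ε)) ,
    ≤-intro y x (λ ε 0<ε → eventually-map
      (λ n le → ∣-∣≤⇒≤+ (seq y n) (seq x n) (subst (ℚ._≤ ε) (F.∣∣-sym (seq x n) (seq y n)) le)) (h ε 0<ε))

  ≈-elim : ∀ x y → x ≈ y → ∀ ε → 0ℚ ℚ.< ε → Eventually (λ n → ℚ.∣ seq x n ℚ.- seq y n ∣ ℚ.≤ ε)
  ≈-elim x y (x≤y , y≤x) ε 0<ε = eventually-map (λ n (g , h) → ≤+⇒∣-∣≤ (seq x n) (seq y n) g h)
    (≤-elim x y x≤y ε 0<ε ∧ᵉ ≤-elim y x y≤x ε 0<ε)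

  pointwise-≤ : ∀ x y → (∀ n → seq x n ℚ.≤ seq y n) → x ≤ y
  pointwise-≤ x y h = ≤-intro x y λ ε 0<ε → always λ n →
    ℚₚ.≤-trans (h n) (F.≤-by (ℚₚ.<⇒≤ 0<ε) refl)

  pointwise-≈ : ∀ x y → (∀ n → seq x n ≡ seq y n) → x ≈ y
  pointwise-≈ x y h = pointwise-≤ x y (λ n → ℚₚ.≤-reflexive (h n)) ,
                      pointwise-≤ y x (λ n → ℚₚ.≤-reflexive (sym (h n)))

  <⇒≤ : ∀ x y → x < y → x ≤ y
  <⇒≤ x y (ε , 0<ε , N , h) = ≤-intro x y λ η 0<η → N , λ n N≤n →
    ℚₚ.≤-trans (F.≤-by (ℚₚ.<⇒≤ 0<ε) refl) (ℚₚ.≤-trans (h n N≤n) (F.≤-by (ℚₚ.<⇒≤ 0<η) refl))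

  ≤ℝ-refl : ∀ x → x ≤ x
  ≤ℝ-refl x = pointwise-≤ x x λ n → ℚₚ.≤-refl

  ≤ℝ-trans : ∀ x y z → x ≤ y → y ≤ z → x ≤ z
  ≤ℝ-trans x y z p q = ≤-intro x z λ ε 0<ε → eventually-map
    (λ n (g , h) → ℚₚ.≤-trans g (subst (seq y n ℚ.+ ε ℚ.* ½ ℚ.≤_)
      (solve 2 (λ z e → (z :+ e :* con ½) :+ e :* con ½ := z :+ e) refl (seq z n) ε)
      (ℚₚ.+-monoˡ-≤ (ε ℚ.* ½) h)))
    (≤-elim x y p (ε ℚ.* ½) (F.0<half 0<ε) ∧ᵉ ≤-elim y z q (ε ℚ.* ½) (F.0<half 0<ε))
    where open ℚ-Solver.+-*-Solver

  ≤ℝ-total : ∀ x y → ¬ ¬ ((x ≤ y) ⊎ (y ≤ x))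
  ≤ℝ-total x y k = k (inj₁ λ y<x → k (inj₂ (<⇒≤ y x y<x)))

  +ℝ-monoʳ-≤ : ∀ z x y → x ≤ y → z + x ≤ z + y
  +ℝ-monoʳ-≤ z x y x≤y (ε , 0<ε , N , h) = x≤y (ε , 0<ε , N , λ n N≤n → subst₂ ℚ._≤_
    (solve 3 (λ z y e → :- z :+ (z :+ y :+ e) := y :+ e) refl (seq z n) (seq y n) ε)
    (solve 2 (λ z x → :- z :+ (z :+ x) := x) refl (seq z n) (seq x n))
    (ℚₚ.+-monoʳ-≤ (ℚ.- seq z n) (h n N≤n)))
    where open ℚ-Solver.+-*-Solver

  scale-inv : ∀ {K} (0<K : 0ℚ ℚ.< K) ε → K ℚ.* (ε ℚ.* F.inv 0<K) ≡ ε
  scale-inv {K} 0<K ε = trans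
    (solve 3 (λ k e i → k :* (e :* i) := (k :* i) :* e) refl K ε (F.inv 0<K))
    (trans (cong (ℚ._* ε) (F.inv-inverse 0<K)) (ℚₚ.*-identityˡ ε))
    where open ℚ-Solver.+-*-Solver

  *ℝ-cong : ∀ x x′ y y′ → x ≈ x′ → y ≈ y′ → x * y ≈ x′ * y′
  *ℝ-cong x x′ y y′ x≈x′ y≈y′ = ≈-intro (x * y) (x′ * y′) λ ε 0<ε →
    let η   = ε ℚ.* F.inv 0<K ℚ.* ½
        0<η = F.0<half (F.*>0 0<ε (F.inv>0 0<K))
    in eventually-map (λ n (b , c , d , e) → ℚₚ.≤-trans
         (F.∣*-*∣≤ (seq x n) (seq x′ n) (seq y n) (seq y′ n) 0≤B 0≤C b c)
         (ℚₚ.≤-trans (F.*-monoˡ (ℚₚ.<⇒≤ 0<K) (ℚₚ.+-mono-≤ d e))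
           (ℚₚ.≤-reflexive (trans (cong (K ℚ.*_) (F.halves (ε ℚ.* F.inv 0<K))) (scale-inv 0<K ε)))))
       (evB ∧ᵉ evC ∧ᵉ ≈-elim x x′ x≈x′ η 0<η ∧ᵉ ≈-elim y y′ y≈y′ η 0<η)
    where
    B   = proj₁ (bounded x)
    1≤B = proj₁ (proj₂ (bounded x))
    evB = proj₂ (proj₂ (bounded x))
    C   = proj₁ (bounded y′)
    1≤C = proj₁ (proj₂ (bounded y′))
    evC = proj₂ (proj₂ (bounded y′))
    K = B ℚ.+ C
    0≤B = ℚₚ.≤-trans F.0≤1 1≤B
    0≤C = ℚₚ.≤-trans F.0≤1 1≤C
    0<K : 0ℚ ℚ.< K
    0<K = ℚₚ.<-≤-trans (ℚₚ.<-≤-trans F.0<1 1≤B) (F.≤-by {B} {K} {C} 0≤C refl)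

  -- Eventually -η ≤ x_n and -η ≤ y_n, so (x_n + η)(y_n + η) ≥ 0 gives x_n y_n ≥ -η (B + C) - η².
  -- With η ≤ 1 and (B + C + 1) η ≤ ε this is at least -ε.
  *ℝ-nonNeg : ∀ x y → 0ℝ ≤ x → 0ℝ ≤ y → 0ℝ ≤ x * y
  *ℝ-nonNeg x y 0≤x 0≤y = ≤-intro 0ℝ (x * y) λ ε 0<ε →
    let η   = (ε ℚ.* F.inv 0<K) ℚ.⊓ 1ℚ
        0<η = ⊓-pos (F.*>0 0<ε (F.inv>0 0<K)) F.0<1
        Kη≤ε : K ℚ.* η ℚ.≤ ε
        Kη≤ε = subst (K ℚ.* η ℚ.≤_) (scale-inv 0<K ε)
          (F.*-monoˡ (ℚₚ.<⇒≤ 0<K) (ℚₚ.p⊓q≤p (ε ℚ.* F.inv 0<K) 1ℚ))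
        0≤η = ℚₚ.<⇒≤ 0<η
        η²≤η : 0ℚ ℚ.≤ η ℚ.* (1ℚ ℚ.- η)
        η²≤η = F.*≥0 0≤η (F.diff≥0 (ℚₚ.p⊓q≤q (ε ℚ.* F.inv 0<K) 1ℚ))
    in eventually-map (λ n (b , c , d , e) →
         let xB = F.diff≥0 (ℚₚ.≤-trans (F.≤∣∣ (seq x n)) b)
             yC = F.diff≥0 (ℚₚ.≤-trans (F.≤∣∣ (seq y n)) c)
         in F.≤-by
           (F.+≥0 (F.*≥0 d e) (F.+≥0 (F.*≥0 0≤η xB) (F.+≥0 (F.*≥0 0≤η yC) (F.+≥0 η²≤η (F.diff≥0 Kη≤ε)))))
           (solve 6 (λ x y h B C e → con 0ℚ :+ ((x :+ h) :* (y :+ h)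
              :+ (h :* (B :- x) :+ (h :* (C :- y) :+ (h :* (con 1ℚ :- h) :+ (e :- ((B :+ C) :+ con 1ℚ) :* h)))))
              := x :* y :+ e) refl (seq x n) (seq y n) η B C ε))
       (evB ∧ᵉ evC ∧ᵉ ≤-elim 0ℝ x 0≤x η 0<η ∧ᵉ ≤-elim 0ℝ y 0≤y η 0<η)
    where
    open ℚ-Solver.+-*-Solver
    B   = proj₁ (bounded x)
    1≤B = proj₁ (proj₂ (bounded x))
    evB = proj₂ (proj₂ (bounded x))
    C   = proj₁ (bounded y)
    1≤C = proj₁ (proj₂ (bounded y))
    evC = proj₂ (proj₂ (bounded y))
    K = (B ℚ.+ C) ℚ.+ 1ℚ
    0<K : 0ℚ ℚ.< K
    0<K = ℚₚ.<-≤-trans F.0<1 (F.≤-by (F.+≥0 (ℚₚ.≤-trans F.0≤1 1≤B) (ℚₚ.≤-trans F.0≤1 1≤C)) (ℚₚ.+-comm 1ℚ (B ℚ.+ C)))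
    ⊓-pos : ∀ {p q} → 0ℚ ℚ.< p → 0ℚ ℚ.< q → 0ℚ ℚ.< p ℚ.⊓ q
    ⊓-pos {p} {q} 0<p 0<q with ℚₚ.⊓-sel p q
    ... | inj₁ e = subst (0ℚ ℚ.<_) (sym e) 0<p
    ... | inj₂ e = subst (0ℚ ℚ.<_) (sym e) 0<q

  fromℚ-mono : ∀ p q → p ℚ.≤ q → fromℚ p ≤ fromℚ q
  fromℚ-mono p q h = pointwise-≤ (fromℚ p) (fromℚ q) λ _ → h

  fromℚ-cancel : ∀ p q → fromℚ p ≤ fromℚ q → p ℚ.≤ q
  fromℚ-cancel p q h with p ℚₚ.≤? q
  ... | yes p≤q = p≤q
  ... | no  p≰q = contradiction
    (p ℚ.- q , F.diff>0 (ℚₚ.≰⇒> p≰q) , 0 , λ _ _ → ℚₚ.≤-reflexive (solve 2 (λ p q → q :+ (p :- q) := p) refl p q)) h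
    where open ℚ-Solver.+-*-Solver

  ℝ-isCommutativeRing : IsCommutativeRing _≈_ _+_ _*_ -_ (fromℚ 0ℚ) (fromℚ 1ℚ)
  ℝ-isCommutativeRing = record
    { isRing = record
      { +-isAbelianGroup = record
        { isGroup = record
          { isMonoid = record
            { isSemigroup = record
              { isMagma = record
                { isEquivalence = record
                  { refl  = λ {x} → ≤ℝ-refl x , ≤ℝ-refl x
                  ; sym   = λ (p , q) → q , p
                  ; trans = λ {x} {y} {z} (p , q) (p′ , q′) → ≤ℝ-trans x y z p p′ , ≤ℝ-trans z y x q′ q
                  }
                ; ∙-cong = λ {x} {x′} {y} {y′} (p , q) (p′ , q′) →
                    +-mono x x′ y y′ p p′ , +-mono x′ x y′ y q q′
                }
              ; assoc = λ x y z → pointwise-≈ (x + y + z) (x + (y + z)) λ n → ℚₚ.+-assoc (seq x n) (seq y n) (seq z n)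
              }
            ; identity = (λ x → pointwise-≈ (fromℚ 0ℚ + x) x λ n → ℚₚ.+-identityˡ (seq x n))
                       , (λ x → pointwise-≈ (x + fromℚ 0ℚ) x λ n → ℚₚ.+-identityʳ (seq x n))
            }
          ; inverse = (λ x → pointwise-≈ (- x + x) (fromℚ 0ℚ) λ n → ℚₚ.+-inverseˡ (seq x n))
                    , (λ x → pointwise-≈ (x + - x) (fromℚ 0ℚ) λ n → ℚₚ.+-inverseʳ (seq x n))
          ; ⁻¹-cong = λ {x} {y} (p , q) → neg-mono x y q , neg-mono y x p
          }
        ; comm = λ x y → pointwise-≈ (x + y) (y + x) λ n → ℚₚ.+-comm (seq x n) (seq y n)
        }
      ; *-cong = λ {x} {x′} {y} {y′} → *ℝ-cong x x′ y y′
      ; *-assoc = λ x y z → pointwise-≈ (x * y * z) (x * (y * z)) λ n → ℚₚ.*-assoc (seq x n) (seq y n) (seq z n)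
      ; *-identity = (λ x → pointwise-≈ (fromℚ 1ℚ * x) x λ n → ℚₚ.*-identityˡ (seq x n))
                   , (λ x → pointwise-≈ (x * fromℚ 1ℚ) x λ n → ℚₚ.*-identityʳ (seq x n))
      ; distrib = (λ x y z → pointwise-≈ (x * (y + z)) (x * y + x * z) λ n → ℚₚ.*-distribˡ-+ (seq x n) (seq y n) (seq z n))
                , (λ x y z → pointwise-≈ ((y + z) * x) (y * x + z * x) λ n → ℚₚ.*-distribʳ-+ (seq x n) (seq y n) (seq z n))
      }
    ; *-comm = λ x y → pointwise-≈ (x * y) (y * x) λ n → ℚₚ.*-comm (seq x n) (seq y n)
    }
    where
    open ℚ-Solver.+-*-Solver
    +-mono : ∀ x x′ y y′ → x ≤ x′ → y ≤ y′ → x + y ≤ x′ + y′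
    +-mono x x′ y y′ p q = ≤ℝ-trans (x + y) (x + y′) (x′ + y′) (+ℝ-monoʳ-≤ x y y′ q)
      (≤ℝ-trans (x + y′) (y′ + x) (x′ + y′) (pointwise-≤ (x + y′) (y′ + x) λ n → ℚₚ.≤-reflexive (ℚₚ.+-comm (seq x n) (seq y′ n)))
        (≤ℝ-trans (y′ + x) (y′ + x′) (x′ + y′) (+ℝ-monoʳ-≤ y′ x x′ p)
          (pointwise-≤ (y′ + x′) (x′ + y′) λ n → ℚₚ.≤-reflexive (ℚₚ.+-comm (seq y′ n) (seq x′ n)))))
    neg-mono : ∀ x y → y ≤ x → - x ≤ - y
    neg-mono x y y≤x (ε , 0<ε , N , h) = y≤x (ε , 0<ε , N , λ n N≤n → F.≤-by (F.diff≥0 (h n N≤n))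
      (solve 3 (λ x y e → (x :+ e) :+ (:- x :- (:- y :+ e)) := y) refl (seq x n) (seq y n) ε))

  ℝ-orderedAlgebra : OrderedAlgebra
  ℝ-orderedAlgebra = record
    { Carrier = ℝ ; _≈_ = _≈_ ; _≤_ = _≤_ ; _+_ = _+_ ; _*_ = _*_ ; -_ = -_ ; fromℚ = fromℚ
    ; isCommutativeRing = ℝ-isCommutativeRing
    ; fromℚ-+      = λ p q → pointwise-≈ (fromℚ (p ℚ.+ q)) (fromℚ p + fromℚ q) λ _ → refl
    ; fromℚ-*      = λ p q → pointwise-≈ (fromℚ (p ℚ.* q)) (fromℚ p * fromℚ q) λ _ → refl
    ; fromℚ-neg    = λ p → pointwise-≈ (fromℚ (ℚ.- p)) (- fromℚ p) λ _ → refl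
    ; fromℚ-mono   = λ {p} {q} → fromℚ-mono p q
    ; fromℚ-cancel = λ {p} {q} → fromℚ-cancel p q
    ; ≤-reflexive  = proj₁
    ; ≤-trans      = λ {x} {y} {z} → ≤ℝ-trans x y z
    ; ≤-antisym    = _,_
    ; +-monoʳ-≤    = λ z {x} {y} → +ℝ-monoʳ-≤ z x y
    ; *-nonNeg     = λ {x} {y} → *ℝ-nonNeg x y
    ; ≤-stable     = λ ¬¬p y<x → ¬¬p λ p → p y<x
    ; ≤-total      = ≤ℝ-total
    }

-- Rational partial sums of exp, cos and sin.

module Series where

  open import Data.Nat using (_∸_)
  open import Data.Rational using (_+_; _*_; -_; _-_; _≤_; _<_; ∣_∣)
  open ℚₚ
  open RationalFacts hiding (_≤ₙ_)
  open ℚ-Solver.+-*-Solver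
  open ≡ using (refl; sym; trans; cong; cong₂; subst; subst₂)

  Σ-cong : ∀ {f g : ℕ → ℚ} n → (∀ j → j ℕ.< n → f j ≡ g j) → Σ[j< n ] f ≡ Σ[j< n ] g
  Σ-cong zero    h = refl
  Σ-cong (suc n) h = cong₂ _+_ (Σ-cong n λ j j<n → h j (ℕₚ.m<n⇒m<1+n j<n)) (h n ℕₚ.≤-refl)

  Σ-+ : ∀ n f g → Σ[j< n ] (λ j → f j + g j) ≡ Σ[j< n ] f + Σ[j< n ] g
  Σ-+ zero    f g = refl
  Σ-+ (suc n) f g = trans (cong (_+ (f n + g n)) (Σ-+ n f g))
    (solve 4 (λ F G a b → (F :+ G) :+ (a :+ b) := (F :+ a) :+ (G :+ b)) refl (Σ[j< n ] f) (Σ[j< n ] g) (f n) (g n))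

  Σ-*ˡ : ∀ n c f → Σ[j< n ] (λ j → c * f j) ≡ c * Σ[j< n ] f
  Σ-*ˡ zero    c f = sym (*-zeroʳ c)
  Σ-*ˡ (suc n) c f = trans (cong (_+ c * f n) (Σ-*ˡ n c f)) (sym (*-distribˡ-+ c _ _))

  Σ-sub : ∀ n f g → Σ[j< n ] (λ j → f j - g j) ≡ Σ[j< n ] f - Σ[j< n ] g
  Σ-sub zero    f g = refl
  Σ-sub (suc n) f g = trans (cong (_+ (f n - g n)) (Σ-sub n f g))
    (solve 4 (λ F G a b → (F :- G) :+ (a :- b) := (F :+ a) :- (G :+ b)) refl (Σ[j< n ] f) (Σ[j< n ] g) (f n) (g n))

  Σ-head : ∀ n f → Σ[j< suc n ] f ≡ f 0 + Σ[j< n ] (f ∘ suc)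
  Σ-head zero    f = +-comm 0ℚ (f 0)
  Σ-head (suc n) f = trans (cong (_+ f (suc n)) (Σ-head n f)) (+-assoc (f 0) _ _)

  Σ-product : ∀ m n f g → Σ[j< m ] f * Σ[j< n ] g ≡ Σ[j< m ] (λ j → Σ[j< n ] (λ l → f j * g l))
  Σ-product zero    n f g = *-zeroˡ (Σ[j< n ] g)
  Σ-product (suc m) n f g = trans (*-distribʳ-+ (Σ[j< n ] g) (Σ[j< m ] f) (f m))
    (cong₂ _+_ (Σ-product m n f g) (sym (Σ-*ˡ n (f m) g)))

  -- Both sides sum h over the triangle j + l < n, by antidiagonals and by rows.
  Σ-triangle : ∀ n (h : ℕ → ℕ → ℚ) →
    Σ[j< n ] (λ k → Σ[j< suc k ] (λ j → h j (k ∸ j))) ≡ Σ[j< n ] (λ j → Σ[j< n ∸ j ] (h j))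
  Σ-triangle zero    h = refl
  Σ-triangle (suc n) h = begin
    Σ[j< n ] (λ k → Σ[j< suc k ] (λ j → h j (k ∸ j))) + (D + h n (n ∸ n))
      ≡⟨ cong (_+ (D + h n (n ∸ n))) (Σ-triangle n h) ⟩
    T + (D + h n (n ∸ n))
      ≡⟨ +-assoc T D (h n (n ∸ n)) ⟨
    (T + D) + h n (n ∸ n)
      ≡⟨ cong₂ _+_ (trans (sym (Σ-+ n (λ j → Σ[j< n ∸ j ] (h j)) (λ j → h j (n ∸ j))))
           (Σ-cong n λ j j<n → cong (λ i → Σ[j< i ] (h j)) (sym (ℕₚ.+-∸-assoc 1 (ℕₚ.<⇒≤ j<n)))))
           (last-row (ℕₚ.n∸n≡0 n)) ⟩
    Σ[j< n ] (λ j → Σ[j< suc n ∸ j ] (h j)) + Σ[j< suc n ∸ n ] (h n) ∎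
    where
    open ≡.≡-Reasoning
    D = Σ[j< n ] (λ j → h j (n ∸ j))
    T = Σ[j< n ] (λ j → Σ[j< n ∸ j ] (h j))
    last-row : n ∸ n ≡ 0 → h n (n ∸ n) ≡ Σ[j< suc n ∸ n ] (h n)
    last-row e = trans (cong (h n) e) (trans (sym (+-identityˡ (h n 0)))
      (cong (λ i → Σ[j< i ] (h n)) (sym (trans (ℕₚ.+-∸-assoc 1 (ℕₚ.≤-refl {n})) (cong suc e)))))

  Σ-mono : ∀ {f g : ℕ → ℚ} n → (∀ j → j ℕ.< n → f j ≤ g j) → Σ[j< n ] f ≤ Σ[j< n ] g
  Σ-mono zero    h = ≤-refl
  Σ-mono (suc n) h = +-mono-≤ (Σ-mono n λ j j<n → h j (ℕₚ.m<n⇒m<1+n j<n)) (h n ℕₚ.≤-refl)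

  Σ-extend : ∀ {f : ℕ → ℚ} → (∀ j → 0ℚ ≤ f j) → ∀ m k → Σ[j< m ] f ≤ Σ[j< k ℕ.+ m ] f
  Σ-extend f≥0 m zero    = ≤-refl
  Σ-extend {f} f≥0 m (suc k) = ≤-trans (Σ-extend f≥0 m k) (≤-by (f≥0 (k ℕ.+ m)) refl)

  Σ-extend-≤ : ∀ {f : ℕ → ℚ} → (∀ j → 0ℚ ≤ f j) → ∀ {m n} → m ℕ.≤ n → Σ[j< m ] f ≤ Σ[j< n ] f
  Σ-extend-≤ {f} f≥0 {m} {n} m≤n =
    subst (λ i → Σ[j< m ] f ≤ Σ[j< i ] f) (ℕₚ.m∸n+n≡m m≤n) (Σ-extend f≥0 m (n ∸ m))

  ∣+-+∣≤ : ∀ a b c d {u v} → ∣ a - c ∣ ≤ u → ∣ b - d ∣ ≤ v → ∣ (a + b) - (c + d) ∣ ≤ u + v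
  ∣+-+∣≤ a b c d {u} {v} p q = subst (λ t → ∣ t ∣ ≤ u + v)
    (solve 4 (λ a b c d → (a :- c) :+ (b :- d) := (a :+ b) :- (c :+ d)) refl a b c d)
    (≤-trans (∣p+q∣≤∣p∣+∣q∣ (a - c) (b - d)) (+-mono-≤ p q))

  Σ-tail-dominated : ∀ {f g : ℕ → ℚ} → (∀ j → ∣ f j ∣ ≤ g j) → ∀ m k →
    ∣ Σ[j< k ℕ.+ m ] f - Σ[j< m ] f ∣ ≤ Σ[j< k ℕ.+ m ] g - Σ[j< m ] g
  Σ-tail-dominated {f} {g} h m zero = subst₂ _≤_
    (cong ∣_∣ (sym (+-inverseʳ (Σ[j< m ] f)))) (sym (+-inverseʳ (Σ[j< m ] g))) ≤-refl
  Σ-tail-dominated {f} {g} h m (suc k) = subst₂ _≤_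
    (cong ∣_∣ (solve 3 (λ a b c → (a :+ b) :- (c :+ con 0ℚ) := (a :+ b) :- c) refl (Σ[j< k ℕ.+ m ] f) (f (k ℕ.+ m)) (Σ[j< m ] f)))
    (solve 3 (λ a b c → (a :- c) :+ b := (a :+ b) :- c) refl (Σ[j< k ℕ.+ m ] g) (g (k ℕ.+ m)) (Σ[j< m ] g))
    (∣+-+∣≤ (Σ[j< k ℕ.+ m ] f) (f (k ℕ.+ m)) (Σ[j< m ] f) 0ℚ (Σ-tail-dominated h m k)
      (subst (λ t → ∣ t ∣ ≤ g (k ℕ.+ m)) (sym (+-identityʳ (f (k ℕ.+ m)))) (h (k ℕ.+ m))))

  Σ-tail-dominated-≤ : ∀ {f g : ℕ → ℚ} → (∀ j → ∣ f j ∣ ≤ g j) → ∀ {m n} → m ℕ.≤ n →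
    ∣ Σ[j< n ] f - Σ[j< m ] f ∣ ≤ Σ[j< n ] g - Σ[j< m ] g
  Σ-tail-dominated-≤ {f} {g} h {m} {n} m≤n =
    subst (λ i → ∣ Σ[j< i ] f - Σ[j< m ] f ∣ ≤ Σ[j< i ] g - Σ[j< m ] g) (ℕₚ.m∸n+n≡m m≤n)
      (Σ-tail-dominated h m (n ∸ m))

  Σ-difference-dominated : ∀ n (f f′ g g′ : ℕ → ℚ) → (∀ j → ∣ f j - f′ j ∣ ≤ g j - g′ j) →
    ∣ Σ[j< n ] f - Σ[j< n ] f′ ∣ ≤ Σ[j< n ] g - Σ[j< n ] g′
  Σ-difference-dominated zero    f f′ g g′ h = ≤-refl
  Σ-difference-dominated (suc n) f f′ g g′ h = subst (∣ Σ[j< suc n ] f - Σ[j< suc n ] f′ ∣ ≤_)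
    (solve 4 (λ a b c d → (a :- c) :+ (b :- d) := (a :+ b) :- (c :+ d)) refl (Σ[j< n ] g) (g n) (Σ[j< n ] g′) (g′ n))
    (∣+-+∣≤ (Σ[j< n ] f) (f n) (Σ[j< n ] f′) (f′ n) (Σ-difference-dominated n f f′ g g′ h) (h n))

  dividedPower : ℚ → ℕ → ℚ
  dividedPower x j = x ^ j * 1/! j

  dividedPower≥0 : ∀ {x} → 0ℚ ≤ x → ∀ j → 0ℚ ≤ dividedPower x j
  dividedPower≥0 0≤x j = *≥0 (^≥0 0≤x j) (<⇒≤ (1/!>0 j))

  ∣dividedPower∣≤ : ∀ {x y} → ∣ x ∣ ≤ y → ∀ j → ∣ dividedPower x j ∣ ≤ dividedPower y j
  ∣dividedPower∣≤ {x} {y} x≤y j = subst (_≤ dividedPower y j) (sym (trans (∣p*q∣≡∣p∣*∣q∣ (x ^ j) (1/! j))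
      (cong (∣ x ^ j ∣ *_) (0≤p⇒∣p∣≡p (<⇒≤ (1/!>0 j))))))
    (*-monoʳ (<⇒≤ (1/!>0 j)) (∣^∣≤ x≤y j))

  suc*dividedPower : ∀ x j → fromℕ (suc j) * dividedPower x (suc j) ≡ x * dividedPower x j
  suc*dividedPower x j = trans
    (solve 5 (λ s x p i f → s :* ((x :* p) :* (i :* f)) := (s :* i) :* (x :* (p :* f))) refl
      (fromℕ (suc j)) x (x ^ j) (1/suc j) (1/! j))
    (trans (cong (_* (x * dividedPower x j)) (suc*1/suc j)) (*-identityˡ _))

  convolution : (a b : ℕ → ℚ) → ℕ → ℚ
  convolution a b k = Σ[j< suc k ] (λ j → a j * b (k ∸ j))

  fromℕ-+ : ∀ m n → fromℕ (m ℕ.+ n) ≡ fromℕ m + fromℕ n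
  fromℕ-+ zero    n = sym (+-identityˡ (fromℕ n))
  fromℕ-+ (suc m) n = trans (fromℕ-suc (m ℕ.+ n)) (trans (cong (_+_ 1ℚ) (fromℕ-+ m n))
    (trans (sym (+-assoc 1ℚ (fromℕ m) (fromℕ n))) (cong (_+ fromℕ n) (sym (fromℕ-suc m)))))

  module _ (x y : ℚ) where
    private
      a = dividedPower x
      b = dividedPower y

    -- The Leibniz rule on coefficients: k + 1 splits as j + (k + 1 - j), and each part lowers the
    -- index of its own factor.
    suc*convolution : ∀ k → fromℕ (suc k) * convolution a b (suc k) ≡ (x + y) * convolution a b k
    suc*convolution k = begin
      fromℕ (suc k) * convolution a b (suc k)
        ≡⟨ Σ-*ˡ (2 ℕ.+ k) (fromℕ (suc k)) (λ j → a j * b (suc k ∸ j)) ⟨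
      Σ[j< 2 ℕ.+ k ] (λ j → fromℕ (suc k) * (a j * b (suc k ∸ j)))
        ≡⟨ Σ-cong (2 ℕ.+ k) (λ j j<k → split j (ℕ.s≤s⁻¹ j<k)) ⟩
      Σ[j< 2 ℕ.+ k ] (λ j → L j + R j)
        ≡⟨ Σ-+ (2 ℕ.+ k) L R ⟩
      Σ[j< 2 ℕ.+ k ] L + Σ[j< 2 ℕ.+ k ] R
        ≡⟨ cong₂ _+_ left right ⟩
      x * convolution a b k + y * convolution a b k
        ≡⟨ *-distribʳ-+ (convolution a b k) x y ⟨
      (x + y) * convolution a b k ∎
      where
      open ≡.≡-Reasoning
      L R : ℕ → ℚ
      L j = (fromℕ j * a j) * b (suc k ∸ j)
      R j = a j * (fromℕ (suc k ∸ j) * b (suc k ∸ j))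
      split : ∀ j → j ℕ.≤ suc k → fromℕ (suc k) * (a j * b (suc k ∸ j)) ≡ L j + R j
      split j j≤ = trans (cong (_* (a j * b (suc k ∸ j))) (trans (cong fromℕ (sym (ℕₚ.m+[n∸m]≡n j≤))) (fromℕ-+ j (suc k ∸ j))))
        (solve 4 (λ m n a b → (m :+ n) :* (a :* b) := (m :* a) :* b :+ a :* (n :* b)) refl
          (fromℕ j) (fromℕ (suc k ∸ j)) (a j) (b (suc k ∸ j)))
      left : Σ[j< 2 ℕ.+ k ] L ≡ x * convolution a b k
      left = begin
        Σ[j< 2 ℕ.+ k ] L                      ≡⟨ Σ-head (suc k) L ⟩
        L 0 + Σ[j< suc k ] (L ∘ suc)          ≡⟨ cong (_+ Σ[j< suc k ] (L ∘ suc)) (trans (cong (_* b (suc k)) (*-zeroˡ (a 0))) (*-zeroˡ (b (suc k)))) ⟩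
        0ℚ + Σ[j< suc k ] (L ∘ suc)           ≡⟨ +-identityˡ _ ⟩
        Σ[j< suc k ] (L ∘ suc)                ≡⟨ Σ-cong (suc k) (λ j _ → trans (cong (_* b (k ∸ j)) (suc*dividedPower x j)) (*-assoc x (a j) (b (k ∸ j)))) ⟩
        Σ[j< suc k ] (λ j → x * (a j * b (k ∸ j))) ≡⟨ Σ-*ˡ (suc k) x _ ⟩
        x * convolution a b k                 ∎
      right : Σ[j< 2 ℕ.+ k ] R ≡ y * convolution a b k
      right = begin
        Σ[j< suc k ] R + R (suc k)            ≡⟨ cong (_+_ (Σ[j< suc k ] R)) (trans (cong (λ i → a (suc k) * (fromℕ i * b i)) (ℕₚ.n∸n≡0 (suc k)))
                                                   (trans (cong (a (suc k) *_) (*-zeroˡ (b 0))) (*-zeroʳ (a (suc k))))) ⟩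
        Σ[j< suc k ] R + 0ℚ                   ≡⟨ +-identityʳ _ ⟩
        Σ[j< suc k ] R                        ≡⟨ Σ-cong (suc k) (λ j j<k → trans
                                                   (cong (λ i → a j * (fromℕ i * b i)) (ℕₚ.+-∸-assoc 1 (ℕ.s≤s⁻¹ j<k)))
                                                   (trans (cong (a j *_) (suc*dividedPower y (k ∸ j)))
                                                     (solve 3 (λ a y b → a :* (y :* b) := y :* (a :* b)) refl (a j) y (b (k ∸ j))))) ⟩
        Σ[j< suc k ] (λ j → y * (a j * b (k ∸ j))) ≡⟨ Σ-*ˡ (suc k) y _ ⟩
        y * convolution a b k                 ∎

    -- The binomial theorem. Both sides satisfy (k + 1) c_{k+1} = (x + y) c_k with c_0 = 1.
    dividedPower-convolution : ∀ k → convolution a b k ≡ dividedPower (x + y) k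
    dividedPower-convolution zero    = refl
    dividedPower-convolution (suc k) = begin
      c                                     ≡⟨ *-identityˡ c ⟨
      1ℚ * c                                ≡⟨ cong (_* c) (suc*1/suc k) ⟨
      (s * i) * c                           ≡⟨ solve 3 (λ s i c → (s :* i) :* c := i :* (s :* c)) refl s i c ⟩
      i * (s * c)                           ≡⟨ cong (i *_) (suc*convolution k) ⟩
      i * ((x + y) * convolution a b k)     ≡⟨ cong (λ t → i * ((x + y) * t)) (dividedPower-convolution k) ⟩
      i * ((x + y) * ((x + y) ^ k * 1/! k)) ≡⟨ solve 4 (λ i z p f → i :* (z :* (p :* f)) := (z :* p) :* (i :* f)) refl i (x + y) ((x + y) ^ k) (1/! k) ⟩
      dividedPower (x + y) (suc k)          ∎
      where
      open ≡.≡-Reasoning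
      c = convolution a b (suc k)
      s = fromℕ (suc k)
      i = 1/suc k

  -- The double series of the power series at x + y, truncated to a square as the product of two
  -- partial sums produces it.
  mixedProduct : (ℕ → ℚ) → ℚ → ℚ → ℕ → ℚ
  mixedProduct u x y n = Σ[j< n ] (λ j → Σ[j< n ] (λ l → u (j ℕ.+ l) * (dividedPower x j * dividedPower y l)))

  partial-convolution : ∀ u x y n →
    Σ[j< n ] (λ j → Σ[j< n ∸ j ] (λ l → u (j ℕ.+ l) * (dividedPower x j * dividedPower y l))) ≡ partial u (x + y) n
  partial-convolution u x y n = trans (sym (Σ-triangle n h)) (Σ-cong n λ k _ → trans
    (Σ-cong (suc k) λ j j<k → cong (λ i → u i * (dividedPower x j * dividedPower y (k ∸ j))) (ℕₚ.m+[n∸m]≡n (ℕ.s≤s⁻¹ j<k)))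
    (trans (Σ-*ˡ (suc k) (u k) (λ j → dividedPower x j * dividedPower y (k ∸ j)))
      (trans (cong (u k *_) (dividedPower-convolution x y k)) (sym (*-assoc (u k) ((x + y) ^ k) (1/! k))))))
    where
    h : ℕ → ℕ → ℚ
    h j l = u (j ℕ.+ l) * (dividedPower x j * dividedPower y l)

  -- The square [0 , n)² lies between the triangles j + l < n and j + l < 2n.
  mixedProduct-error : ∀ u → (∀ j → ∣ u j ∣ ≤ 1ℚ) → ∀ x y {C} → ∣ x ∣ + ∣ y ∣ ≤ C → ∀ n →
    ∣ mixedProduct u x y n - partial u (x + y) n ∣ ≤ E C (n ℕ.+ n) - E C n
  mixedProduct-error u u≤1 x y {C} C≥ n = begin
    ∣ mixedProduct u x y n - partial u (x + y) n ∣
      ≡⟨ cong (λ z → ∣ mixedProduct u x y n - z ∣) (partial-convolution u x y n) ⟨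
    ∣ mixedProduct u x y n - Σ[j< n ] (λ j → Σ[j< n ∸ j ] (t j)) ∣
      ≤⟨ Σ-difference-dominated n (λ j → Σ[j< n ] (t j)) (λ j → Σ[j< n ∸ j ] (t j)) (λ j → Σ[j< n ] (h j)) (λ j → Σ[j< n ∸ j ] (h j))
           (λ j → Σ-tail-dominated-≤ (λ l → t≤h j l) (ℕₚ.m∸n≤m n j)) ⟩
    Σ[j< n ] (λ j → Σ[j< n ] (h j)) - Σ[j< n ] (λ j → Σ[j< n ∸ j ] (h j))
      ≤⟨ +-mono-≤ square≤triangle (neg-mono (≤-reflexive (sym (triangle n)))) ⟩
    E D (n ℕ.+ n) - E D n
      ≤⟨ ≤∣∣ _ ⟩
    ∣ E D (n ℕ.+ n) - E D n ∣
      ≤⟨ Σ-tail-dominated-≤ (∣dividedPower∣≤ (subst (_≤ C) (sym (0≤p⇒∣p∣≡p D≥0)) C≥)) (ℕₚ.m≤m+n n n) ⟩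
    E C (n ℕ.+ n) - E C n ∎
    where
    open ≤-Reasoning
    D = ∣ x ∣ + ∣ y ∣
    D≥0 : 0ℚ ≤ D
    D≥0 = +≥0 (0≤∣p∣ x) (0≤∣p∣ y)
    t h : ℕ → ℕ → ℚ
    t j l = u (j ℕ.+ l) * (dividedPower x j * dividedPower y l)
    h j l = dividedPower (∣ x ∣) j * dividedPower (∣ y ∣) l
    h≥0 : ∀ j l → 0ℚ ≤ h j l
    h≥0 j l = *≥0 (dividedPower≥0 (0≤∣p∣ x) j) (dividedPower≥0 (0≤∣p∣ y) l)
    t≤h : ∀ j l → ∣ t j l ∣ ≤ h j l
    t≤h j l = subst₂ _≤_
      (sym (trans (∣p*q∣≡∣p∣*∣q∣ (u (j ℕ.+ l)) _) (cong (∣ u (j ℕ.+ l) ∣ *_) (∣p*q∣≡∣p∣*∣q∣ (dividedPower x j) (dividedPower y l)))))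
      (*-identityˡ (h j l))
      (*-mono 0≤1 (*≥0 (0≤∣p∣ (dividedPower x j)) (0≤∣p∣ (dividedPower y l))) (u≤1 (j ℕ.+ l))
        (*-mono (dividedPower≥0 (0≤∣p∣ x) j) (0≤∣p∣ (dividedPower y l))
          (∣dividedPower∣≤ ≤-refl j) (∣dividedPower∣≤ ≤-refl l)))
    triangle : ∀ m → Σ[j< m ] (λ j → Σ[j< m ∸ j ] (h j)) ≡ E D m
    triangle m = trans (sym (Σ-triangle m h)) (Σ-cong m λ k _ → dividedPower-convolution (∣ x ∣) (∣ y ∣) k)
    row≥0 : ∀ k j → 0ℚ ≤ Σ[j< k ] (h j)
    row≥0 k j = Σ-extend-≤ (h≥0 j) (ℕ.z≤n {k})
    square≤triangle : Σ[j< n ] (λ j → Σ[j< n ] (h j)) ≤ E D (n ℕ.+ n)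
    square≤triangle = ≤-trans
      (Σ-mono n λ j j<n → Σ-extend-≤ (h≥0 j) (subst (ℕ._≤ (n ℕ.+ n) ∸ j) (ℕₚ.m+n∸n≡m n n) (ℕₚ.∸-monoʳ-≤ (n ℕ.+ n) (ℕₚ.<⇒≤ j<n))))
      (≤-trans (Σ-extend-≤ (λ j → row≥0 ((n ℕ.+ n) ∸ j) j) (ℕₚ.m≤m+n n n)) (≤-reflexive (triangle (n ℕ.+ n))))

  partial-product : ∀ s t x y n → partial s x n * partial t y n ≡
    Σ[j< n ] (λ j → Σ[j< n ] (λ l → (s j * t l) * (dividedPower x j * dividedPower y l)))
  partial-product s t x y n = trans (Σ-product n n _ _) (Σ-cong n λ j _ → Σ-cong n λ l _ →
    solve 6 (λ s p f t q g → (s :* p :* f) :* (t :* q :* g) := (s :* t) :* ((p :* f) :* (q :* g))) refl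
      (s j) (x ^ j) (1/! j) (t l) (y ^ l) (1/! l))

  cosSign-suc : ∀ j → cosSign (suc j) ≡ - sinSign j
  cosSign-suc zero          = refl
  cosSign-suc (suc zero)    = refl
  cosSign-suc (suc (suc j)) = cong -_ (cosSign-suc j)

  sinSign-suc : ∀ j → sinSign (suc j) ≡ cosSign j
  sinSign-suc zero          = refl
  sinSign-suc (suc zero)    = refl
  sinSign-suc (suc (suc j)) = cong -_ (sinSign-suc j)

  -- `cosSign j` and `sinSign j` are cos (jπ/2) and sin (jπ/2). Their addition formulas, applied
  -- coefficientwise, give those for cos and sin.
  cosSign-+ : ∀ j l → cosSign (j ℕ.+ l) ≡ cosSign j * cosSign l - sinSign j * sinSign l
  cosSign-+ zero l = solve 2 (λ c s → c := con 1ℚ :* c :- con 0ℚ :* s) refl (cosSign l) (sinSign l)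
  cosSign-+ (suc zero) l = trans (cosSign-suc l)
    (solve 2 (λ c s → :- s := con 0ℚ :* c :- con 1ℚ :* s) refl (cosSign l) (sinSign l))
  cosSign-+ (suc (suc j)) l = trans (cong -_ (cosSign-+ j l))
    (solve 4 (λ a b c d → :- (a :* b :- c :* d) := (:- a) :* b :- (:- c) :* d) refl (cosSign j) (cosSign l) (sinSign j) (sinSign l))

  sinSign-+ : ∀ j l → sinSign (j ℕ.+ l) ≡ sinSign j * cosSign l + cosSign j * sinSign l
  sinSign-+ zero l = solve 2 (λ c s → s := con 0ℚ :* c :+ con 1ℚ :* s) refl (cosSign l) (sinSign l)
  sinSign-+ (suc zero) l = trans (sinSign-suc l)
    (solve 2 (λ c s → c := con 1ℚ :* c :+ con 0ℚ :* s) refl (cosSign l) (sinSign l))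
  sinSign-+ (suc (suc j)) l = trans (cong -_ (sinSign-+ j l))
    (solve 4 (λ a b c d → :- (a :* b :+ c :* d) := (:- a) :* b :+ (:- c) :* d) refl (sinSign j) (cosSign l) (cosSign j) (sinSign l))

  cos-product : ∀ x y n → partial cosSign x n * partial cosSign y n - partial sinSign x n * partial sinSign y n
    ≡ mixedProduct cosSign x y n
  cos-product x y n = trans (cong₂ _-_ (partial-product cosSign cosSign x y n) (partial-product sinSign sinSign x y n))
    (trans (sym (Σ-sub n _ _)) (Σ-cong n λ j _ → trans (sym (Σ-sub n _ _)) (Σ-cong n λ l _ → trans
      (solve 5 (λ a b c d m → (a :* b) :* m :- (c :* d) :* m := (a :* b :- c :* d) :* m) refl
        (cosSign j) (cosSign l) (sinSign j) (sinSign l) (dividedPower x j * dividedPower y l))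
      (cong (_* (dividedPower x j * dividedPower y l)) (sym (cosSign-+ j l))))))

  sin-product : ∀ x y n → partial sinSign x n * partial cosSign y n + partial cosSign x n * partial sinSign y n
    ≡ mixedProduct sinSign x y n
  sin-product x y n = trans (cong₂ _+_ (partial-product sinSign cosSign x y n) (partial-product cosSign sinSign x y n))
    (trans (sym (Σ-+ n _ _)) (Σ-cong n λ j _ → trans (sym (Σ-+ n _ _)) (Σ-cong n λ l _ → trans
      (solve 5 (λ a b c d m → (a :* b) :* m :+ (c :* d) :* m := (a :* b :+ c :* d) :* m) refl
        (sinSign j) (cosSign l) (cosSign j) (sinSign l) (dividedPower x j * dividedPower y l))
      (cong (_* (dividedPower x j * dividedPower y l)) (sym (sinSign-+ j l))))))

  cosSign-even : ∀ p j → cosSign j * (- p) ^ j ≡ cosSign j * p ^ j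
  cosSign-even p zero          = refl
  cosSign-even p (suc zero)    = trans (*-zeroˡ (- p * (- p) ^ 0)) (sym (*-zeroˡ (p * p ^ 0)))
  cosSign-even p (suc (suc j)) = trans
    (solve 3 (λ c p q → (:- c) :* ((:- p) :* ((:- p) :* q)) := :- (p :* p) :* (c :* q)) refl (cosSign j) p ((- p) ^ j))
    (trans (cong (- (p * p) *_) (cosSign-even p j))
      (solve 3 (λ c p q → :- (p :* p) :* (c :* q) := (:- c) :* (p :* (p :* q))) refl (cosSign j) p (p ^ j)))

  sinSign-odd : ∀ p j → sinSign j * (- p) ^ j ≡ - (sinSign j * p ^ j)
  sinSign-odd p zero          = refl
  sinSign-odd p (suc zero)    = solve 1 (λ p → con 1ℚ :* (:- p :* con 1ℚ) := :- (con 1ℚ :* (p :* con 1ℚ))) refl p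
  sinSign-odd p (suc (suc j)) = trans
    (solve 3 (λ c p q → (:- c) :* ((:- p) :* ((:- p) :* q)) := :- (p :* p) :* (c :* q)) refl (sinSign j) p ((- p) ^ j))
    (trans (cong (- (p * p) *_) (sinSign-odd p j))
      (solve 3 (λ c p q → :- (p :* p) :* (:- (c :* q)) := :- ((:- c) :* (p :* (p :* q)))) refl (sinSign j) p (p ^ j)))

  partial-cos-even : ∀ p n → partial cosSign (- p) n ≡ partial cosSign p n
  partial-cos-even p n = Σ-cong n λ j _ → cong (_* 1/! j) (cosSign-even p j)

  partial-sin-odd : ∀ p n → partial sinSign (- p) n ≡ - partial sinSign p n
  partial-sin-odd p zero    = refl
  partial-sin-odd p (suc n) = trans
    (cong₂ _+_ (partial-sin-odd p n) (cong (_* 1/! n) (sinSign-odd p n)))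
    (solve 4 (λ S c q f → :- S :+ (:- (c :* q)) :* f := :- (S :+ c :* q :* f)) refl
      (partial sinSign p n) (sinSign n) (p ^ n) (1/! n))

  square≥0 : ∀ p → 0ℚ ≤ p * p
  square≥0 p with ≤-total 0ℚ p
  ... | inj₁ 0≤p = *≥0 0≤p 0≤p
  ... | inj₂ p≤0 = subst (0ℚ ≤_) (solve 1 (λ p → (:- p) :* (:- p) := p :* p) refl p) (*≥0 (neg-mono p≤0) (neg-mono p≤0))

  -- From index k on, each term C^j / j! is at least twice the next one, so a partial sum plus twice
  -- its next term can only decrease.
  E-tail : ∀ {C} → 0ℚ ≤ C → ∀ k → 2ℚ * C ≤ fromℕ (suc k) → ∀ m →
    E C (m ℕ.+ k) + 2ℚ * dividedPower C (m ℕ.+ k) ≤ E C k + 2ℚ * dividedPower C k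
  E-tail {C} 0≤C k 2C≤ zero = ≤-refl
  E-tail {C} 0≤C k 2C≤ (suc m) = ≤-trans (≤-by (*≥0 (diff≥0 2Ci≤1) d≥0)
      (solve 5 (λ S c i p f → ((S :+ p :* f) :+ con 2ℚ :* ((c :* p) :* (i :* f))) :+ (con 1ℚ :- con 2ℚ :* c :* i) :* (p :* f)
          := S :+ con 2ℚ :* (p :* f)) refl (E C (m ℕ.+ k)) C i (C ^ (m ℕ.+ k)) (1/! (m ℕ.+ k))))
    (E-tail 0≤C k 2C≤ m)
    where
    i = 1/suc (m ℕ.+ k)
    d≥0 = dividedPower≥0 0≤C (m ℕ.+ k)
    2Ci≤1 : 2ℚ * C * i ≤ 1ℚ
    2Ci≤1 = subst (2ℚ * C * i ≤_) (suc*1/suc (m ℕ.+ k))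
      (*-monoʳ (<⇒≤ (1/suc>0 (m ℕ.+ k))) (≤-trans 2C≤ (fromℕ-mono (ℕ.s≤s (ℕₚ.m≤n+m k m)))))

  partial-tail-bound : ∀ s → (∀ j → ∣ s j ∣ ≤ 1ℚ) → ∀ {p C} → ∣ p ∣ ≤ C → ∀ k → 2ℚ * C ≤ fromℕ (suc k) → ∀ m →
    ∣ partial s p (m ℕ.+ k) - partial s p k ∣ ≤ 2ℚ * dividedPower C k
  partial-tail-bound s s≤1 {p} {C} p≤C k 2C≤ m = ≤-trans (partial-tail s s≤1 p p≤C k m)
    (≤-by (+≥0 (diff≥0 (E-tail 0≤C k 2C≤ m)) (*≥0 0≤2 (dividedPower≥0 0≤C (m ℕ.+ k))))
      (solve 4 (λ S T a b → (S :- T) :+ ((T :+ con 2ℚ :* b :- (S :+ con 2ℚ :* a)) :+ con 2ℚ :* a) := con 2ℚ :* b)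
        refl (E C (m ℕ.+ k)) (E C k) (dividedPower C (m ℕ.+ k)) (dividedPower C k)))
    where
    0≤C = ≤-trans (0≤∣p∣ p) p≤C

  -- The tail begins with the cubic term and is at most 2 |p|³ / 3! ≤ p² / 3.
  partial-quadratic : ∀ s → (∀ j → ∣ s j ∣ ≤ 1ℚ) → ∀ {p} → ∣ p ∣ ≤ 1ℚ → ∀ m →
    ∣ partial s p (m ℕ.+ 3) - partial s p 3 ∣ ≤ (p * p) * ⅓
  partial-quadratic s s≤1 {p} p≤1 m = ≤-trans (partial-tail-bound s s≤1 ≤-refl 3 2∣p∣≤4 m)
    (subst (2ℚ * dividedPower (∣ p ∣) 3 ≤_) (cong (_* ⅓) ∣p∣²)
      (≤-by (*≥0 (*≥0 (*≥0 (0≤∣p∣ p) (0≤∣p∣ p)) (diff≥0 p≤1)) (<⇒≤ 0<⅓))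
        (solve 1 (λ c → con 2ℚ :* ((c :* (c :* (c :* con 1ℚ))) :* con (1/! 3)) :+ (c :* c) :* (con 1ℚ :- c) :* con ⅓ := (c :* c) :* con ⅓)
          refl (∣ p ∣))))
    where
    2∣p∣≤4 : 2ℚ * ∣ p ∣ ≤ fromℕ 4
    2∣p∣≤4 = ≤-trans (*-monoˡ 0≤2 p≤1) (fromℕ-mono {2} {4} (ℕ.s≤s (ℕ.s≤s ℕ.z≤n)))
    ∣p∣² : ∣ p ∣ * ∣ p ∣ ≡ p * p
    ∣p∣² = trans (sym (∣p*q∣≡∣p∣*∣q∣ p p)) (0≤p⇒∣p∣≡p (square≥0 p))

  cos-lower : ∀ {p} → ∣ p ∣ ≤ 1ℚ → ∀ m → 1ℚ - partial cosSign p (m ℕ.+ 3) ≤ p * p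
  cos-lower {p} p≤1 m = ≤-trans
    (≤-by (diff≥0 (≤-trans (-≤∣∣ _) (partial-quadratic cosSign cosSign≤1 p≤1 m)))
      (solve 2 (λ P p → (con 1ℚ :- P) :+ ((p :* p) :* con ⅓ :- (:- (P :-
         (((con 0ℚ :+ con 1ℚ :* con 1ℚ :* con 1ℚ) :+ con 0ℚ :* (p :* con 1ℚ) :* con (1/! 1)) :+ con (- 1ℚ) :* (p :* (p :* con 1ℚ)) :* con (1/! 2)))))
         := (p :* p) :* con (½ + ⅓)) refl (partial cosSign p (m ℕ.+ 3)) p))
    (≤-by (*≥0 (square≥0 p) (nonNegative⁻¹ (1ℚ - (½ + ⅓))))
      (solve 1 (λ p → (p :* p) :* con (½ + ⅓) :+ (p :* p) :* con (1ℚ - (½ + ⅓)) := p :* p) refl p))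

  cos-upper : ∀ {p} → ∣ p ∣ ≤ 1ℚ → ∀ m → (p * p) * (½ - ⅓) ≤ 1ℚ - partial cosSign p (m ℕ.+ 3)
  cos-upper {p} p≤1 m =
    ≤-by (diff≥0 (≤-trans (≤∣∣ _) (partial-quadratic cosSign cosSign≤1 p≤1 m)))
      (solve 2 (λ P p → (p :* p) :* con (½ - ⅓) :+ ((p :* p) :* con ⅓ :- (P :-
         (((con 0ℚ :+ con 1ℚ :* con 1ℚ :* con 1ℚ) :+ con 0ℚ :* (p :* con 1ℚ) :* con (1/! 1)) :+ con (- 1ℚ) :* (p :* (p :* con 1ℚ)) :* con (1/! 2))))
         := con 1ℚ :- P) refl (partial cosSign p (m ℕ.+ 3)) p)

  -- The terms up to degree 6 sum to 1 - 2 + 2/3 - 4/45 = -19/45, and the tail is at most 2 · 2⁷ /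
  -- 7! = 16/315.
  cos-2≤0 : ∀ m → partial cosSign 2ℚ (m ℕ.+ 7) ≤ 0ℚ
  cos-2≤0 m = ≤-trans
    (≤-by (diff≥0 (≤-trans (≤∣∣ _) (partial-tail-bound cosSign cosSign≤1 {2ℚ} ≤-refl 7 (fromℕ-mono {4} {8} (ℕ.s≤s (ℕ.s≤s (ℕ.s≤s (ℕ.s≤s ℕ.z≤n))))) m)))
      (solve 3 (λ P Q t → P :+ (t :- (P :- Q)) := Q :+ t) refl
        (partial cosSign 2ℚ (m ℕ.+ 7)) (partial cosSign 2ℚ 7) (2ℚ * dividedPower 2ℚ 7)))
    (nonPositive⁻¹ (partial cosSign 2ℚ 7 + 2ℚ * dividedPower 2ℚ 7))

  -- On [0 , ½] the partial sum is at most 1 + p + (½ + ⅓) p² < 2. This makes log N at least p for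
  -- every N ≥ 2.
  exp-upper : ∀ {p} → 0ℚ ≤ p → p ≤ ½ → ∀ m → partial one p (m ℕ.+ 3) ≤ 2ℚ
  exp-upper {p} 0≤p p≤½ m = ≤-trans
    (≤-by (diff≥0 (≤-trans (≤∣∣ _) (partial-quadratic one one≤1 (subst (_≤ 1ℚ) (sym (0≤p⇒∣p∣≡p 0≤p)) p≤1) m)))
      (solve 2 (λ P p → P :+ ((p :* p) :* con ⅓ :- (P :-
         (((con 0ℚ :+ con 1ℚ :* con 1ℚ :* con 1ℚ) :+ con 1ℚ :* (p :* con 1ℚ) :* con (1/! 1)) :+ con 1ℚ :* (p :* (p :* con 1ℚ)) :* con (1/! 2))))
         := con 1ℚ :+ (p :+ (p :* p) :* con (½ + ⅓))) refl (partial one p (m ℕ.+ 3)) p))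
    (+-monoʳ-≤ 1ℚ (≤-trans (+-mono-≤ p≤½ (*-monoʳ (nonNegative⁻¹ (½ + ⅓)) (*-mono (<⇒≤ 0<½) 0≤p p≤½ p≤½)))
      (≤-by (nonNegative⁻¹ (1ℚ - (½ + (½ * ½) * (½ + ⅓)))) refl)))
    where
    p≤1 = ≤-trans p≤½ (≤-by (<⇒≤ 0<½) refl)

  -- The first two terms already give 1 + p. Used to see that exp exceeds its target at the right
  -- end of the search interval for log.
  exp-lower : ∀ {p} → 0ℚ ≤ p → ∀ m → p ≤ partial one p (m ℕ.+ 2)
  exp-lower {p} 0≤p m = ≤-trans
    (≤-by 0≤1 (solve 1 (λ p → p :+ con 1ℚ
      := (con 0ℚ :+ con 1ℚ :* con 1ℚ :* con 1ℚ) :+ con 1ℚ :* (p :* con 1ℚ) :* con (1/! 1)) refl p))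
    (Σ-extend (λ j → *≥0 (*≥0 0≤1 (^≥0 0≤p j)) (<⇒≤ (1/!>0 j))) 2 m)

-- The functions cos, sin, √, log and the number π on ℝ.

module Transcendental where

  open import Defs
  private module F = RationalFacts
  private module S = Series
  open ≡ using (refl; sym; trans; cong; cong₂; subst; subst₂)
  open Ordered
  open Real

  ≤-limit : ∀ z x → (∀ m → fromℚ (seq z m) ≤ x) → z ≤ x
  ≤-limit z x h = ≤-intro z x λ ε 0<ε →
    let N , c = cauchy-≤ z (ε ℚ.* ½) (F.0<half 0<ε)
    in eventually-map (λ n (c′ , le) → ℚₚ.≤-trans c′ (subst (seq z N ℚ.+ ε ℚ.* ½ ℚ.≤_)
         (solve 2 (λ x e → (x :+ e :* con ½) :+ e :* con ½ := x :+ e) refl (seq x n) ε)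
         (ℚₚ.+-monoˡ-≤ (ε ℚ.* ½) le)))
       ((N , λ n N≤n → c n N N≤n ℕₚ.≤-refl) ∧ᵉ ≤-elim (fromℚ (seq z N)) x (h N) (ε ℚ.* ½) (F.0<half 0<ε))
    where open ℚ-Solver.+-*-Solver

  module _ (s : ℕ → ℚ) (s≤1 : ∀ j → ℚ.∣ s j ∣ ℚ.≤ 1ℚ) where

    -- Stated for sequences, so that a real can be compared with a constant rational. U bounds the
    -- partial sums of exp at 2B, which dominate the Lipschitz constants of all partial sums on
    -- [-B , B].
    series-lipschitz : ∀ {B} → 1ℚ ℚ.≤ B → ∃[ U ] (0ℚ ℚ.< U) × (∀ (x y : ℕ → ℚ) η →
      Eventually (λ n → ℚ.∣ x n ∣ ℚ.≤ B) → Eventually (λ n → ℚ.∣ y n ∣ ℚ.≤ B) →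
      Eventually (λ n → ℚ.∣ x n ℚ.- y n ∣ ℚ.≤ η) →
      Eventually (λ n → ℚ.∣ F.partial s (x n) n ℚ.- F.partial s (y n) n ∣ ℚ.≤ η ℚ.* U))
    series-lipschitz {B} 1≤B =
      U , ℚₚ.<-≤-trans F.0<1 1≤U , λ x y η bx by d → eventually-map (λ n (b , c , d , e) →
        ℚₚ.≤-trans (F.partial-lipschitz s s≤1 (x n) (y n) 1≤B b c n)
          (F.*-mono (ℚₚ.≤-trans (ℚₚ.0≤∣p∣ (x n ℚ.- y n)) d) (E≥0 n) d (ℚₚ.≤-trans (F.≤∣∣ (F.E (B ℚ.+ B) n)) e)))
        (bx ∧ᵉ by ∧ᵉ d ∧ᵉ evU)
      where
      0≤B = ℚₚ.≤-trans F.0≤1 1≤B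
      0≤2B = F.+≥0 0≤B 0≤B
      bound = F.eventual-bound (F.E-cauchy (B ℚ.+ B) 0≤2B)
      U = proj₁ bound
      1≤U = proj₁ (proj₂ bound)
      evU : Eventually (λ n → ℚ.∣ F.E (B ℚ.+ B) n ∣ ℚ.≤ U)
      evU = proj₂ (proj₂ bound)
      E≥0 : ∀ n → 0ℚ ℚ.≤ F.E (B ℚ.+ B) n
      E≥0 n = S.Σ-extend-≤ (S.dividedPower≥0 0≤2B) (ℕ.z≤n {n})

    series : ℝ → ℝ
    series x = real (λ n → F.partial s (seq x n) n) (F.partial-cauchy s s≤1 {seq x} (cauchy x))

    series-cong : ∀ x y → x ≈ y → series x ≈ series y
    series-cong x y x≈y = ≈-intro (series x) (series y) λ ε 0<ε →
      eventually-map (λ n le → ℚₚ.≤-trans le (ℚₚ.≤-reflexive (trans (ℚₚ.*-comm _ U) (scale-inv 0<U ε))))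
        (h (seq x) (seq y) (ε ℚ.* F.inv 0<U)
          (eventually-map (λ n le → ℚₚ.≤-trans le (F.≤-by 0≤C refl)) (proj₂ (proj₂ (bounded x))))
          (eventually-map (λ n le → ℚₚ.≤-trans le (F.≤-by 0≤B (ℚₚ.+-comm C B))) (proj₂ (proj₂ (bounded y))))
          (≈-elim x y x≈y (ε ℚ.* F.inv 0<U) (F.*>0 0<ε (F.inv>0 0<U))))
      where
      B = proj₁ (bounded x)
      C = proj₁ (bounded y)
      0≤B = ℚₚ.≤-trans F.0≤1 (proj₁ (proj₂ (bounded x)))
      0≤C = ℚₚ.≤-trans F.0≤1 (proj₁ (proj₂ (bounded y)))
      L = series-lipschitz {B ℚ.+ C} (ℚₚ.≤-trans (proj₁ (proj₂ (bounded x))) (F.≤-by 0≤C refl))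
      U = proj₁ L
      0<U = proj₁ (proj₂ L)
      h = proj₂ (proj₂ L)

    -- The square and triangular truncations differ by at most E C (2n) - E C n, which tends to 0
    -- because `E C` is Cauchy.
    series-mixedProduct : ∀ x y z → (∀ n → seq z n ≡ S.mixedProduct s (seq x n) (seq y n) n) → z ≈ series (x + y)
    series-mixedProduct x y z e = ≈-intro z (series (x + y)) λ ε 0<ε →
      let N , c = F.E-cauchy C 0≤C ε 0<ε
      in eventually-map (λ n (b , b′ , d) → ℚₚ.≤-trans
           (subst (λ t → ℚ.∣ t ℚ.- F.partial s (seq x n ℚ.+ seq y n) n ∣ ℚ.≤ F.E C (n ℕ.+ n) ℚ.- F.E C n) (sym (e n))
             (S.mixedProduct-error s s≤1 (seq x n) (seq y n) (ℚₚ.+-mono-≤ b b′) n))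
           (ℚₚ.≤-trans (F.≤∣∣ _) (ℚₚ.<⇒≤ d)))
         (proj₂ (proj₂ (bounded x)) ∧ᵉ proj₂ (proj₂ (bounded y)) ∧ᵉ
           (N , λ n N≤n → c (n ℕ.+ n) n (ℕₚ.≤-trans N≤n (ℕₚ.m≤m+n n n)) N≤n))
      where
      C = proj₁ (bounded x) ℚ.+ proj₁ (bounded y)
      0≤C : 0ℚ ℚ.≤ C
      0≤C = F.+≥0 (ℚₚ.≤-trans F.0≤1 (proj₁ (proj₂ (bounded x)))) (ℚₚ.≤-trans F.0≤1 (proj₁ (proj₂ (bounded y))))

  cos-cong : ∀ x y → x ≈ y → cos x ≈ cos y
  cos-cong = series-cong F.cosSign F.cosSign≤1

  sin-cong : ∀ x y → x ≈ y → sin x ≈ sin y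
  sin-cong = series-cong F.sinSign F.sinSign≤1

  ≈-sym : ∀ {x y} → x ≈ y → y ≈ x
  ≈-sym (p , q) = q , p

  cos-+ : ∀ x y → cos (x + y) ≈ cos x * cos y - sin x * sin y
  cos-+ x y = ≈-sym {cos x * cos y - sin x * sin y} {cos (x + y)}
    (series-mixedProduct F.cosSign F.cosSign≤1 x y (cos x * cos y - sin x * sin y)
      (λ n → S.cos-product (seq x n) (seq y n) n))

  sin-+ : ∀ x y → sin (x + y) ≈ sin x * cos y + cos x * sin y
  sin-+ x y = ≈-sym {sin x * cos y + cos x * sin y} {sin (x + y)}
    (series-mixedProduct F.sinSign F.sinSign≤1 x y (sin x * cos y + cos x * sin y)
      (λ n → S.sin-product (seq x n) (seq y n) n))

  cos-neg : ∀ x → cos (- x) ≈ cos x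
  cos-neg x = pointwise-≈ (cos (- x)) (cos x) λ n → S.partial-cos-even (seq x n) n

  sin-neg : ∀ x → sin (- x) ≈ - sin x
  sin-neg x = pointwise-≈ (sin (- x)) (- sin x) λ n → S.partial-sin-odd (seq x n) n

  eventually-shift : ∀ {P : ℕ → Set} k → (∀ m → P (m ℕ.+ k)) → Eventually P
  eventually-shift {P} k h = k , λ n k≤n → subst P (ℕₚ.m∸n+n≡m k≤n) (h (n ℕ.∸ k))

  eventually-≤1 : ∀ x → - fromℚ ½ ≤ x → x ≤ fromℚ ½ → Eventually (λ n → ℚ.∣ seq x n ∣ ℚ.≤ 1ℚ)
  eventually-≤1 x l u = eventually-map
    (λ n (l , u) → F.∣∣≤ u (F.≤-by (F.diff≥0 l)
      (solve 1 (λ x → :- x :+ ((x :+ con ½) :- (:- con ½)) := con 1ℚ) refl (seq x n))))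
    (≤-elim (- fromℚ ½) x l ½ F.0<½ ∧ᵉ ≤-elim x (fromℚ ½) u ½ F.0<½)
    where open ℚ-Solver.+-*-Solver

  1-cos≤ : ∀ x → - fromℚ ½ ≤ x → x ≤ fromℚ ½ → 1ℝ - cos x ≤ x * x
  1-cos≤ x l u = ≤-intro (1ℝ - cos x) (x * x) λ ε 0<ε → eventually-map
    (λ n (b , h) → ℚₚ.≤-trans (h b) (F.≤-by (ℚₚ.<⇒≤ 0<ε) refl))
    (eventually-≤1 x l u ∧ᵉ eventually-shift {λ n → ℚ.∣ seq x n ∣ ℚ.≤ 1ℚ → 1ℚ ℚ.- F.partial F.cosSign (seq x n) n ℚ.≤ seq x n ℚ.* seq x n} 3
      (λ m b → S.cos-lower b m))

  ≤1-cos : ∀ x → - fromℚ ½ ≤ x → x ≤ fromℚ ½ → x * x * fromℚ (½ ℚ.- F.⅓) ≤ 1ℝ - cos x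
  ≤1-cos x l u = ≤-intro (x * x * fromℚ (½ ℚ.- F.⅓)) (1ℝ - cos x) λ ε 0<ε → eventually-map
    (λ n (b , h) → ℚₚ.≤-trans (h b) (F.≤-by (ℚₚ.<⇒≤ 0<ε) refl))
    (eventually-≤1 x l u ∧ᵉ eventually-shift {λ n → ℚ.∣ seq x n ∣ ℚ.≤ 1ℚ → (seq x n ℚ.* seq x n) ℚ.* (½ ℚ.- F.⅓) ℚ.≤ 1ℚ ℚ.- F.partial F.cosSign (seq x n) n} 3
      (λ m b → S.cos-upper b m))

  module Root
    (f : ℚ → ℝ) (a b : ℚ) (a<b : a ℚ.< b)
    (increasing : ∀ {p q} → a ℚ.≤ p → p ℚ.< q → q ℚ.≤ b → f p < f q)
    (y : ℝ)
    where
    open Solve f a b a<b increasing y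

    -- A left endpoint moves only to a point where f < y has been established, and a right endpoint
    -- only to one where y < f, so the bracketing of y survives every step.
    below : f a ≤ y → ∀ n → f (l (trisect n)) ≤ y
    below fa≤y zero    = fa≤y
    below fa≤y (suc n) = step (trisect n) (choice (trisect n)) (below fa≤y n)
      where
      step : ∀ I c → f (l I) ≤ y → f (l (refine I c)) ≤ y
      step I (inj₁ lt) _ = <⇒≤ (f (l⁺ I)) y lt
      step I (inj₂ _)  h = h

    above : y ≤ f b → ∀ n → y ≤ f (l (trisect n) ℚ.+ w (trisect n))
    above y≤fb zero    = subst (λ q → y ≤ f q) (solve 2 (λ a b → b := a :+ (b :- a)) refl a b) y≤fb
      where open ℚ-Solver.+-*-Solver
    above y≤fb (suc n) = step (trisect n) (choice (trisect n)) (above y≤fb n)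
      where
      step : ∀ I c → y ≤ f (l I ℚ.+ w I) → y ≤ f (l (refine I c) ℚ.+ w (refine I c))
      step I (inj₁ _)  h = subst (λ q → y ≤ f q) (sym (l⁺+w⁻≡ I)) h
      step I (inj₂ lt) _ = <⇒≤ y (f (r⁻ I)) lt

    width : ∀ ε → 0ℚ ℚ.< ε → Eventually (λ n → w (trisect n) ℚ.< ε)
    width = F.geometric-decay (λ n → w (trisect n)) (λ n → ℚₚ.<⇒≤ (0<w (trisect n)))
      (λ n → ℚₚ.≤-reflexive (refine-w (trisect n) (choice (trisect n))))

    l≤b : ∀ I → l I ℚ.≤ b
    l≤b I = ℚₚ.≤-trans (F.≤-by (ℚₚ.<⇒≤ (0<w I)) refl) (l+w≤b I)

    -- If the solution were below p, then so would be a right endpoint r, once the interval is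
    -- narrower than the gap. Monotonicity and `above` would give f r < f p ≤ y ≤ f r.
    solution-lower : y ≤ f b → ∀ p → p ℚ.≤ b → f p ≤ y → fromℚ p ≤ solution
    solution-lower y≤fb p p≤b fp≤y (ε , 0<ε , N , h) =
      let n , (gap , narrow) = eventually-witness ((N , h) ∧ᵉ width ε 0<ε)
          I = trisect n
      in contradiction
        (increasing (ℚₚ.≤-trans (a≤l I) (F.≤-by (ℚₚ.<⇒≤ (0<w I)) refl))
          (ℚₚ.<-≤-trans (ℚₚ.+-monoʳ-< (l I) narrow) gap) p≤b)
        (≤ℝ-trans (f p) y (f (l I ℚ.+ w I)) fp≤y (above y≤fb n))

    solution-upper : f a ≤ y → ∀ p → a ℚ.≤ p → y ≤ f p → solution ≤ fromℚ p
    solution-upper fa≤y p a≤p y≤fp (ε , 0<ε , N , h) =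
      let n , gap = eventually-witness (N , h)
          I = trisect n
      in contradiction
        (increasing a≤p (ℚₚ.<-≤-trans (F.<-by 0<ε refl) gap) (l≤b I))
        (≤ℝ-trans (f (l I)) y (f p) (below fa≤y n) y≤fp)

  module _ (x : ℝ) where

    private
      module R = Root (λ p → fromℚ (p ℚ.* p)) 0ℚ (upperBound x) (0<upperBound x)

    √-upper : 0ℝ ≤ x → ∀ p → 0ℚ ℚ.≤ p → x ≤ fromℚ (p ℚ.* p) → √ x ≤ fromℚ p
    √-upper = R.solution-upper _ x

    x≤upperBound : x ≤ fromℚ (upperBound x)
    x≤upperBound = ≤-intro x (fromℚ (upperBound x)) λ ε 0<ε → eventually-map
      (λ n le → ℚₚ.≤-trans (F.≤∣∣ (seq x n)) (ℚₚ.≤-trans le (F.≤-by (ℚₚ.<⇒≤ 0<ε) refl)))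
      (proj₂ (proj₂ (bounded x)))

    1≤upperBound : 1ℚ ℚ.≤ upperBound x
    1≤upperBound = proj₁ (proj₂ (bounded x))

    -- p ≤ 1 places p inside the search interval, whose right end U ≥ 1 satisfies x ≤ U ≤ U².
    √-lower : ∀ p → p ℚ.≤ 1ℚ → fromℚ (p ℚ.* p) ≤ x → fromℚ p ≤ √ x
    √-lower p p≤1 = R.solution-lower _ x
      (≤ℝ-trans x (fromℚ (upperBound x)) (fromℚ (upperBound x ℚ.* upperBound x)) x≤upperBound
        (fromℚ-mono _ _ (subst (ℚ._≤ upperBound x ℚ.* upperBound x) (ℚₚ.*-identityˡ (upperBound x))
          (F.*-monoʳ (ℚₚ.<⇒≤ (0<upperBound x)) 1≤upperBound))))
      p (ℚₚ.≤-trans p≤1 1≤upperBound)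

    -- The n-th term of √ x * √ x is the square of the n-th left endpoint, which the trisection
    -- keeps below x.
    √-square : 0ℝ ≤ x → √ x * √ x ≤ x
    √-square 0≤x = ≤-limit (√ x * √ x) x (R.below _ x 0≤x)

  -- exp p ≤ 2 ≤ N, and the search interval does bracket the solution because N ≤ U ≤ exp U.
  log-lower : ∀ N → 2 ℕ.≤ N → ∀ p → 0ℚ ℚ.≤ p → p ℚ.≤ ½ → fromℚ p ≤ log (fromℕ N)
  log-lower N 2≤N p 0≤p p≤½ = R.solution-lower _ y
    (≤ℝ-trans y (fromℚ U) (exp (fromℚ U)) (x≤upperBound y)
      (≤-intro (fromℚ U) (exp (fromℚ U)) λ ε 0<ε →
        eventually-shift 2 λ m → ℚₚ.≤-trans (S.exp-lower (ℚₚ.<⇒≤ (0<upperBound y)) m) (F.≤-by (ℚₚ.<⇒≤ 0<ε) refl)))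
    p (ℚₚ.≤-trans p≤½ (ℚₚ.≤-trans (F.≤-by (ℚₚ.<⇒≤ F.0<½) refl) (1≤upperBound y)))
    (≤-intro (exp (fromℚ p)) y λ ε 0<ε → eventually-shift 3 λ m →
      ℚₚ.≤-trans (S.exp-upper 0≤p p≤½ m) (ℚₚ.≤-trans (fromℚ-cancel (+ 2 ℚ./ 1) (+ N ℚ./ 1) (O.fromℕ-mono 2≤N))
        (F.≤-by {+ N ℚ./ 1} {+ N ℚ./ 1 ℚ.+ ε} (ℚₚ.<⇒≤ 0<ε) refl)))
    where
    module O = OrderedAlgebraProperties ℝ-orderedAlgebra
    y = fromℕ N
    U = upperBound y
    module R = Root (λ p → exp (fromℚ p)) 0ℚ U (0<upperBound y)

  -- The definition of `π` carries a particular proof of monotonicity. Abstracting over it lets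
  -- unification supply that proof when the results are applied to `π`.
  module HalfPeriod
    (increasing : ∀ {p q} → 0ℚ ℚ.≤ p → p ℚ.< q → q ℚ.≤ F.2ℚ → - cos (fromℚ p) < - cos (fromℚ q))
    where

    private
      f : ℚ → ℝ
      f p = - cos (fromℚ p)
      0<2 : 0ℚ ℚ.< F.2ℚ
      0<2 = ℚₚ.positive⁻¹ F.2ℚ
    open Solve f 0ℚ F.2ℚ 0<2 increasing 0ℝ
    open Root f 0ℚ F.2ℚ 0<2 increasing 0ℝ

    private
      h : ℝ
      h = solution

    f0≤0 : f 0ℚ ≤ 0ℝ
    f0≤0 = ≤-intro (f 0ℚ) 0ℝ λ ε 0<ε → eventually-shift 3 λ m → ℚₚ.≤-trans
      (F.≤-by (F.+≥0 (F.diff≥0 (S.cos-lower {0ℚ} F.0≤1 m)) F.0≤1)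
        (solve 1 (λ P → :- P :+ ((con 0ℚ :- (con 1ℚ :- P)) :+ con 1ℚ) := con 0ℚ) refl (F.partial F.cosSign 0ℚ (m ℕ.+ 3))))
      (F.≤-by (ℚₚ.<⇒≤ 0<ε) refl)
      where open ℚ-Solver.+-*-Solver

    0≤f2 : 0ℝ ≤ f F.2ℚ
    0≤f2 = ≤-intro 0ℝ (f F.2ℚ) λ ε 0<ε → eventually-shift 7 λ m → ℚₚ.≤-trans
      (F.neg-mono (S.cos-2≤0 m)) (F.≤-by (ℚₚ.<⇒≤ 0<ε) refl)

    -- cos ½ ≥ 1 - ¼ > 0, so the zero of cos lies beyond ½; doubling gives 1 ≤ π.
    ½≤solution : fromℚ ½ ≤ solution
    ½≤solution = solution-lower 0≤f2 ½ (F.≤-by (ℚₚ.nonNegative⁻¹ (F.2ℚ ℚ.- ½)) refl)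
      (≤-intro (f ½) 0ℝ λ ε 0<ε → eventually-shift 3 λ m → ℚₚ.≤-trans
        (F.≤-by (F.+≥0 (F.diff≥0 (S.cos-lower {½} (F.≤-by (ℚₚ.<⇒≤ F.0<½) refl) m)) (ℚₚ.nonNegative⁻¹ (1ℚ ℚ.- ½ ℚ.* ½)))
          (solve 1 (λ P → :- P :+ ((con (½ ℚ.* ½) :- (con 1ℚ :- P)) :+ con (1ℚ ℚ.- ½ ℚ.* ½)) := con 0ℚ) refl (F.partial F.cosSign ½ (m ℕ.+ 3))))
        (F.≤-by (ℚₚ.<⇒≤ 0<ε) refl))
      where open ℚ-Solver.+-*-Solver

    private
      0≤2ℚ = ℚₚ.<⇒≤ 0<2
      lip = series-lipschitz F.cosSign F.cosSign≤1 {F.2ℚ} (F.≤-by {1ℚ} {F.2ℚ} F.0≤1 refl)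
      U = proj₁ lip
      0<U = proj₁ (proj₂ lip)
      inRange : ∀ q → 0ℚ ℚ.≤ q → q ℚ.≤ F.2ℚ → ℚ.∣ q ∣ ℚ.≤ F.2ℚ
      inRange q 0≤q q≤2 = subst (ℚ._≤ F.2ℚ) (sym (ℚₚ.0≤p⇒∣p∣≡p 0≤q)) q≤2
      l-range : ∀ n → ℚ.∣ l (trisect n) ∣ ℚ.≤ F.2ℚ
      l-range n = inRange _ (a≤l (trisect n)) (l≤b (trisect n))
      r : ℕ → ℚ
      r n = l (trisect n) ℚ.+ w (trisect n)
      r-range : ∀ n → ℚ.∣ r n ∣ ℚ.≤ F.2ℚ
      r-range n = inRange _ (F.+≥0 (a≤l (trisect n)) (ℚₚ.<⇒≤ (0<w (trisect n)))) (l+w≤b (trisect n))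

    cos-near : ∀ ε → 0ℚ ℚ.< ε → ∀ q → ℚ.∣ q ∣ ℚ.≤ F.2ℚ →
      Eventually (λ n → ℚ.∣ seq h n ℚ.- q ∣ ℚ.≤ ε ℚ.* F.inv 0<U) →
      Eventually (λ n → ℚ.∣ seq (cos h) n ℚ.- seq (cos (fromℚ q)) n ∣ ℚ.≤ ε)
    cos-near ε 0<ε q q≤2 ev = eventually-map
      (λ n le → ℚₚ.≤-trans le (ℚₚ.≤-reflexive (trans (ℚₚ.*-comm (ε ℚ.* F.inv 0<U) U) (scale-inv 0<U ε))))
      (proj₂ (proj₂ lip) (seq h) (λ _ → q) (ε ℚ.* F.inv 0<U) (always l-range) (always λ _ → q≤2) ev)

    -- cos is nonnegative at every left endpoint; these converge to h, and the Lipschitz bound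
    -- carries the sign to the limit.
    0≤cos : 0ℝ ≤ cos h
    0≤cos = ≤-intro 0ℝ (cos h) λ ε 0<ε →
      let η = ε ℚ.* ½ ℚ.* F.inv 0<U
          N , c = cauchy h η (F.*>0 (F.0<half 0<ε) (F.inv>0 0<U))
          q = l (trisect N)
      in eventually-map (λ n (d , e) → F.≤-by (F.+≥0 (F.diff≥0 (∣-∣≤⇒≤+ (seq (cos (fromℚ q)) n) (seq (cos h) n) d)) (F.diff≥0 e))
           (solve 3 (λ P Q e → con 0ℚ :+ ((P :+ e :* con ½ :- Q) :+ ((con 0ℚ :+ e :* con ½) :- :- Q)) := P :+ e) refl
             (seq (cos h) n) (seq (cos (fromℚ q)) n) ε))
         (eventually-map (λ n → subst (ℚ._≤ ε ℚ.* ½) (F.∣∣-sym (seq (cos h) n) (seq (cos (fromℚ q)) n)))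
           (cos-near (ε ℚ.* ½) (F.0<half 0<ε) q (l-range N) (N , λ n N≤n → ℚₚ.<⇒≤ (c n N N≤n ℕₚ.≤-refl)))
         ∧ᵉ ≤-elim (f q) 0ℝ (below f0≤0 N) (ε ℚ.* ½) (F.0<half 0<ε))
      where open ℚ-Solver.+-*-Solver

    -- The same with right endpoints, where cos is nonpositive; they converge to h because the
    -- widths tend to 0.
    cos≤0 : cos h ≤ 0ℝ
    cos≤0 = ≤-intro (cos h) 0ℝ λ ε 0<ε →
      let η   = ε ℚ.* ½ ℚ.* F.inv 0<U
          0<η = F.*>0 (F.0<half 0<ε) (F.inv>0 0<U)
          N , (c , narrow) = eventually-witness (close (η ℚ.* ½) (F.0<half 0<η) ∧ᵉ width (η ℚ.* ½) (F.0<half 0<η))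
      in eventually-map (λ n (d , e) → F.≤-by (F.+≥0 (F.diff≥0 (∣-∣≤⇒≤+ (seq (cos h) n) (seq (cos (fromℚ (r N))) n) d)) (F.diff≥0 e))
           (solve 3 (λ P Q e → P :+ ((Q :+ e :* con ½ :- P) :+ ((:- Q :+ e :* con ½) :- con 0ℚ)) := con 0ℚ :+ e) refl
             (seq (cos h) n) (seq (cos (fromℚ (r N))) n) ε))
         (cos-near (ε ℚ.* ½) (F.0<half 0<ε) (r N) (r-range N)
           (eventually-map (λ n d → near n N η d (ℚₚ.<⇒≤ narrow)) c)
         ∧ᵉ ≤-elim 0ℝ (f (r N)) (above 0≤f2 N) (ε ℚ.* ½) (F.0<half 0<ε))
      where
      open ℚ-Solver.+-*-Solver
      close : ∀ η → 0ℚ ℚ.< η → Eventually (λ m → Eventually (λ n → ℚ.∣ seq h n ℚ.- seq h m ∣ ℚ.≤ η))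
      close η 0<η = proj₁ (cauchy h η 0<η) , λ m M≤m →
        proj₁ (cauchy h η 0<η) , λ n M≤n → ℚₚ.<⇒≤ (proj₂ (cauchy h η 0<η) n m M≤n M≤m)
      near : ∀ n N η → ℚ.∣ seq h n ℚ.- seq h N ∣ ℚ.≤ η ℚ.* ½ → w (trisect N) ℚ.≤ η ℚ.* ½ → ℚ.∣ seq h n ℚ.- r N ∣ ℚ.≤ η
      near n N η d narrow = subst (ℚ.∣ seq h n ℚ.- r N ∣ ℚ.≤_) (F.halves η)
        (ℚₚ.≤-trans (F.∣∣-triangle (seq h n) (seq h N) (r N))
          (ℚₚ.+-mono-≤ d (subst (ℚ._≤ η ℚ.* ½)
            (trans (sym (ℚₚ.0≤p⇒∣p∣≡p (ℚₚ.<⇒≤ (0<w (trisect N))))) (trans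
              (cong ℚ.∣_∣ (solve 2 (λ l w → w := (l :+ w) :- l) refl (l (trisect N)) (w (trisect N))))
              (F.∣∣-sym (r N) (seq h N)))) narrow)))

    cos-half : cos (fromℚ ½ * (fromℕ 2 * h)) ≈ 0ℝ
    cos-half = ≤ℝ-trans (cos t) (cos h) 0ℝ (proj₁ e) cos≤0 , ≤ℝ-trans 0ℝ (cos h) (cos t) 0≤cos (proj₂ e)
      where
      open ℚ-Solver.+-*-Solver
      t = fromℚ ½ * (fromℕ 2 * h)
      e = cos-cong t h (pointwise-≈ t h λ n → solve 1 (λ x → con ½ :* (con (+ 2 ℚ./ 1) :* x) := x) refl (seq h n))

    1≤2h : 1ℝ ≤ fromℕ 2 * h
    1≤2h = ≤ℝ-trans 1ℝ (h + h) (fromℕ 2 * h)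
      (≤ℝ-trans 1ℝ (h + fromℚ ½) (h + h)
        (≤ℝ-trans 1ℝ (fromℚ ½ + h) (h + fromℚ ½) (+ℝ-monoʳ-≤ (fromℚ ½) (fromℚ ½) h ½≤solution)
          (pointwise-≤ (fromℚ ½ + h) (h + fromℚ ½) λ n → ℚₚ.≤-reflexive (ℚₚ.+-comm ½ (seq h n))))
        (+ℝ-monoʳ-≤ h (fromℚ ½) h ½≤solution))
      (pointwise-≤ (h + h) (fromℕ 2 * h) λ n → ℚₚ.≤-reflexive
        (solve 1 (λ x → x :+ x := con (+ 2 ℚ./ 1) :* x) refl (seq h n)))
      where open ℚ-Solver.+-*-Solver

    2h≤4 : fromℕ 2 * h ≤ fromℕ 4
    2h≤4 = pointwise-≤ (fromℕ 2 * h) (fromℕ 4) λ n → ℚₚ.≤-trans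
      (F.*-monoˡ (ℚₚ.nonNegative⁻¹ (+ 2 ℚ./ 1)) (l≤b (trisect n))) ℚₚ.≤-refl

  cos-halfπ : cos (fromℚ ½ * π) ≈ 0ℝ
  cos-halfπ = HalfPeriod.cos-half _

  1≤π : 1ℝ ≤ π
  1≤π = HalfPeriod.1≤2h _

  π≤4 : π ≤ fromℕ 4
  π≤4 = HalfPeriod.2h≤4 _

  toNearestℤ-upper : ∀ x k r → x - fromℤ k ≤ r → fromℤ k - x ≤ r → ∥ x ∥ ≤ r
  toNearestℤ-upper x k r h g = ≤-intro ∥ x ∥ r λ ε 0<ε → eventually-map
    (λ n (p , q) → ℚₚ.≤-trans (F.toNearestℤ-least (seq x n) k)
      (subst (λ t → ℚ.∣ seq x n ℚ.- t ∣ ℚ.≤ seq r n ℚ.+ ε) (sym (F.fromℤ≡/1 k))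
        (F.∣∣≤ p (subst (ℚ._≤ seq r n ℚ.+ ε) (solve 2 (λ x k → k :- x := :- (x :- k)) refl (seq x n) (k ℚ./ 1)) q))))
    (≤-elim (x - fromℤ k) r h ε 0<ε ∧ᵉ ≤-elim (fromℤ k - x) r g ε 0<ε)
    where open ℚ-Solver.+-*-Solver

  -- The floor function is not computable on ℝ. The floor of one rational approximation with error ½
  -- is off by at most 1 + ½, which 2 covers.
  integerPart : ∀ x → ∃[ z ] (x ≤ fromℤ z + fromℕ 2) × (fromℤ z ≤ x + fromℕ 2)
  integerPart x = z , ≤-intro x (fromℤ z + fromℕ 2) upper , ≤-intro (fromℤ z) (x + fromℕ 2) lower
    where
    open ℚ-Solver.+-*-Solver
    N = proj₁ (cauchy-≤ x ½ F.0<½)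
    c = proj₂ (cauchy-≤ x ½ F.0<½)
    q = seq x N
    z = ℚ.floor q
    q≤ : q ℚ.≤ 1ℚ ℚ.+ z ℚ./ 1
    q≤ = ℚₚ.≤-trans (ℚₚ.<⇒≤ (F.<⌊⌋+1 q)) (ℚₚ.≤-reflexive (trans (F.fromℤ-+ (+ 1) z) (cong (1ℚ ℚ.+_) (F.fromℤ≡/1 z))))
    ≤q : z ℚ./ 1 ℚ.≤ q
    ≤q = subst (ℚ._≤ q) (F.fromℤ≡/1 z) (F.⌊⌋≤ q)
    upper : ∀ ε → 0ℚ ℚ.< ε → Eventually (λ n → seq x n ℚ.≤ z ℚ./ 1 ℚ.+ + 2 ℚ./ 1 ℚ.+ ε)
    upper ε 0<ε = N , λ n N≤n → F.≤-by
      (F.+≥0 (F.diff≥0 (c n N N≤n ℕₚ.≤-refl)) (F.+≥0 (F.diff≥0 q≤) (F.+≥0 (ℚₚ.<⇒≤ F.0<½) (ℚₚ.<⇒≤ 0<ε))))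
      (solve 4 (λ x q z e → x :+ ((q :+ con ½ :- x) :+ (((con 1ℚ :+ z) :- q) :+ (con ½ :+ e))) := (z :+ con (+ 2 ℚ./ 1)) :+ e)
        refl (seq x n) q (z ℚ./ 1) ε)
    lower : ∀ ε → 0ℚ ℚ.< ε → Eventually (λ n → z ℚ./ 1 ℚ.≤ seq x n ℚ.+ + 2 ℚ./ 1 ℚ.+ ε)
    lower ε 0<ε = N , λ n N≤n → F.≤-by
      (F.+≥0 (F.diff≥0 (c N n ℕₚ.≤-refl N≤n)) (F.+≥0 (F.diff≥0 ≤q) (F.+≥0 (ℚₚ.nonNegative⁻¹ (1ℚ ℚ.+ ½)) (ℚₚ.<⇒≤ 0<ε))))
      (solve 4 (λ x q z e → z :+ ((x :+ con ½ :- q) :+ ((q :- z) :+ (con (1ℚ ℚ.+ ½) :+ e))) := (x :+ con (+ 2 ℚ./ 1)) :+ e)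
        refl (seq x n) q (z ℚ./ 1) ε)

  -- From index N on, x_n ≥ ε, so the maximum inside `inv⊔` is x_n itself.
  reciprocal-inverse : ∀ x 0<x → x * reciprocal x 0<x ≈ 1ℝ
  reciprocal-inverse x (ε , 0<ε , N , h) = ≈-intro (x * reciprocal x (ε , 0<ε , N , h)) 1ℝ λ η 0<η → N , λ n N≤n →
    subst (ℚ._≤ η) (cong ℚ.∣_∣ (sym (trans (cong (ℚ._- 1ℚ) (inverse n N≤n)) (ℚₚ.+-inverseʳ 1ℚ)))) (ℚₚ.<⇒≤ 0<η)
    where
    inverse : ∀ n → N ℕ.≤ n → seq x n ℚ.* F.inv⊔ 0<ε (seq x n) ≡ 1ℚ
    inverse n N≤n = trans (cong (ℚ._* F.inv⊔ 0<ε (seq x n)) (sym (ℚₚ.p≤q⇒p⊔q≡q ε≤x))) (F.inv-inverse (ℚₚ.<-≤-trans 0<ε (ℚₚ.p≤p⊔q ε (seq x n))))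
      where
      ε≤x : ε ℚ.≤ seq x n
      ε≤x = subst (ℚ._≤ seq x n) (ℚₚ.+-identityˡ ε) (h n N≤n)

  reciprocal-nonNeg : ∀ x 0<x → 0ℝ ≤ reciprocal x 0<x
  reciprocal-nonNeg x (ε , 0<ε , N , h) = pointwise-≤ 0ℝ (reciprocal x (ε , 0<ε , N , h)) λ n →
    ℚₚ.<⇒≤ (F.inv>0 (ℚₚ.<-≤-trans 0<ε (ℚₚ.p≤p⊔q ε (seq x n))))

-- The theorem over ℝ.

open import Defs
open Ordered
open Circle
open Correlation
open Real
open Transcendental
open ≡ using (refl)

ℝ-trigonometry : Trigonometry ℝ-orderedAlgebra
ℝ-trigonometry = record
  { cos       = cos
  ; sin       = sin
  ; π         = π
  ; cos-cong  = λ {x} {y} → cos-cong x y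
  ; sin-cong  = λ {x} {y} → sin-cong x y
  ; cos-+     = cos-+
  ; sin-+     = sin-+
  ; cos-neg   = cos-neg
  ; sin-neg   = sin-neg
  ; 1-cos≤    = λ {x} → 1-cos≤ x
  ; ≤1-cos    = λ {x} → ≤1-cos x
  ; cos-halfπ = cos-halfπ
  ; 1≤π       = 1≤π
  ; π≤4       = π≤4
  }

private
  module O = OrderedAlgebraProperties ℝ-orderedAlgebra
  module P = PairCorrelation ℝ-orderedAlgebra ℝ-trigonometry

re-∑ : ∀ {n} (f : Vector ℂ n) m → seq (re (∑ f)) m ≡ seq (O.sum (λ i → re (f i))) m
re-∑ {ℕ.zero}  f m = refl
re-∑ {ℕ.suc n} f m = ≡.cong (ℚ._+_ (seq (re (f zero)) m)) (re-∑ (λ i → f (suc i)) m)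

im-∑ : ∀ {n} (f : Vector ℂ n) m → seq (im (∑ f)) m ≡ seq (O.sum (λ i → im (f i))) m
im-∑ {ℕ.zero}  f m = refl
im-∑ {ℕ.suc n} f m = ≡.cong (ℚ._+_ (seq (im (f zero)) m)) (im-∑ (λ i → f (suc i)) m)

-- Of |z|² = (re z)² + (im z)², this is the half that an upper bound for the sum calls for;
-- `√-square` supplies it.
∣∣²≤ : ∀ z → ∣ z ∣ ² ≤ re z * re z + im z * im z
∣∣²≤ z = √-square (re z * re z + im z * im z)
  (≤ℝ-trans 0ℝ (0ℝ + 0ℝ) (re z * re z + im z * im z)
    (pointwise-≤ 0ℝ (0ℝ + 0ℝ) λ _ → ℚₚ.≤-refl)
    (pointwise-≤ (0ℝ + 0ℝ) (re z * re z + im z * im z) λ m →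
      ℚₚ.+-mono-≤ (Series.square≥0 (seq (re z) m)) (Series.square≥0 (seq (im z) m))))

positive : ∀ q → 0ℚ ℚ.< q → 0ℝ < fromℚ q
positive q 0<q = q , 0<q , 0 , λ _ _ → ℚₚ.≤-reflexive (ℚₚ.+-identityˡ q)

-- log N ≥ 1/64 gives √(log N) ≥ 1/8, hence 8 √(log N) ≥ 1.
logarithmic-cutoff : ∀ N → 2 ℕ.≤ N → ∀ ρ → 0ℝ ≤ ρ → ρ ≤ fromℕ 8 * ρ * √ (log (fromℕ N))
logarithmic-cutoff N 2≤N ρ 0≤ρ = O.≤-8* {ρ} {√ (log (fromℕ N))} 0≤ρ
  (√-lower (log (fromℕ N)) (+ 1 ℚ./ 8) (ℚₚ.≤ᵇ⇒≤ _)
    (log-lower N 2≤N (+ 1 ℚ./ 64) (ℚₚ.nonNegative⁻¹ (+ 1 ℚ./ 64)) (ℚₚ.≤ᵇ⇒≤ _)))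

√-small : ∀ δ → 0ℝ ≤ δ → δ ≤ fromℚ (+ 1 ℚ./ 256) → √ δ ≤ fromℚ (+ 1 ℚ./ 16)
√-small δ 0≤δ δ≤δ₀ = √-upper δ 0≤δ (+ 1 ℚ./ 16) (ℚₚ.nonNegative⁻¹ (+ 1 ℚ./ 16)) δ≤δ₀

phase-assoc : ∀ k t → fromℕ 2 * π * fromℤ k * t ≈ fromℕ 2 * π * (fromℤ k * t)
phase-assoc k t = pointwise-≈ (fromℕ 2 * π * fromℤ k * t) (fromℕ 2 * π * (fromℤ k * t))
  λ m → ℚₚ.*-assoc (seq (fromℕ 2 * π) m) (seq (fromℤ k) m) (seq t m)

mainTheorem3 : ∃[ δ₀ ] ∃[ C ] (0ℝ < δ₀) × (0ℝ < C) ×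
    (∀ (N : ℕ) .{{_ : NonZero N}} (x : Fin N → 𝕋) (δ : ℝ) (0<δ : 0ℝ < δ) → δ ≤ δ₀ →
    (∀ (s : ℝ) → 1ℝ ≤ s → s ≤ fromℕ 8 * reciprocal δ 0<δ * √ (log (fromℕ N)) →
    ∀ (pairs : List (Fin N × Fin N)) →
    Enumerates pairs (λ (m , n) → m ≢ n × ∥ x m - x n ∥ ≤ s /ℕ N) →
    fromℕ (length pairs) /ℕ N ≤ (1ℝ + δ) * (fromℕ 2 * s)) →
    ∀ (ks : List ℤ) →
    Enumerates ks (λ k → k ≢ 0ℤ × fromℕ ℤ.∣ k ∣ ≤ δ * √ δ * fromℕ N) →
    ∑ᴸ ks (λ k → ∣ ∑ (λ n → e^i (fromℕ 2 * π * fromℤ k * x n)) ∣ ²)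
    ≤ C * δ * fromℕ N ²)
mainTheorem3 = fromℚ δ₀ , fromℕ 82 , positive δ₀ (ℚₚ.positive⁻¹ δ₀) , positive (+ 82 ℚ./ 1) (ℚₚ.positive⁻¹ (+ 82 ℚ./ 1)) ,
  λ N x δ 0<δ δ≤δ₀ sparse ks (unique , enumerated) →
    let ρ   = reciprocal δ 0<δ
        0≤δ = <⇒≤ 0ℝ δ 0<δ
        0≤ρ = reciprocal-nonNeg δ 0<δ
        e : ℤ → Fin N → ℂ
        e k n = e^i (fromℕ 2 * π * fromℤ k * x n)
    in P.exponential-sum-bound ∥_∥ toNearestℤ-upper integerPart N x {δ} {ρ} {√ δ}
      0≤δ δ≤δ₀ 0≤ρ (reciprocal-inverse δ 0<δ) (√-small δ 0≤δ δ≤δ₀)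
      -- The hypothesis is restricted to radii s ≤ 1/δ, which lie in its range once N ≥ 2.
      (λ 2≤N s 1≤s s≤ρ → sparse s 1≤s
        (≤ℝ-trans s ρ (fromℕ 8 * ρ * √ (log (fromℕ N))) s≤ρ (logarithmic-cutoff N 2≤N ρ 0≤ρ)))
      (λ k → ∣ ∑ (e k) ∣ ²) (λ k → re (∑ (e k))) (λ k → im (∑ (e k))) (λ k n → re (e k n)) (λ k n → im (e k n))
      (λ k → ∣∣²≤ (∑ (e k)))
      (λ k → pointwise-≈ (re (∑ (e k))) (O.sum (λ n → re (e k n))) (re-∑ (e k)))
      (λ k → pointwise-≈ (im (∑ (e k))) (O.sum (λ n → im (e k n))) (im-∑ (e k)))
      (λ k n → cos-cong (fromℕ 2 * π * fromℤ k * x n) (fromℕ 2 * π * (fromℤ k * x n)) (phase-assoc k (x n)))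
      (λ k n → sin-cong (fromℕ 2 * π * fromℤ k * x n) (fromℕ 2 * π * (fromℤ k * x n)) (phase-assoc k (x n)))
      ks unique (All.tabulate λ {k} k∈ks → Equivalence.to (enumerated k) k∈ks)
  where
  δ₀ = + 1 ℚ./ 256
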